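{- Let $K$ be an algebraically closed field complete with respect to a nontrivial nonarchimedean absolute value, let $\varphi:\mathbb{P}^N_K\to\mathbb{P}^N_K$ be a morphism of degree $d\ge2$, let $\Phi$ be a lift of $\varphi$, let $\hat g_\Phi$ be the modified Green function, and let $P\in\mathbb{P}^N(K)$. The following are equivalent: (a) $P\in\mathcal{F}(\varphi)$, i.e. the iterates of $\varphi$ are equicontinuous at every point of some neighborhood of $P$; (b) the iterates of $\varphi$ are locally uniformly Lipschitz at $P$, i.e. there exist $r>0$ and $C>0$ with $\Delta(\varphi^n(Q),\varphi^n(R))\le C\,\Delta(Q,R)$ for all $Q,R\in\bar D_r(P)$ and all $n\ge0$; (c) $\hat g_\Phi$ is constant on a neighborhood of $P$.
   Context: For $x\in K^{N+1}$, $\|x\|=\max_i|x_i|$, and $\pi:K^{N+1}\setminus\{0\}\to\mathbb{P}^N(K)$ is the projection. The chordal distance of $P=\pi(x)$, $Q=\pi(y)$ is $\Delta(P,Q)=\max_{i,j}|x_iy_j-x_jy_i|/(\|x\|\,\|y\|)$, and $\bar D_r(P)=\{Q:\Delta(P,Q)\le r\}$. A lift of $\varphi$ is a tuple $\Phi=(\Phi_0,\dots,\Phi_N)$ of degree-$d$ homogeneous polynomials over $K$ with no common nontrivial zero and $\varphi\circ\pi=\pi\circ\Phi$. The Green function is $G_\Phi(x)=\lim_{n\to\infty}d^{ -n}\log\|\Phi^n(x)\|$ (the limit exists) and $\hat g_\Phi(P)=G_\Phi(x)-\log\|x\|$ for $x\in\pi^{ -1}(P)$. A family of maps is equicontinuous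 at $P$ if for every $\epsilon>0$ there is $\delta>0$ with $\Delta(\psi(P),\psi(Q))<\epsilon$ whenever $\Delta(P,Q)<\delta$, for all $\psi$ in the family. The Fatou set $\mathcal{F}(\varphi)$ is the union of all open sets $U\subseteq\mathbb{P}^N(K)$ such that $\{\varphi^n\}_{n\ge1}$ is equicontinuous at every point of $U$. -}

module Defs where

open import Algebra.Bundles using (CommutativeRing; Semiring)
import Algebra.Construct.NaturalChoice.Max as Max
import Algebra.Definitions.RawSemiring as RawSemiring
open import Data.List.Base as List using (List)
open import Data.List.Relation.Unary.All using (All)
open import Data.Nat.Base as ℕ using (ℕ; suc)
import Data.Nat.Properties as ℕ
open import Data.Fin.Base using (Fin; toℕ)
open import Data.Product.Base using (_×_; _,_; ∃; ∃-syntax; proj₁; proj₂)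
open import Data.Vec.Functional as Vector using (Vector)
import Function.Endo.Propositional as Endo
open import Level using (Level; 0ℓ; _⊔_) renaming (suc to lsuc)
open import Relation.Binary.Bundles using (TotalOrder)
open import Relation.Binary.Core using (Rel)
open import Relation.Binary.Structures using (IsTotalOrder)
import Relation.Binary.Construct.NonStrictToStrict as Strict
open import Relation.Nullary using (¬_)
open import Relation.Unary using (Pred)
open import Relation.Binary.PropositionalEquality.Core using (_≡_)

------------------------------------------------------------------------
-- Fields

-- Inversion is total; its value at 0 is unspecified and never used.
record Field (c ℓ : Level) : Set (lsuc (c ⊔ ℓ)) where
  field
    commutativeRing : CommutativeRing c ℓ

  open CommutativeRing commutativeRing public
  open RawSemiring (Semiring.rawSemiring semiring) public
    using (_^_; sum; product) renaming (_×_ to _·_)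

  infix 9 _⁻¹
  field
    0≉1         : 0# ≉ 1#
    _⁻¹         : Carrier → Carrier
    *-inverseʳ  : ∀ {x} → x ≉ 0# → x * x ⁻¹ ≈ 1#

-- Every polynomial a₀ + a₁x + ⋯ + aₘxᵐ with m ≥ 1 and aₘ ≠ 0 has a root.
AlgebraicallyClosed : ∀ {c ℓ} → Field c ℓ → Set (c ⊔ ℓ)
AlgebraicallyClosed K =
  ∀ {n} (a : Vector Carrier (suc (suc n))) → Vector.last a ≉ 0# →
  ∃[ x ] sum (λ i → a i * x ^ toℕ i) ≈ 0#
  where open Field K

------------------------------------------------------------------------
-- The real numbers

-- A Dedekind-complete totally ordered field.  Classically there is exactly
-- one up to unique isomorphism, so quantifying over all of them amounts to
-- speaking about ℝ.
record RealNumbers : Set₁ where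
  field
    realField : Field 0ℓ 0ℓ

  open Field realField public

  infix 4 _≤_
  field
    _≤_          : Rel Carrier 0ℓ
    isTotalOrder : IsTotalOrder _≈_ _≤_
    +-monoˡ-≤    : ∀ z {x y} → x ≤ y → x + z ≤ y + z
    *-nonNeg     : ∀ {x y} → 0# ≤ x → 0# ≤ y → 0# ≤ x * y

  IsUpperBound : Pred Carrier 0ℓ → Carrier → Set
  IsUpperBound S b = ∀ {x} → S x → x ≤ b

  field
    supremum : (S : Pred Carrier 0ℓ) → ∃ S → ∃ (IsUpperBound S) →
               ∃[ s ] IsUpperBound S s × (∀ {b} → IsUpperBound S b → s ≤ b)

  totalOrder : TotalOrder 0ℓ 0ℓ 0ℓ
  totalOrder = record { isTotalOrder = isTotalOrder }

  open Strict _≈_ _≤_ public using (_<_)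
  open Max totalOrder public using () renaming (_⊔_ to max)

  abs : Carrier → Carrier
  abs x = max x (- x)

  -- Only applied to nonempty families of nonnegative numbers, for which
  -- starting the fold at 0 gives the maximum.
  maximum : ∀ {n} → Vector Carrier n → Carrier
  maximum = Vector.foldr max 0#

  ConvergesTo : (ℕ → Carrier) → Carrier → Set
  ConvergesTo u l =
    ∀ ε → 0# < ε → ∃[ M ] (∀ n → M ℕ.≤ n → abs (u n - l) < ε)

-- The homomorphism law and the bound log x ≤ x - 1 single out the natural
-- logarithm: applied to x and to 1/x, the bound gives 1 - 1/x ≤ log x ≤ x - 1,
-- hence log has derivative 1/x.  Values at x ≤ 0 are unspecified.
record NaturalLog (ℝ : RealNumbers) : Set where
  open RealNumbers ℝ
  field
    log      : Carrier → Carrier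
    log-cong : ∀ {x y} → 0# < x → x ≈ y → log x ≈ log y
    log-*    : ∀ {x y} → 0# < x → 0# < y → log (x * y) ≈ log x + log y
    log≤x-1  : ∀ {x} → 0# < x → log x ≤ x - 1#

------------------------------------------------------------------------
-- Nonarchimedean absolute values

module _ (ℝ : RealNumbers) where

  private module ℝ = RealNumbers ℝ

  record NonarchimedeanField (c ℓ : Level) : Set (lsuc (c ⊔ ℓ)) where
    field
      baseField : Field c ℓ

    open Field baseField public

    field
      ∣_∣         : Carrier → ℝ.Carrier
      ∣∣-cong     : ∀ {x y} → x ≈ y → ∣ x ∣ ℝ.≈ ∣ y ∣
      ∣∣-nonNeg   : ∀ x → ℝ.0# ℝ.≤ ∣ x ∣
      ∣0∣≈0       : ∣ 0# ∣ ℝ.≈ ℝ.0#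
      ∣x∣≈0⇒x≈0   : ∀ {x} → ∣ x ∣ ℝ.≈ ℝ.0# → x ≈ 0#
      ∣∣-*        : ∀ x y → ∣ x * y ∣ ℝ.≈ ∣ x ∣ ℝ.* ∣ y ∣
      ∣∣-ultra    : ∀ x y → ∣ x + y ∣ ℝ.≤ ℝ.max ∣ x ∣ ∣ y ∣

  module _ {c ℓ} (K : NonarchimedeanField c ℓ) where

    open NonarchimedeanField K

    Nontrivial : Set (c ⊔ ℓ)
    Nontrivial = ∃[ x ] x ≉ 0# × ¬ (∣ x ∣ ℝ.≈ ℝ.1#)

    Cauchy : (ℕ → Carrier) → Set
    Cauchy u = ∀ ε → ℝ.0# ℝ.< ε →
      ∃[ M ] (∀ m n → M ℕ.≤ m → M ℕ.≤ n → ∣ u m - u n ∣ ℝ.< ε)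

    Complete : Set c
    Complete = ∀ u → Cauchy u →
      ∃[ x ] (∀ ε → ℝ.0# ℝ.< ε → ∃[ M ] (∀ n → M ℕ.≤ n → ∣ u n - x ∣ ℝ.< ε))

------------------------------------------------------------------------
-- Polynomials

module _ {c ℓ} (K : Field c ℓ) where

  open Field K

  -- A polynomial in m variables is written as a formal sum of terms a·Xᵉ,
  -- with e an exponent vector.
  Polynomial : ℕ → Set c
  Polynomial m = List (Carrier × Vector ℕ m)

  eval : ∀ {m} → Polynomial m → Vector Carrier m → Carrier
  eval p x =
    List.foldr (λ (a , e) s → a * product (λ i → x i ^ e i) + s) 0# p

  Homogeneous : ∀ {m} → ℕ → Polynomial m → Set c
  Homogeneous d = All (λ (_ , e) → Vector.foldr ℕ._+_ 0 e ≡ d)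

------------------------------------------------------------------------
-- Dynamics on projective N-space over K

module Dynamics {ℝ : RealNumbers} (ln : NaturalLog ℝ)
                {c ℓ} (K : NonarchimedeanField ℝ c ℓ) (N : ℕ) where

  private module ℝ = RealNumbers ℝ
  open NaturalLog ln
  open NonarchimedeanField K

  Affine : Set c
  Affine = Vector Carrier (suc N)

  IsZero : Affine → Set ℓ
  IsZero x = ∀ i → x i ≈ 0#

  ‖_‖ : Affine → ℝ.Carrier
  ‖ x ‖ = ℝ.maximum (λ i → ∣ x i ∣)

  -- Points of ℙᴺ(K) are given by homogeneous coordinates, with
  -- proportionality _≈ₚ_ as their equality; π is the projection.
  record Point : Set (c ⊔ ℓ) where
    constructor π
    field
      coords  : Affine
      nonzero : ¬ IsZero coords

  open Point public

  infix 4 _≈ₚ_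
  _≈ₚ_ : Rel Point (c ⊔ ℓ)
  P ≈ₚ Q = ∃[ t ] t ≉ 0# × (∀ i → coords P i ≈ t * coords Q i)

  Δ : Point → Point → ℝ.Carrier
  Δ P Q =
    ℝ.maximum (λ i → ℝ.maximum (λ j → ∣ x i * y j - x j * y i ∣))
      ℝ.* (‖ x ‖ ℝ.* ‖ y ‖) ℝ.⁻¹
    where
    x = coords P
    y = coords Q

  ClosedDisk : Point → ℝ.Carrier → Pred Point 0ℓ
  ClosedDisk P r Q = Δ P Q ℝ.≤ r

  -- An open set is automatically closed under _≈ₚ_, because Δ vanishes on
  -- proportional coordinates.
  Open : Pred Point 0ℓ → Set (c ⊔ ℓ)
  Open U = ∀ P → U P → ∃[ r ] ℝ.0# ℝ.< r × (∀ Q → Δ P Q ℝ.< r → U Q)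

  -- Tuples (Φ₀ , … , Φ_N) of polynomials in X₀ , … , X_N.
  PolynomialMap : Set c
  PolynomialMap = Vector (Polynomial baseField (suc N)) (suc N)

  ⟦_⟧ : PolynomialMap → Affine → Affine
  ⟦ Φ ⟧ x i = eval baseField (Φ i) x

  record IsLift (d : ℕ) (φ : Point → Point) (Φ : PolynomialMap)
                : Set (c ⊔ ℓ) where
    field
      homogeneous  : ∀ i → Homogeneous baseField d (Φ i)
      noCommonZero : ∀ x → ¬ IsZero x → ¬ IsZero (⟦ Φ ⟧ x)
      commutes     : ∀ x (x≉0 : ¬ IsZero x) →
                     φ (π x x≉0) ≈ₚ π (⟦ Φ ⟧ x) (noCommonZero x x≉0)

  -- A morphism ℙᴺ → ℙᴺ of degree d, as a map on K-points.
  record Morphism (d : ℕ) : Set (c ⊔ ℓ) where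
    field
      map     : Point → Point
      hasLift : ∃ (IsLift d map)

  iterate : ∀ {d} → Morphism d → ℕ → Point → Point
  iterate φ n = Morphism.map φ ^ₑ n
    where open Endo Point renaming (_^_ to _^ₑ_)

  iterateLift : PolynomialMap → ℕ → Affine → Affine
  iterateLift Φ n = ⟦ Φ ⟧ ^ₑ n
    where open Endo Affine renaming (_^_ to _^ₑ_)

  -- G is the Green function of Φ: G(x) = lim d⁻ⁿ log ‖Φⁿ(x)‖ for x ≠ 0.
  IsGreenFunction : ℕ → PolynomialMap → (Affine → ℝ.Carrier) → Set (c ⊔ ℓ)
  IsGreenFunction d Φ G = ∀ x → ¬ IsZero x →
    ℝ.ConvergesTo
      (λ n → ((d ℕ.^ n) ℝ.· ℝ.1#) ℝ.⁻¹ ℝ.* log ‖ iterateLift Φ n x ‖)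
      (G x)

  -- ĝ, computed from the given homogeneous coordinates.
  modifiedGreen : (Affine → ℝ.Carrier) → Point → ℝ.Carrier
  modifiedGreen G P = G (coords P) ℝ.- log ‖ coords P ‖

  EquicontinuousAt : ∀ {i} {I : Set i} →
                     (I → Point → Point) → Point → Set (i ⊔ c ⊔ ℓ)
  EquicontinuousAt ψ P =
    ∀ ε → ℝ.0# ℝ.< ε → ∃[ δ ] ℝ.0# ℝ.< δ ×
      (∀ k Q → Δ P Q ℝ.< δ → Δ (ψ k P) (ψ k Q) ℝ.< ε)

  FatouSet : ∀ {d} → Morphism d → Pred Point (lsuc 0ℓ ⊔ c ⊔ ℓ)
  FatouSet φ P = ∃[ U ] Open U × U P ×
    (∀ Q → U Q → EquicontinuousAt (λ n → iterate φ (suc n)) Q)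

  LocallyUniformlyLipschitzAt : ∀ {d} → Morphism d → Point → Set (c ⊔ ℓ)
  LocallyUniformlyLipschitzAt φ P =
    ∃[ r ] ∃[ C ] ℝ.0# ℝ.< r × ℝ.0# ℝ.< C ×
      (∀ Q R → ClosedDisk P r Q → ClosedDisk P r R → ∀ n →
         Δ (iterate φ n Q) (iterate φ n R) ℝ.≤ C ℝ.* Δ Q R)

  ConstantNear : (Point → ℝ.Carrier) → Point → Set (lsuc 0ℓ ⊔ c ⊔ ℓ)
  ConstantNear g P = ∃[ U ] Open U × U P ×
    (∀ Q R → U Q → U R → g Q ℝ.≈ g R)

{-# OPTIONS --safe #-}

-- Write x̂ for homogeneous coordinates with ‖ x̂ ‖ = 1.  The Nullstellensatz
-- gives 1 ≤ C ‖ Φ(x̂) ‖, so log ‖ Φ(x) ‖ - d log ‖ x ‖ is bounded, and it is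
-- constant on all balls of one radius δ₀.  If the orbits of P and Q stay within
-- δ₀ of each other, telescoping d⁻ⁿ log ‖ Φⁿ ‖ gives ĝ(P) = ĝ(Q), whence
-- (a) ⇒ (c).  Conversely, if ĝ is constant on a ball, then G is constant on the
-- x̂ over it, and since log ‖ Φⁿ(x̂) ‖ stays within a constant of dⁿ G(x̂), the
-- norms ‖ Φⁿ(x̂) ‖ are comparable uniformly in n.  The maximum principle on
-- lines turns this into a Lipschitz bound, whence (c) ⇒ (b).  Finally (b) ⇒ (a)
-- by the ultrametric inequality.
--
-- The Nullstellensatz is proved modulo the ideal of functions bounded by a
-- multiple of ‖ Φ ‖, by Noether normalisation, Nakayama's lemma and induction
-- on the number of variables.
module Submission where

open import Defs
open import Algebra.Bundles using (CommutativeRing; RawRing)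
import Algebra.Construct.NaturalChoice.Max as Max
import Algebra.Construct.NaturalChoice.MaxOp as MaxOp
import Algebra.Properties.AbelianGroup as AbelianGroupProperties
import Algebra.Properties.CommutativeSemiring.Exp as Exp
import Algebra.Properties.Monoid.Mult as MonoidMultiples
import Algebra.Properties.Monoid.Mult.TCOptimised as MonoidMult
import Algebra.Properties.Ring as RingProperties
import Algebra.Properties.Semiring.Exp as SemiringExp
import Algebra.Properties.Semiring.Mult as SemiringMultiples
import Algebra.Properties.Semiring.Mult.TCOptimised as SemiringMult
import Algebra.Properties.Semiring.Sum as Sum
import Algebra.Solver.Ring as RingSolver
open import Algebra.Solver.Ring.AlmostCommutativeRing
  using (_-Raw-AlmostCommutative⟶_; fromCommutativeRing)
open import Axiom.ExcludedMiddle using (ExcludedMiddle)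
open import Data.Empty using (⊥-elim)
open import Data.Fin.Base as Fin
  using (Fin; zero; suc; toℕ; fromℕ; fromℕ<; punchIn; punchOut)
import Data.Fin.Properties as Fin
open import Data.Integer.Base as ℤ using (ℤ; +_; -[1+_]; _◃_)
import Data.Integer.Properties as ℤ
open import Data.List.Base as List using (List; []; _∷_)
import Data.List.Properties as List
open import Data.List.Relation.Unary.All as All using (All; []; _∷_)
open import Data.Maybe.Base as Maybe using (Maybe)
open import Data.Nat.Base as ℕ using (ℕ; zero; suc)
import Data.Nat.Properties as ℕ
open import Data.Product.Base using (_×_; _,_; ∃; ∃-syntax; proj₁; proj₂; Σ)
open import Data.Sign.Base as Sign using (Sign)
open import Data.Sum.Base using (_⊎_; inj₁; inj₂)
open import Data.Unit.Base using (⊤; tt)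
open import Data.Vec.Functional as Vector using (Vector; insertAt)
import Data.Vec.Functional.Properties as Vector
open import Function.Bundles using (_⇔_; mk⇔)
import Level
open import Relation.Binary.Bundles using (TotalOrder)
import Relation.Binary.Construct.NonStrictToStrict as Strict
open import Relation.Binary.PropositionalEquality as ≡ using (_≡_; _≢_)
import Relation.Binary.Reasoning.PartialOrder as PartialOrderReasoning
import Relation.Binary.Reasoning.Setoid as SetoidReasoning
open import Relation.Nullary using (¬_; yes; no; contradiction; Dec)
open import Relation.Nullary.Decidable using (dec⇒maybe)

-- `K` is not locally compact, so the lower bound for ‖ Φ ‖ on normalised vectors cannot come from
-- compactness. Instead: were 1 not dominated by a multiple of ‖ Φ ‖, the dominated functions would
-- form a proper ideal over the bounded ones, and a common zero of all polynomials in that ideal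
-- would be a forbidden common zero of Φ. In (a) ⇒ (c) the ultrametric inequality yields an equality
-- rather than an estimate: a perturbation of Φ that does not exceed ‖ Φ ‖ at either point leaves ‖
-- Φ ‖ unchanged, so log ‖ Φⁿ ‖ obeys the same recursion along both orbits. In (c) ⇒ (b) the
-- obstacle is that the degree and the coefficients of Φⁿ grow with n, so no Lipschitz constant of
-- the polynomials themselves is uniform. What is uniform is the ratio of ‖ Φⁿ ‖ at two nearby
-- normalised points. On a line it bounds a one-variable polynomial on the whole unit disk, and the
-- Gauss norm turns such a bound into one for differences, whatever the degree. Algebraic closedness
-- enters here: it makes the Gauss norm a value actually taken on the unit circle. Polynomials are
-- handled as unnormalised expressions compared through their values.

-- Integer coefficients have a decidable equality, which the solver needs to
-- see cancellations in an abstract ring.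
module IntegerCoefficientSolver {c ℓ} (R : CommutativeRing c ℓ) where

  open CommutativeRing R
  open MonoidMult +-monoid using (1+×; ×-homo-+) renaming (_×_ to _·_)
  open SemiringMult semiring using (×1-homo-*)
  open RingProperties ring
    using (-‿distribˡ-*; -‿distribʳ-*; -‿involutive; -0#≈0#)
  open AbelianGroupProperties +-abelianGroup using (⁻¹-∙-comm)
  open SetoidReasoning setoid

  private
    -- This form of multiplication computes `1 · 1#` to `1#`, so that `con (+ 1)` in a solver goal
    -- is literally `1#`.
    ι : ℕ → Carrier
    ι n = n · 1#

    fromℤ : ℤ → Carrier
    fromℤ (+ n)    = ι n
    fromℤ -[1+ n ] = - ι (suc n)

    signed : Sign → Carrier → Carrier
    signed Sign.+ x = x
    signed Sign.- x = - x

    cancel : ∀ x y z → (x + y) - (x + z) ≈ y - z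
    cancel x y z = begin
      (x + y) - (x + z)       ≈⟨ +-cong (+-comm x y) (sym (⁻¹-∙-comm x z)) ⟩
      (y + x) + (- x + - z)   ≈⟨ +-assoc y x _ ⟩
      y + (x + (- x + - z))   ≈⟨ +-congˡ (+-assoc x (- x) (- z)) ⟨
      y + ((x - x) + - z)     ≈⟨ +-congˡ (+-congʳ (-‿inverseʳ x)) ⟩
      y + (0# + - z)          ≈⟨ +-congˡ (+-identityˡ (- z)) ⟩
      y - z                   ∎

    fromℤ-⊖ : ∀ m n → fromℤ (m ℤ.⊖ n) ≈ ι m - ι n
    fromℤ-⊖ m zero = sym (trans (+-congˡ -0#≈0#) (+-identityʳ _))
    fromℤ-⊖ zero (suc n) = sym (+-identityˡ _)
    fromℤ-⊖ (suc m) (suc n) = begin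
      fromℤ (suc m ℤ.⊖ suc n)   ≡⟨ ≡.cong fromℤ (ℤ.[1+m]⊖[1+n]≡m⊖n m n) ⟩
      fromℤ (m ℤ.⊖ n)           ≈⟨ fromℤ-⊖ m n ⟩
      ι m - ι n                 ≈⟨ cancel 1# (ι m) (ι n) ⟨
      (1# + ι m) - (1# + ι n)   ≈⟨ +-cong (1+× m 1#) (-‿cong (1+× n 1#)) ⟨
      ι (suc m) - ι (suc n)     ∎

    fromℤ-+ : ∀ i j → fromℤ (i ℤ.+ j) ≈ fromℤ i + fromℤ j
    fromℤ-+ (+ m)    (+ n)    = ×-homo-+ 1# m n
    fromℤ-+ (+ m)    -[1+ n ] = fromℤ-⊖ m (suc n)
    fromℤ-+ -[1+ m ] (+ n)    = trans (fromℤ-⊖ n (suc m)) (+-comm _ _)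
    fromℤ-+ -[1+ m ] -[1+ n ] = begin
      - ι (suc (suc (m ℕ.+ n)))     ≡⟨ ≡.cong (λ k → - ι (suc k)) (ℕ.+-suc m n) ⟨
      - ι (suc m ℕ.+ suc n)         ≈⟨ -‿cong (×-homo-+ 1# (suc m) (suc n)) ⟩
      - (ι (suc m) + ι (suc n))     ≈⟨ ⁻¹-∙-comm _ _ ⟨
      - ι (suc m) + - ι (suc n)     ∎

    fromℤ-◃ : ∀ s n → fromℤ (s ◃ n) ≈ signed s (ι n)
    fromℤ-◃ Sign.+ zero    = refl
    fromℤ-◃ Sign.+ (suc n) = refl
    fromℤ-◃ Sign.- zero    = sym -0#≈0#
    fromℤ-◃ Sign.- (suc n) = refl

    signed-cong : ∀ s {x y} → x ≈ y → signed s x ≈ signed s y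
    signed-cong Sign.+ eq = eq
    signed-cong Sign.- eq = -‿cong eq

    signed-* : ∀ s t x y → signed (s Sign.* t) (x * y) ≈ signed s x * signed t y
    signed-* Sign.+ Sign.+ x y = refl
    signed-* Sign.+ Sign.- x y = -‿distribʳ-* x y
    signed-* Sign.- Sign.+ x y = -‿distribˡ-* x y
    signed-* Sign.- Sign.- x y = begin
      x * y         ≈⟨ -‿involutive (x * y) ⟨
      - - (x * y)   ≈⟨ -‿cong (-‿distribʳ-* x y) ⟩
      - (x * - y)   ≈⟨ -‿distribˡ-* x (- y) ⟩
      - x * - y     ∎

    sign-abs : ∀ i → signed (ℤ.sign i) (ι ℤ.∣ i ∣) ≈ fromℤ i
    sign-abs (+ n)    = refl
    sign-abs -[1+ n ] = refl

    fromℤ-* : ∀ i j → fromℤ (i ℤ.* j) ≈ fromℤ i * fromℤ j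
    fromℤ-* i j = begin
      fromℤ (i ℤ.* j)                       ≈⟨ fromℤ-◃ s (m ℕ.* n) ⟩
      signed s (ι (m ℕ.* n))                ≈⟨ signed-cong s (×1-homo-* m n) ⟩
      signed s (ι m * ι n)                  ≈⟨ signed-* (ℤ.sign i) (ℤ.sign j) (ι m) (ι n) ⟩
      signed (ℤ.sign i) (ι m) * signed (ℤ.sign j) (ι n)
                                            ≈⟨ *-cong (sign-abs i) (sign-abs j) ⟩
      fromℤ i * fromℤ j                     ∎
      where
      s = ℤ.sign i Sign.* ℤ.sign j
      m = ℤ.∣ i ∣
      n = ℤ.∣ j ∣

    fromℤ-neg : ∀ i → fromℤ (ℤ.- i) ≈ - fromℤ i
    fromℤ-neg (+ zero)  = sym -0#≈0#
    fromℤ-neg (+ suc n) = refl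
    fromℤ-neg -[1+ n ]  = sym (-‿involutive _)

    ℤ-rawRing : RawRing _ _
    ℤ-rawRing = CommutativeRing.rawRing ℤ.+-*-commutativeRing

    morphism : ℤ-rawRing -Raw-AlmostCommutative⟶ fromCommutativeRing R
    morphism = record
      { ⟦_⟧    = fromℤ
      ; +-homo = fromℤ-+
      ; *-homo = fromℤ-*
      ; -‿homo = fromℤ-neg
      ; 0-homo = refl
      ; 1-homo = refl
      }

    fromℤ≟ : ∀ i j → Maybe (fromℤ i ≈ fromℤ j)
    fromℤ≟ i j = Maybe.map (λ eq → reflexive (≡.cong fromℤ eq)) (dec⇒maybe (i ℤ.≟ j))

  open RingSolver ℤ-rawRing (fromCommutativeRing R) morphism fromℤ≟ public
    using (solve; _:=_; _:+_; _:*_; _:-_; :-_; con)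

-- Ordered fields, finite maxima and limits

module RealFacts (em : ∀ {a} → ExcludedMiddle a) (ℝ : RealNumbers) where

  open RealNumbers ℝ hiding (zero)
  open TotalOrder totalOrder public
    using (≤-respˡ-≈; ≤-respʳ-≈)
    renaming (refl to ≤-refl; reflexive to ≤-reflexive; trans to ≤-trans;
              antisym to ≤-antisym; total to ≤-total; poset to ≤-poset)
  open MaxOp (Max.maxOperator totalOrder) public
    using (x≤x⊔y; x≤y⊔x; ⊔-lub; ⊔-sel)
  open Exp commutativeSemiring public using (^-congˡ)
  open IntegerCoefficientSolver commutativeRing
  private module ≤-Reasoning = PartialOrderReasoning ≤-poset

  <⇒≤ : ∀ {x y} → x < y → x ≤ y
  <⇒≤ = Strict.<⇒≤ _≈_ _≤_

  <⇒≉ : ∀ {x y} → x < y → x ≉ y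
  <⇒≉ = proj₂

  <⇒≱ : ∀ {x y} → x < y → ¬ (y ≤ x)
  <⇒≱ = Strict.<⇒≱ _≈_ _≤_ ≤-antisym

  ≰⇒> : ∀ {x y} → ¬ (x ≤ y) → y < x
  ≰⇒> = Strict.≰⇒> _≈_ _≤_ sym ≤-reflexive ≤-total

  ≤-or-> : ∀ x y → x ≤ y ⊎ y < x
  ≤-or-> x y with em {P = x ≤ y}
  ... | yes x≤y = inj₁ x≤y
  ... | no x≰y  = inj₂ (≰⇒> x≰y)

  ≮⇒≥ : ∀ {x y} → ¬ (x < y) → y ≤ x
  ≮⇒≥ {x} {y} x≮y with ≤-or-> y x
  ... | inj₁ y≤x = y≤x
  ... | inj₂ x<y = contradiction x<y x≮y

  <-≤-trans : ∀ {x y z} → x < y → y ≤ z → x < z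
  <-≤-trans = Strict.<-≤-trans _≈_ _≤_ sym ≤-trans ≤-antisym ≤-respʳ-≈

  ≤-<-trans : ∀ {x y z} → x ≤ y → y < z → x < z
  ≤-<-trans = Strict.≤-<-trans _≈_ _≤_ ≤-trans ≤-antisym ≤-respˡ-≈

  <-respʳ-≈ : ∀ {x y z} → y ≈ z → x < y → x < z
  <-respʳ-≈ y≈z x<y = <-≤-trans x<y (≤-reflexive y≈z)

  <-respˡ-≈ : ∀ {x y z} → y ≈ z → y < x → z < x
  <-respˡ-≈ y≈z y<x = ≤-<-trans (≤-reflexive (sym y≈z)) y<x

  max-<-lub : ∀ {x y z} → x < z → y < z → max x y < z
  max-<-lub {x} {y} x<z y<z with ⊔-sel x y
  ... | inj₁ eq = <-respˡ-≈ (sym eq) x<z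
  ... | inj₂ eq = <-respˡ-≈ (sym eq) y<z

  +-mono-≤ : ∀ {x y u v} → x ≤ y → u ≤ v → x + u ≤ y + v
  +-mono-≤ {x} {y} {u} {v} x≤y u≤v = begin
    x + u ≤⟨ +-monoˡ-≤ u x≤y ⟩
    y + u ≈⟨ +-comm y u ⟩
    u + y ≤⟨ +-monoˡ-≤ y u≤v ⟩
    v + y ≈⟨ +-comm v y ⟩
    y + v ∎
    where open ≤-Reasoning

  +-cancelʳ-≤ : ∀ z {x y} → x + z ≤ y + z → x ≤ y
  +-cancelʳ-≤ z {x} {y} p = begin
    x           ≈⟨ solve 2 (λ x z → x := (x :+ z) :- z) refl x z ⟩
    (x + z) - z ≤⟨ +-monoˡ-≤ (- z) p ⟩
    (y + z) - z ≈⟨ solve 2 (λ x z → x := (x :+ z) :- z) refl y z ⟨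
    y           ∎
    where open ≤-Reasoning

  +-monoˡ-< : ∀ z {x y} → x < y → x + z < y + z
  +-monoˡ-< z x<y = ≰⇒> (λ p → <⇒≱ x<y (+-cancelʳ-≤ z p))

  +-mono-<-≤ : ∀ {x y u v} → x < y → u ≤ v → x + u < y + v
  +-mono-<-≤ {x} {y} {u} {v} x<y u≤v =
    <-≤-trans (+-monoˡ-< u x<y) (+-mono-≤ ≤-refl u≤v)

  +-mono-≤-< : ∀ {x y u v} → x ≤ y → u < v → x + u < y + v
  +-mono-≤-< {x} {y} {u} {v} x≤y u<v =
    <-respˡ-≈ (+-comm u x) (<-respʳ-≈ (+-comm v y) (+-mono-<-≤ u<v x≤y))

  neg-mono-≤ : ∀ {x y} → x ≤ y → - y ≤ - x
  neg-mono-≤ {x} {y} x≤y = +-cancelʳ-≤ (x + y) (begin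
    - y + (x + y) ≈⟨ solve 2 (λ x y → :- y :+ (x :+ y) := x) refl x y ⟩
    x             ≤⟨ x≤y ⟩
    y             ≈⟨ solve 2 (λ x y → :- x :+ (x :+ y) := y) refl x y ⟨
    - x + (x + y) ∎)
    where open ≤-Reasoning

  x≤y⇒0≤y-x : ∀ {x y} → x ≤ y → 0# ≤ y - x
  x≤y⇒0≤y-x {x} x≤y = ≤-respˡ-≈ (-‿inverseʳ x) (+-monoˡ-≤ (- x) x≤y)

  0≤y-x⇒x≤y : ∀ {x y} → 0# ≤ y - x → x ≤ y
  0≤y-x⇒x≤y {x} {y} p = +-cancelʳ-≤ (- x) (≤-respˡ-≈ (sym (-‿inverseʳ x)) p)

  x<y⇒0<y-x : ∀ {x y} → x < y → 0# < y - x
  x<y⇒0<y-x {x} x<y = <-respˡ-≈ (-‿inverseʳ x) (+-monoˡ-< (- x) x<y)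

  *-monoˡ-≤ : ∀ {z x y} → 0# ≤ z → x ≤ y → z * x ≤ z * y
  *-monoˡ-≤ {z} {x} {y} 0≤z x≤y = 0≤y-x⇒x≤y (≤-respʳ-≈
    (solve 3 (λ x y z → z :* (y :- x) := z :* y :- z :* x) refl x y z)
    (*-nonNeg 0≤z (x≤y⇒0≤y-x x≤y)))

  *-monoʳ-≤ : ∀ {z x y} → 0# ≤ z → x ≤ y → x * z ≤ y * z
  *-monoʳ-≤ {z} {x} {y} 0≤z x≤y =
    ≤-respˡ-≈ (*-comm z x) (≤-respʳ-≈ (*-comm z y) (*-monoˡ-≤ 0≤z x≤y))

  *-mono-≤ : ∀ {x y u v} → 0# ≤ y → 0# ≤ u → x ≤ y → u ≤ v → x * u ≤ y * v
  *-mono-≤ 0≤y 0≤u x≤y u≤v = ≤-trans (*-monoʳ-≤ 0≤u x≤y) (*-monoˡ-≤ 0≤y u≤v)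

  *-cancelˡ-≈ : ∀ {z x y} → z ≉ 0# → z * x ≈ z * y → x ≈ y
  *-cancelˡ-≈ {z} {x} {y} z≉0 eq = begin-equality
    x              ≈⟨ lemma x ⟩
    z ⁻¹ * (z * x) ≈⟨ *-congˡ eq ⟩
    z ⁻¹ * (z * y) ≈⟨ lemma y ⟨
    y              ∎
    where
    open ≤-Reasoning
    lemma : ∀ x → x ≈ z ⁻¹ * (z * x)
    lemma x = begin-equality
      x              ≈⟨ *-identityˡ x ⟨
      1# * x         ≈⟨ *-congʳ (*-inverseʳ z≉0) ⟨
      z * z ⁻¹ * x   ≈⟨ solve 3 (λ z w x → z :* w :* x := w :* (z :* x)) refl z (z ⁻¹) x ⟩
      z ⁻¹ * (z * x) ∎

  *-monoˡ-< : ∀ {z x y} → 0# < z → x < y → z * x < z * y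
  *-monoˡ-< 0<z x<y = *-monoˡ-≤ (<⇒≤ 0<z) (<⇒≤ x<y) ,
    λ eq → <⇒≉ x<y (*-cancelˡ-≈ (λ z≈0 → <⇒≉ 0<z (sym z≈0)) eq)

  *-monoʳ-< : ∀ {z x y} → 0# < z → x < y → x * z < y * z
  *-monoʳ-< {z} {x} {y} 0<z x<y =
    <-respˡ-≈ (*-comm z x) (<-respʳ-≈ (*-comm z y) (*-monoˡ-< 0<z x<y))

  *-cancelˡ-≤ : ∀ {z x y} → 0# < z → z * x ≤ z * y → x ≤ y
  *-cancelˡ-≤ 0<z p = ≮⇒≥ (λ y<x → <⇒≱ (*-monoˡ-< 0<z y<x) p)

  *-cancelʳ-≤ : ∀ {z x y} → 0# < z → x * z ≤ y * z → x ≤ y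
  *-cancelʳ-≤ 0<z p = ≮⇒≥ (λ y<x → <⇒≱ (*-monoʳ-< 0<z y<x) p)

  *-pos : ∀ {x y} → 0# < x → 0# < y → 0# < x * y
  *-pos {x} 0<x 0<y = <-respˡ-≈ (zeroʳ x) (*-monoˡ-< 0<x 0<y)

  0≤1 : 0# ≤ 1#
  0≤1 with ≤-total 0# 1#
  ... | inj₁ 0≤1 = 0≤1
  ... | inj₂ 1≤0 = ≤-respʳ-≈ (solve 0 (:- con (+ 1) :* :- con (+ 1) := con (+ 1)) refl)
                     (*-nonNeg 0≤-1 0≤-1)
    where
    0≤-1 : 0# ≤ - 1#
    0≤-1 = ≤-respʳ-≈ (+-identityˡ (- 1#)) (x≤y⇒0≤y-x 1≤0)

  0<1 : 0# < 1#
  0<1 = 0≤1 , 0≉1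

  pos⇒≉0 : ∀ {x} → 0# < x → x ≉ 0#
  pos⇒≉0 0<x x≈0 = <⇒≉ 0<x (sym x≈0)

  ⁻¹-inverseʳ : ∀ {x} → 0# < x → x * x ⁻¹ ≈ 1#
  ⁻¹-inverseʳ 0<x = *-inverseʳ (pos⇒≉0 0<x)

  ⁻¹-pos : ∀ {x} → 0# < x → 0# < x ⁻¹
  ⁻¹-pos {x} 0<x = ≰⇒> λ x⁻¹≤0 → <⇒≱ 0<1 (begin
    1#        ≈⟨ ⁻¹-inverseʳ 0<x ⟨
    x * x ⁻¹  ≤⟨ *-monoˡ-≤ (<⇒≤ 0<x) x⁻¹≤0 ⟩
    x * 0#    ≈⟨ zeroʳ x ⟩
    0#        ∎)
    where open ≤-Reasoning

  x*y⁻¹*y≈x : ∀ {y} x → 0# < y → x * y ⁻¹ * y ≈ x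
  x*y⁻¹*y≈x {y} x 0<y = begin-equality
    x * y ⁻¹ * y    ≈⟨ solve 3 (λ x w y → x :* w :* y := x :* (y :* w)) refl x (y ⁻¹) y ⟩
    x * (y * y ⁻¹)  ≈⟨ *-congˡ (⁻¹-inverseʳ 0<y) ⟩
    x * 1#          ≈⟨ *-identityʳ x ⟩
    x               ∎
    where open ≤-Reasoning

  x/y≤z⇒x≤zy : ∀ {x y z} → 0# < y → x * y ⁻¹ ≤ z → x ≤ z * y
  x/y≤z⇒x≤zy {x} 0<y p = ≤-respˡ-≈ (x*y⁻¹*y≈x x 0<y) (*-monoʳ-≤ (<⇒≤ 0<y) p)

  x≤zy⇒x/y≤z : ∀ {x y z} → 0# < y → x ≤ z * y → x * y ⁻¹ ≤ z
  x≤zy⇒x/y≤z {x} 0<y p = *-cancelʳ-≤ 0<y (≤-respˡ-≈ (sym (x*y⁻¹*y≈x x 0<y)) p)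

  x/y<z⇒x<zy : ∀ {x y z} → 0# < y → x * y ⁻¹ < z → x < z * y
  x/y<z⇒x<zy {x} 0<y p = <-respˡ-≈ (x*y⁻¹*y≈x x 0<y) (*-monoʳ-< 0<y p)

  x<zy⇒x/y<z : ∀ {x y z} → 0# < y → x < z * y → x * y ⁻¹ < z
  x<zy⇒x/y<z {x} {y} {z} 0<y p = ≰⇒> λ q →
    <⇒≱ p (≤-respʳ-≈ (x*y⁻¹*y≈x x 0<y) (*-monoʳ-≤ (<⇒≤ 0<y) q))

  ^-pos : ∀ {x} n → 0# < x → 0# < x ^ n
  ^-pos zero    0<x = 0<1
  ^-pos (suc n) 0<x = *-pos 0<x (^-pos n 0<x)

  2# : Carrier
  2# = 1# + 1#

  0<2 : 0# < 2#
  0<2 = <-respˡ-≈ (+-identityˡ 0#) (+-mono-<-≤ 0<1 0≤1)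

  half : ∀ {x} → 0# < x → ∃[ y ] 0# < y × y + y ≈ x
  half {x} 0<x = x * 2# ⁻¹ , *-pos 0<x (⁻¹-pos 0<2) , trans
    (solve 2 (λ x w → x :* w :+ x :* w := x :* w :* (con (+ 1) :+ con (+ 1))) refl x (2# ⁻¹))
    (x*y⁻¹*y≈x x 0<2)

  x≤abs : ∀ x → x ≤ abs x
  x≤abs x = x≤x⊔y x (- x)

  -x≤abs : ∀ x → - x ≤ abs x
  -x≤abs x = x≤y⊔x x (- x)

  -- This identity and the following ones are solved here because, where they are used, the solver
  -- in scope is the one over the valued field.
  x*[y*z]≈y*[x*z] : ∀ x y z → x * (y * z) ≈ y * (x * z)
  x*[y*z]≈y*[x*z] = solve 3 (λ x y z → x :* (y :* z) := y :* (x :* z)) refl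

  x*[y*z]≈y*x*z : ∀ x y z → x * (y * z) ≈ y * x * z
  x*[y*z]≈y*x*z = solve 3 (λ x y z → x :* (y :* z) := y :* x :* z) refl

  x*y*z≈z*y*x : ∀ x y z → x * y * z ≈ z * y * x
  x*y*z≈z*y*x = solve 3 (λ x y z → x :* y :* z := z :* y :* x) refl

  rearrange₁ : ∀ z r x y → z * (r * (x * y)) ≈ y * (r * (x * z))
  rearrange₁ = solve 4 (λ z r x y → z :* (r :* (x :* y)) := y :* (r :* (x :* z))) refl

  rearrange₂ : ∀ x r y z → x * (r * (y * z)) ≈ y * (r * (x * z))
  rearrange₂ = solve 4 (λ x r y z → x :* (r :* (y :* z)) := y :* (r :* (x :* z))) refl

  rearrange₃ : ∀ r t x s y → r * ((t * x) * (s * y)) ≈ t * s * (r * (x * y))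
  rearrange₃ = solve 5 (λ r t x s y → r :* ((t :* x) :* (s :* y)) := t :* s :* (r :* (x :* y))) refl

  rearrange₄ : ∀ y c z k s → y * (c * (c * z) * (k * s)) ≈ c * c * k * s * (y * z)
  rearrange₄ = solve 5 (λ y c z k s → y :* (c :* (c :* z) :* (k :* s)) := c :* c :* k :* s :* (y :* z)) refl

  x≈[x-y]+y : ∀ x y → x ≈ (x - y) + y
  x≈[x-y]+y = solve 2 (λ x y → x := (x :- y) :+ y) refl

  ≤-maximum : ∀ {n} (v : Vector Carrier n) i → v i ≤ maximum v
  ≤-maximum v zero    = x≤x⊔y _ _
  ≤-maximum v (suc i) = ≤-trans (≤-maximum (Vector.tail v) i) (x≤y⊔x _ _)

  maximum-nonNeg : ∀ {n} (v : Vector Carrier n) → 0# ≤ maximum v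
  maximum-nonNeg {zero}  v = ≤-refl
  maximum-nonNeg {suc n} v = ≤-trans (maximum-nonNeg (Vector.tail v)) (x≤y⊔x _ _)

  maximum-≤ : ∀ {n} (v : Vector Carrier n) {b} → 0# ≤ b → (∀ i → v i ≤ b) → maximum v ≤ b
  maximum-≤ {zero}  v 0≤b p = 0≤b
  maximum-≤ {suc n} v 0≤b p = ⊔-lub (p zero) (maximum-≤ (Vector.tail v) 0≤b (λ i → p (suc i)))

  -- Positivity rules out the starting value 0 of the fold, which need not be an entry.
  maximum-attained : ∀ {n} (v : Vector Carrier n) → 0# < maximum v → ∃[ i ] maximum v ≈ v i
  maximum-attained {zero}  v 0<0 = contradiction refl (<⇒≉ 0<0)
  maximum-attained {suc n} v 0<m with ⊔-sel (v zero) (maximum (Vector.tail v))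
  ... | inj₁ eq = zero , eq
  ... | inj₂ eq with maximum-attained (Vector.tail v) (<-respʳ-≈ eq 0<m)
  ...   | i , eq′ = suc i , trans eq eq′

  -- If s bounds all powers of x, then so does s / x.
  powers-unbounded : ∀ {x} → 1# < x → ∀ b → ∃[ n ] b < x ^ n
  powers-unbounded {x} 1<x b with em {P = ∃[ n ] b < x ^ n}
  ... | yes p = p
  ... | no ¬p = ⊥-elim (<⇒≱ s<s*x (s*x≤s (s-least divided-bound)))
    where
    open ≤-Reasoning
    0<x = ≤-<-trans 0≤1 1<x
    Power : Carrier → Set
    Power y = ∃[ n ] y ≈ x ^ n
    sup = supremum Power (1# , 0 , refl)
            (b , λ (n , y≈) → ≤-respˡ-≈ (sym y≈) (≮⇒≥ λ q → ¬p (n , q)))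
    s = proj₁ sup
    s-bound = proj₁ (proj₂ sup)
    s-least = proj₂ (proj₂ sup)
    s<s*x : s < s * x
    s<s*x = <-respˡ-≈ (*-identityʳ s) (*-monoˡ-< (<-≤-trans 0<1 (s-bound (0 , refl))) 1<x)
    s*x≤s : s ≤ s * x ⁻¹ → s * x ≤ s
    s*x≤s p = ≤-respʳ-≈ (x*y⁻¹*y≈x s 0<x) (*-monoʳ-≤ (<⇒≤ 0<x) p)
    divided-bound : IsUpperBound Power (s * x ⁻¹)
    divided-bound {y} (n , y≈) = *-cancelʳ-≤ 0<x (begin
      y * x             ≈⟨ trans (*-comm y x) (*-congˡ y≈) ⟩
      x * x ^ n         ≤⟨ s-bound (suc n , refl) ⟩
      s                 ≈⟨ x*y⁻¹*y≈x s 0<x ⟨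
      s * x ⁻¹ * x      ∎)

  -- If l + k < l′, then at a common late index both sequences are within half the gap of their
  -- limits, against the termwise inequality.
  limit-shift : ∀ {u v l l′ k} → ConvergesTo u l → ConvergesTo v l′ →
                (∀ n → v n ≤ u n + k) → l′ ≤ l + k
  limit-shift {u} {v} {l} {l′} {k} u→l v→l′ v≤u+k = ≮⇒≥ λ l+k<l′ →
    let (δ , 0<δ , δ+δ≈ε) = half (x<y⇒0<y-x l+k<l′)
        (M , hu) = u→l δ 0<δ
        (M′ , hv) = v→l′ δ 0<δ
        n = M ℕ.⊔ M′
        open ≤-Reasoning
    in <⇒≱ (≤-<-trans (-x≤abs (v n - l′)) (hv n (ℕ.m≤n⊔m M M′))) (+-cancelʳ-≤ δ (begin
       δ + δ                    ≈⟨ δ+δ≈ε ⟩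
       l′ - (l + k)             ≈⟨ solve 5 (λ l′ l k u v → l′ :- (l :+ k) :=
                                     (:- (v :- l′) :+ (v :+ (:- (u :+ k)))) :+ (u :- l)) refl l′ l k (u n) (v n) ⟩
       - (v n - l′) + (v n - (u n + k)) + (u n - l)
                                ≤⟨ +-mono-≤ (+-mono-≤ ≤-refl (nonPos (v≤u+k n)))
                                     (≤-trans (x≤abs _) (<⇒≤ (hu n (ℕ.m≤m⊔n M M′)))) ⟩
       - (v n - l′) + 0# + δ    ≈⟨ +-congʳ (+-identityʳ _) ⟩
       - (v n - l′) + δ         ∎))
    where
    nonPos : ∀ {x y} → x ≤ y → x - y ≤ 0#
    nonPos {x} {y} x≤y = ≤-respʳ-≈ (-‿inverseʳ y) (+-monoˡ-≤ (- y) x≤y)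

  limit-≤-from : ∀ {u l b} N → ConvergesTo u l → (∀ n → N ℕ.≤ n → u n ≤ b) → l ≤ b
  limit-≤-from {u} {l} {b} N u→l u≤b = ≮⇒≥ λ b<l →
    let (M , hu) = u→l (l - b) (x<y⇒0<y-x b<l)
        n = M ℕ.⊔ N
        open ≤-Reasoning
    in <⇒≱ (≤-<-trans (-x≤abs (u n - l)) (hu n (ℕ.m≤m⊔n M N))) (begin
       l - b          ≤⟨ +-mono-≤ ≤-refl (neg-mono-≤ (u≤b n (ℕ.m≤n⊔m M N))) ⟩
       l - u n        ≈⟨ solve 2 (λ l u → l :- u := :- (u :- l)) refl l (u n) ⟩
       - (u n - l)    ∎)

  limit-≥-from : ∀ {u l b} N → ConvergesTo u l → (∀ n → N ℕ.≤ n → b ≤ u n) → b ≤ l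
  limit-≥-from {u} {l} {b} N u→l b≤u = ≮⇒≥ λ l<b →
    let (M , hu) = u→l (b - l) (x<y⇒0<y-x l<b)
        n = M ℕ.⊔ N
    in <⇒≱ (≤-<-trans (x≤abs (u n - l)) (hu n (ℕ.m≤m⊔n M N)))
       (+-monoˡ-≤ (- l) (b≤u n (ℕ.m≤n⊔m M N)))

-- Consequences of the axioms for the logarithm

module LogFacts (em : ∀ {a} → ExcludedMiddle a) {ℝ : RealNumbers} (ln : NaturalLog ℝ) where

  open RealNumbers ℝ hiding (zero)
  open NaturalLog ln
  open RealFacts em ℝ
  open IntegerCoefficientSolver commutativeRing
  private module ≤-Reasoning = PartialOrderReasoning ≤-poset

  log-1 : log 1# ≈ 0#
  log-1 = begin-equality
    log 1#                        ≈⟨ solve 1 (λ x → x := (x :+ x) :- x) refl (log 1#) ⟩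
    (log 1# + log 1#) - log 1#    ≈⟨ +-congʳ (log-* 0<1 0<1) ⟨
    log (1# * 1#) - log 1#        ≈⟨ +-congʳ (log-cong (*-pos 0<1 0<1) (*-identityˡ 1#)) ⟩
    log 1# - log 1#               ≈⟨ -‿inverseʳ _ ⟩
    0#                            ∎
    where open ≤-Reasoning

  -- Since x / y < 1, the bound gives log (x / y) ≤ x / y - 1 < 0, and log x = log (x / y) + log y.
  log-mono-< : ∀ {x y} → 0# < x → x < y → log x < log y
  log-mono-< {x} {y} 0<x x<y = begin-strict
    log x                       ≈⟨ log-cong 0<x (sym (x*y⁻¹*y≈x x 0<y)) ⟩
    log (x * y ⁻¹ * y)          ≈⟨ log-* 0<x/y 0<y ⟩
    log (x * y ⁻¹) + log y      ≤⟨ +-monoˡ-≤ (log y) (log≤x-1 0<x/y) ⟩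
    (x * y ⁻¹ - 1#) + log y     <⟨ +-monoˡ-< (log y) (+-monoˡ-< (- 1#)
                                    (x<zy⇒x/y<z 0<y (<-respʳ-≈ (sym (*-identityˡ y)) x<y))) ⟩
    (1# - 1#) + log y           ≈⟨ solve 1 (λ z → (con (+ 1) :- con (+ 1)) :+ z := z) refl (log y) ⟩
    log y                       ∎
    where
    open ≤-Reasoning
    0<y : 0# < y
    0<y = <-≤-trans 0<x (<⇒≤ x<y)
    0<x/y : 0# < x * y ⁻¹
    0<x/y = *-pos 0<x (⁻¹-pos 0<y)

  log-mono-≤ : ∀ {x y} → 0# < x → x ≤ y → log x ≤ log y
  log-mono-≤ {x} {y} 0<x x≤y with em {P = x ≈ y}
  ... | yes x≈y = ≤-reflexive (log-cong 0<x x≈y)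
  ... | no x≉y  = <⇒≤ (log-mono-< 0<x (x≤y , x≉y))

  log-cancel-≤ : ∀ {x y} → 0# < y → log x ≤ log y → x ≤ y
  log-cancel-≤ 0<y p = ≮⇒≥ λ y<x → <⇒≱ (log-mono-< 0<y y<x) p

  log-^ : ∀ {x} n → 0# < x → log (x ^ n) ≈ (n · 1#) * log x
  log-^ {x} zero    0<x = trans log-1 (sym (zeroˡ (log x)))
  log-^ {x} (suc n) 0<x = begin-equality
    log (x * x ^ n)              ≈⟨ log-* 0<x (^-pos n 0<x) ⟩
    log x + log (x ^ n)          ≈⟨ +-congˡ (log-^ n 0<x) ⟩
    log x + (n · 1#) * log x     ≈⟨ solve 2 (λ a l → l :+ a :* l := (con (+ 1) :+ a) :* l) refl (n · 1#) (log x) ⟩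
    (1# + n · 1#) * log x        ∎
    where open ≤-Reasoning

  0<log2 : 0# < log 2#
  0<log2 = <-respˡ-≈ log-1 (log-mono-< 0<1 (<-respˡ-≈ (+-identityʳ 1#) (+-mono-≤-< ≤-refl 0<1)))

  -- A supremum s of the values of log would satisfy s ≤ s - log 2.
  log-unbounded : ∀ b → ∃[ x ] 0# < x × b < log x
  log-unbounded b with em {P = ∃[ x ] 0# < x × b < log x}
  ... | yes p = p
  ... | no ¬p = ⊥-elim (<⇒≱ 0<log2 (+-cancelʳ-≤ s (begin
      log 2# + s                 ≤⟨ +-mono-≤ ≤-refl (s-least shifted-bound) ⟩
      log 2# + (s - log 2#)      ≈⟨ solve 2 (λ l s → l :+ (s :- l) := con (+ 0) :+ s) refl (log 2#) s ⟩
      0# + s                     ∎)))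
    where
    open ≤-Reasoning
    LogValue : Carrier → Set
    LogValue y = ∃[ x ] 0# < x × y ≈ log x
    sup = supremum LogValue (log 1# , 1# , 0<1 , refl)
            (b , λ (x , 0<x , y≈) → ≤-respˡ-≈ (sym y≈) (≮⇒≥ λ q → ¬p (x , 0<x , q)))
    s = proj₁ sup
    s-least = proj₂ (proj₂ sup)
    shifted-bound : IsUpperBound LogValue (s - log 2#)
    shifted-bound {y} (x , 0<x , y≈) = +-cancelʳ-≤ (log 2#) (begin
      y + log 2#            ≈⟨ +-congʳ y≈ ⟩
      log x + log 2#        ≈⟨ log-* 0<x 0<2 ⟨
      log (x * 2#)          ≤⟨ proj₁ (proj₂ sup) (x * 2# , *-pos 0<x 0<2 , refl) ⟩
      s                     ≈⟨ solve 2 (λ s l → s := (s :- l) :+ l) refl s (log 2#) ⟩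
      (s - log 2#) + log 2# ∎)

-- Polynomials in one variable over a field

module FieldFacts {c ℓ} (F : Field c ℓ) where

  open Field F hiding (zero)
  open IntegerCoefficientSolver commutativeRing
  open Sum semiring using (*-distribˡ-sum; sum-cong-≋)
  open SetoidReasoning setoid

  x⁻¹*[x*y]≈y : ∀ {x} → x ≉ 0# → ∀ y → x ⁻¹ * (x * y) ≈ y
  x⁻¹*[x*y]≈y {x} x≉0 y = begin
    x ⁻¹ * (x * y) ≈⟨ solve 3 (λ x w y → w :* (x :* y) := x :* w :* y) refl x (x ⁻¹) y ⟩
    x * x ⁻¹ * y   ≈⟨ *-congʳ (*-inverseʳ x≉0) ⟩
    1# * y         ≈⟨ *-identityˡ y ⟩
    y              ∎

  *-nonzero : ∀ {x y} → x ≉ 0# → y ≉ 0# → x * y ≉ 0#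
  *-nonzero {x} {y} x≉0 y≉0 xy≈0 = y≉0 (begin
    y              ≈⟨ x⁻¹*[x*y]≈y x≉0 y ⟨
    x ⁻¹ * (x * y) ≈⟨ *-congˡ xy≈0 ⟩
    x ⁻¹ * 0#      ≈⟨ zeroʳ _ ⟩
    0#             ∎)

  ⁻¹-nonzero : ∀ {x} → x ≉ 0# → x ⁻¹ ≉ 0#
  ⁻¹-nonzero {x} x≉0 x⁻¹≈0 = 0≉1 (begin
    0#       ≈⟨ zeroʳ x ⟨
    x * 0#   ≈⟨ *-congˡ x⁻¹≈0 ⟨
    x * x ⁻¹ ≈⟨ *-inverseʳ x≉0 ⟩
    1#       ∎)

  -- Polynomials in one variable, as lists of coefficients with the constant
  -- term first

  horner : List Carrier → Carrier → Carrier
  horner []       t = 0#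
  horner (a ∷ as) t = a + t * horner as t

  -- Holds over every infinite field. It is isolated as a property so that the Nullstellensatz can
  -- be proved over a bare field; the valued field supplies it through the Gauss norm.
  DeterminesCoefficients : Set (c Level.⊔ ℓ)
  DeterminesCoefficients = ∀ as → (∀ t → horner as t ≈ 0#) → All (_≈ 0#) as

  -- The degree is an index so that dividing by a linear factor visibly lowers it, which is what
  -- later recursions descend on.
  data Leading (β : Carrier) : ℕ → List Carrier → Set (c Level.⊔ ℓ) where
    [_] : ∀ {b} → b ≈ β → Leading β 0 (b ∷ [])
    _∷_ : ∀ {n as} a → Leading β n as → Leading β (suc n) (a ∷ as)

  private
    toVector : ∀ {β n as} → Leading β n as → Vector Carrier (suc n)
    toVector ([_] {b} _)          = b Vector.∷ Vector.[]
    toVector (a ∷ l) zero         = a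
    toVector (a ∷ l) (suc i)      = toVector l i

    toVector-last : ∀ {β n as} (l : Leading β n as) → toVector l (fromℕ n) ≈ β
    toVector-last [ b≈β ] = b≈β
    toVector-last (a ∷ l) = toVector-last l

    cons-sum : ∀ {n} (v : Vector Carrier (suc n)) t →
               sum (λ i → v i * t ^ toℕ i) ≈
               v zero + t * sum (λ i → v (suc i) * t ^ toℕ i)
    cons-sum v t = +-cong (*-identityʳ _) (begin
      sum (λ i → v (suc i) * (t * t ^ toℕ i))
        ≈⟨ sum-cong-≋ (λ i → solve 3 (λ a t p → a :* (t :* p) := t :* (a :* p)) refl (v (suc i)) t (t ^ toℕ i)) ⟩
      sum (λ i → t * (v (suc i) * t ^ toℕ i))
        ≈⟨ *-distribˡ-sum t (λ i → v (suc i) * t ^ toℕ i) ⟨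
      t * sum (λ i → v (suc i) * t ^ toℕ i) ∎)

    toVector-horner : ∀ {β n as} (l : Leading β n as) t →
                      sum (λ i → toVector l i * t ^ toℕ i) ≈ horner as t
    toVector-horner l@([_] {b} _) t = trans (cons-sum (toVector l) t) refl
    toVector-horner (a ∷ l) t =
      trans (cons-sum (toVector (a ∷ l)) t) (+-congˡ (*-congˡ (toVector-horner l t)))

  horner-root : AlgebraicallyClosed F → ∀ {β n as} → Leading β (suc n) as → β ≉ 0# →
                ∃[ t ] horner as t ≈ 0#
  horner-root closed l β≉0
    with closed (toVector l) (λ eq → β≉0 (trans (sym (toVector-last l)) eq))
  ... | t , eq = t , trans (sym (toVector-horner l t)) eq

  -- Synthetic division: the coefficients of (as(X) - as(t)) / (X - t) are the Horner values at t of
  -- the proper tails of `as`.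
  quotient : Carrier → List Carrier → List Carrier
  quotient t []           = []
  quotient t (a ∷ [])     = []
  quotient t (a ∷ b ∷ bs) = horner (b ∷ bs) t ∷ quotient t (b ∷ bs)

  horner-quotient : ∀ t as u → horner as u - horner as t ≈ (u - t) * horner (quotient t as) u
  horner-quotient t []       u = solve 2 (λ t u → con (+ 0) :- con (+ 0) := (u :- t) :* con (+ 0)) refl t u
  horner-quotient t (a ∷ []) u = solve 3 (λ a t u →
    (a :+ u :* con (+ 0)) :- (a :+ t :* con (+ 0)) := (u :- t) :* con (+ 0)) refl a t u
  horner-quotient t (a ∷ as@(b ∷ bs)) u = begin
    (a + u * hu) - (a + t * ht)     ≈⟨ solve 5 (λ a t u ht hu →
        (a :+ u :* hu) :- (a :+ t :* ht) := (u :- t) :* ht :+ u :* (hu :- ht)) refl a t u ht hu ⟩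
    (u - t) * ht + u * (hu - ht)    ≈⟨ +-congˡ (*-congˡ (horner-quotient t as u)) ⟩
    (u - t) * ht + u * ((u - t) * q) ≈⟨ solve 4 (λ t u ht q →
        (u :- t) :* ht :+ u :* ((u :- t) :* q) := (u :- t) :* (ht :+ u :* q)) refl t u ht q ⟩
    (u - t) * (ht + u * q)          ∎
    where
    hu = horner as u
    ht = horner as t
    q = horner (quotient t as) u

  quotient-Leading : ∀ t {β n as} → Leading β (suc n) as → Leading β n (quotient t as)
  quotient-Leading t (_∷_ a ([_] {b} b≈β)) =
    [ trans (solve 2 (λ b t → b :+ t :* con (+ 0) := b) refl b t) b≈β ]
  quotient-Leading t (_∷_ a l@(_∷_ {as = bs} b l′)) = horner (b ∷ bs) t ∷ quotient-Leading t l

-- Nonarchimedean absolute values and the Gauss norm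

module NonarchimedeanFacts
  (em : ∀ {a} → ExcludedMiddle a) {ℝ : RealNumbers}
  {c ℓ} (K : NonarchimedeanField ℝ c ℓ) where

  private
    module ℝ where
      open RealNumbers ℝ public
      open RealFacts em ℝ public
    module ≤-Reasoning = PartialOrderReasoning ℝ.≤-poset

  open NonarchimedeanField K hiding (zero)
  open FieldFacts baseField public
  open Exp commutativeSemiring public using (^-homo-*; ^-distrib-*)
  open IntegerCoefficientSolver commutativeRing

  ∣∣-pos : ∀ {x} → x ≉ 0# → ℝ.0# ℝ.< ∣ x ∣
  ∣∣-pos {x} x≉0 = ∣∣-nonNeg x , λ eq → x≉0 (∣x∣≈0⇒x≈0 (ℝ.sym eq))

  ∣∣-pos⁻¹ : ∀ {x} → ℝ.0# ℝ.< ∣ x ∣ → x ≉ 0#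
  ∣∣-pos⁻¹ 0<∣x∣ x≈0 = ℝ.pos⇒≉0 0<∣x∣ (ℝ.trans (∣∣-cong x≈0) ∣0∣≈0)

  ∣1∣≈1 : ∣ 1# ∣ ℝ.≈ ℝ.1#
  ∣1∣≈1 = ℝ.*-cancelˡ-≈ (ℝ.pos⇒≉0 (∣∣-pos 1≉0)) (begin-equality
    ∣ 1# ∣ ℝ.* ∣ 1# ∣ ≈⟨ ∣∣-* 1# 1# ⟨
    ∣ 1# * 1# ∣       ≈⟨ ∣∣-cong (*-identityˡ 1#) ⟩
    ∣ 1# ∣            ≈⟨ ℝ.*-identityʳ _ ⟨
    ∣ 1# ∣ ℝ.* ℝ.1#   ∎)
    where
    open ≤-Reasoning
    1≉0 : 1# ≉ 0#
    1≉0 1≈0 = 0≉1 (sym 1≈0)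

  private
    square-cancel-≤ : ∀ {x y} → ℝ.0# ℝ.≤ x → x ℝ.* x ℝ.≤ y ℝ.* y → ℝ.0# ℝ.≤ y → x ℝ.≤ y
    square-cancel-≤ {x} {y} 0≤x p 0≤y = ℝ.≮⇒≥ λ y<x → ℝ.<⇒≱
      (ℝ.≤-<-trans (ℝ.*-monoˡ-≤ 0≤y (ℝ.<⇒≤ y<x)) (ℝ.*-monoʳ-< (ℝ.≤-<-trans 0≤y y<x) y<x)) p

  -- Both sides are nonnegative with the same square, because (-x)(-x) = x x.
  ∣-x∣≈∣x∣ : ∀ x → ∣ - x ∣ ℝ.≈ ∣ x ∣
  ∣-x∣≈∣x∣ x = ℝ.≤-antisym
    (square-cancel-≤ (∣∣-nonNeg _) (ℝ.≤-reflexive squares) (∣∣-nonNeg _))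
    (square-cancel-≤ (∣∣-nonNeg _) (ℝ.≤-reflexive (ℝ.sym squares)) (∣∣-nonNeg _))
    where
    open ≤-Reasoning
    squares : ∣ - x ∣ ℝ.* ∣ - x ∣ ℝ.≈ ∣ x ∣ ℝ.* ∣ x ∣
    squares = begin-equality
      ∣ - x ∣ ℝ.* ∣ - x ∣ ≈⟨ ∣∣-* (- x) (- x) ⟨
      ∣ - x * - x ∣       ≈⟨ ∣∣-cong (solve 1 (λ x → :- x :* :- x := x :* x) refl x) ⟩
      ∣ x * x ∣           ≈⟨ ∣∣-* x x ⟩
      ∣ x ∣ ℝ.* ∣ x ∣     ∎

  ∣∣-sym : ∀ x y → ∣ x - y ∣ ℝ.≈ ∣ y - x ∣
  ∣∣-sym x y = ℝ.trans
    (∣∣-cong (solve 2 (λ x y → x :- y := :- (y :- x)) refl x y)) (∣-x∣≈∣x∣ (y - x))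

  ultra-≤ : ∀ {x y b} → ∣ x ∣ ℝ.≤ b → ∣ y ∣ ℝ.≤ b → ∣ x + y ∣ ℝ.≤ b
  ultra-≤ p q = ℝ.≤-trans (∣∣-ultra _ _) (ℝ.⊔-lub p q)

  ultra-< : ∀ {x y b} → ∣ x ∣ ℝ.< b → ∣ y ∣ ℝ.< b → ∣ x + y ∣ ℝ.< b
  ultra-< p q = ℝ.≤-<-trans (∣∣-ultra _ _) (ℝ.max-<-lub p q)

  ultra-minus-≤ : ∀ {x y b} → ∣ x ∣ ℝ.≤ b → ∣ y ∣ ℝ.≤ b → ∣ x - y ∣ ℝ.≤ b
  ultra-minus-≤ {x} {y} p q = ultra-≤ p (ℝ.≤-respˡ-≈ (ℝ.sym (∣-x∣≈∣x∣ y)) q)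

  -- Otherwise x = (x + y) - y would be a difference of two elements both smaller than x.
  ∣x∣≤∣x+y∣ : ∀ {x y} → ∣ y ∣ ℝ.< ∣ x ∣ → ∣ x ∣ ℝ.≤ ∣ x + y ∣
  ∣x∣≤∣x+y∣ {x} {y} ∣y∣<∣x∣ = ℝ.≮⇒≥ λ ∣x+y∣<∣x∣ → ℝ.<⇒≱
    (ultra-< ∣x+y∣<∣x∣ (ℝ.<-respˡ-≈ (ℝ.sym (∣-x∣≈∣x∣ y)) ∣y∣<∣x∣))
    (ℝ.≤-reflexive (∣∣-cong (solve 2 (λ x y → x := (x :+ y) :- y) refl x y)))

  ∣∣-⁻¹ : ∀ {x} → x ≉ 0# → ∣ x ∣ ℝ.* ∣ x ⁻¹ ∣ ℝ.≈ ℝ.1#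
  ∣∣-⁻¹ {x} x≉0 = ℝ.trans (ℝ.sym (∣∣-* x (x ⁻¹))) (ℝ.trans (∣∣-cong (*-inverseʳ x≉0)) ∣1∣≈1)

  ∣∣-^ : ∀ x n → ∣ x ^ n ∣ ℝ.≈ ∣ x ∣ ℝ.^ n
  ∣∣-^ x zero    = ∣1∣≈1
  ∣∣-^ x (suc n) = ℝ.trans (∣∣-* x (x ^ n)) (ℝ.*-congˡ (∣∣-^ x n))

  ^-nonzero : ∀ {x} n → x ≉ 0# → x ^ n ≉ 0#
  ^-nonzero zero    x≉0 = λ 1≈0 → 0≉1 (sym 1≈0)
  ^-nonzero (suc n) x≉0 = *-nonzero x≉0 (^-nonzero n x≉0)

  -- An element with ∣ x ∣ ≠ 1 or its inverse has absolute value above 1, and the powers of a real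
  -- number above 1 are unbounded.
  ∣∣-unbounded : Nontrivial ℝ K → ∀ b → ∃[ x ] b ℝ.< ∣ x ∣
  ∣∣-unbounded (x , x≉0 , ∣x∣≉1) b = a ^ n , ℝ.<-respʳ-≈ (ℝ.sym (∣∣-^ a n)) b<∣a∣ⁿ
    where
    open ≤-Reasoning
    large : ∃[ a ] ℝ.1# ℝ.< ∣ a ∣
    large with ℝ.≤-or-> ∣ x ∣ ℝ.1#
    ... | inj₂ 1<∣x∣ = x , 1<∣x∣
    ... | inj₁ ∣x∣≤1 = x ⁻¹ , (begin-strict
      ℝ.1#                 ≈⟨ ∣∣-⁻¹ x≉0 ⟨
      ∣ x ∣ ℝ.* ∣ x ⁻¹ ∣   <⟨ ℝ.*-monoʳ-< (∣∣-pos (⁻¹-nonzero x≉0)) (∣x∣≤1 , ∣x∣≉1) ⟩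
      ℝ.1# ℝ.* ∣ x ⁻¹ ∣    ≈⟨ ℝ.*-identityˡ _ ⟩
      ∣ x ⁻¹ ∣             ∎)
    a = proj₁ large
    power = ℝ.powers-unbounded (proj₂ large) b
    n = proj₁ power
    b<∣a∣ⁿ = proj₂ power

  ∣∣-arbitrarily-small : Nontrivial ℝ K → ∀ {r} → ℝ.0# ℝ.< r → ∃[ x ] x ≉ 0# × ∣ x ∣ ℝ.< r
  ∣∣-arbitrarily-small nontrivial {r} 0<r with ∣∣-unbounded nontrivial (r ℝ.⁻¹)
  ... | x , r⁻¹<∣x∣ = x ⁻¹ , ⁻¹-nonzero x≉0 , ℝ.≰⇒> λ r≤∣x⁻¹∣ → ℝ.<⇒≱ r⁻¹<∣x∣
      (ℝ.*-cancelˡ-≤ 0<r (begin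
        r ℝ.* ∣ x ∣            ≤⟨ ℝ.*-monoʳ-≤ (∣∣-nonNeg x) r≤∣x⁻¹∣ ⟩
        ∣ x ⁻¹ ∣ ℝ.* ∣ x ∣     ≈⟨ ℝ.*-comm _ _ ⟩
        ∣ x ∣ ℝ.* ∣ x ⁻¹ ∣     ≈⟨ ∣∣-⁻¹ x≉0 ⟩
        ℝ.1#                   ≈⟨ ℝ.⁻¹-inverseʳ 0<r ⟨
        r ℝ.* r ℝ.⁻¹           ∎))
    where
    open ≤-Reasoning
    x≉0 = ∣∣-pos⁻¹ (ℝ.<-≤-trans (ℝ.⁻¹-pos 0<r) (ℝ.<⇒≤ r⁻¹<∣x∣))

  -- The Gauss norm of a polynomial is attained on the unit circle

  UnitBounded : ℝ.Carrier → List Carrier → Set c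
  UnitBounded m = All (λ a → ∣ a ∣ ℝ.≤ m)

  horner-≤ : ∀ {m as t} → ℝ.0# ℝ.≤ m → UnitBounded m as → ∣ t ∣ ℝ.≤ ℝ.1# → ∣ horner as t ∣ ℝ.≤ m
  horner-≤ 0≤m [] ∣t∣≤1 = ℝ.≤-respˡ-≈ (ℝ.sym ∣0∣≈0) 0≤m
  horner-≤ {m} {a ∷ as} {t} 0≤m (p ∷ ps) ∣t∣≤1 = ultra-≤ p (begin
    ∣ t * horner as t ∣       ≈⟨ ∣∣-* t _ ⟩
    ∣ t ∣ ℝ.* ∣ horner as t ∣ ≤⟨ ℝ.*-mono-≤ ℝ.0≤1 (∣∣-nonNeg _) ∣t∣≤1 (horner-≤ 0≤m ps ∣t∣≤1) ⟩
    ℝ.1# ℝ.* m                ≈⟨ ℝ.*-identityˡ m ⟩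
    m                         ∎)
    where open ≤-Reasoning

  ∣t∣≤1⇒∣tx∣≤∣x∣ : ∀ {t} x → ∣ t ∣ ℝ.≤ ℝ.1# → ∣ t * x ∣ ℝ.≤ ∣ x ∣
  ∣t∣≤1⇒∣tx∣≤∣x∣ {t} x ∣t∣≤1 = ℝ.≤-respˡ-≈ (ℝ.sym (∣∣-* t x))
    (ℝ.≤-respʳ-≈ (ℝ.*-identityˡ _) (ℝ.*-monoʳ-≤ (∣∣-nonNeg x) ∣t∣≤1))

  -- bs is as with the coefficients beyond the last one of maximal absolute
  -- value m dropped; dropped coefficients are smaller than m.
  record Truncation (as : List Carrier) : Set (c Level.⊔ ℓ) where
    field
      m           : ℝ.Carrier
      0<m         : ℝ.0# ℝ.< m
      as≤m        : UnitBounded m as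
      bs          : List Carrier
      bs≤m        : UnitBounded m bs
      β           : Carrier
      ∣β∣≈m       : ∣ β ∣ ℝ.≈ m
      degree      : ℕ
      leading     : Leading β degree bs
      close       : ∀ t → ∣ t ∣ ℝ.≤ ℝ.1# → ∣ horner as t - horner bs t ∣ ℝ.< m

  -- Built from the top coefficient downwards: a new constant term a is put in front of the
  -- truncation found so far if ∣ a ∣ ≤ m, and otherwise it exceeds all later coefficients and is
  -- kept alone.
  truncate : ∀ as → All (_≈ 0#) as ⊎ Truncation as
  truncate [] = inj₁ []
  truncate (a ∷ as) with truncate as
  truncate (a ∷ as) | inj₁ zeros with em {P = a ≈ 0#}
  ... | yes a≈0 = inj₁ (a≈0 ∷ zeros)
  ... | no a≉0 = inj₂ (record
    { m = ∣ a ∣ ; 0<m = ∣∣-pos a≉0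
    ; as≤m = ℝ.≤-refl ∷ All.map zero-≤ zeros
    ; bs = a ∷ [] ; bs≤m = ℝ.≤-refl ∷ []
    ; β = a ; ∣β∣≈m = ℝ.refl ; degree = 0 ; leading = [ refl ]
    ; close = λ t ∣t∣≤1 → ℝ.<-respˡ-≈ (ℝ.sym (ℝ.trans (∣∣-cong (difference t)) ∣0∣≈0)) (∣∣-pos a≉0)
    })
    where
    zero-≤ : ∀ {x} → x ≈ 0# → ∣ x ∣ ℝ.≤ ∣ a ∣
    zero-≤ x≈0 = ℝ.≤-respˡ-≈ (ℝ.sym (ℝ.trans (∣∣-cong x≈0) ∣0∣≈0)) (∣∣-nonNeg a)
    horner-zeros : ∀ {as} → All (_≈ 0#) as → ∀ t → horner as t ≈ 0#
    horner-zeros [] t = refl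
    horner-zeros (x≈0 ∷ zs) t = trans (+-cong x≈0 (*-congˡ (horner-zeros zs t)))
      (solve 1 (λ t → con (+ 0) :+ t :* con (+ 0) := con (+ 0)) refl t)
    difference : ∀ t → horner (a ∷ as) t - horner (a ∷ []) t ≈ 0#
    difference t = trans (+-congʳ (+-congˡ (*-congˡ (horner-zeros zeros t)))) (-‿inverseʳ _)
  truncate (a ∷ as) | inj₂ T with ℝ.≤-or-> ∣ a ∣ (Truncation.m T)
  ... | inj₁ ∣a∣≤m = inj₂ (record
    { m = m ; 0<m = 0<m ; as≤m = ∣a∣≤m ∷ as≤m ; bs = a ∷ bs ; bs≤m = ∣a∣≤m ∷ bs≤m
    ; β = β ; ∣β∣≈m = ∣β∣≈m ; degree = suc degree ; leading = a ∷ leading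
    ; close = λ t ∣t∣≤1 → ℝ.≤-<-trans
        (ℝ.≤-respˡ-≈ (∣∣-cong (solve 4 (λ a t x y → t :* (x :- y) := (a :+ t :* x) :- (a :+ t :* y))
            refl a t (horner as t) (horner bs t)))
          (∣t∣≤1⇒∣tx∣≤∣x∣ _ ∣t∣≤1))
        (close t ∣t∣≤1)
    })
    where open Truncation T
  ... | inj₂ m<∣a∣ = inj₂ (record
    { m = ∣ a ∣ ; 0<m = ℝ.<-≤-trans 0<m (ℝ.<⇒≤ m<∣a∣)
    ; as≤m = ℝ.≤-refl ∷ All.map (λ p → ℝ.≤-trans p (ℝ.<⇒≤ m<∣a∣)) as≤m
    ; bs = a ∷ [] ; bs≤m = ℝ.≤-refl ∷ []
    ; β = a ; ∣β∣≈m = ℝ.refl ; degree = 0 ; leading = [ refl ]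
    ; close = λ t ∣t∣≤1 → ℝ.≤-<-trans
        (ℝ.≤-respˡ-≈ (∣∣-cong (solve 3 (λ a t x → t :* x := (a :+ t :* x) :- (a :+ t :* con (+ 0)))
            refl a t (horner as t)))
          (∣t∣≤1⇒∣tx∣≤∣x∣ _ ∣t∣≤1))
        (ℝ.≤-<-trans (horner-≤ (ℝ.<⇒≤ 0<m) as≤m ∣t∣≤1) m<∣a∣)
    })
    where open Truncation T

  -- By induction the tail has absolute value at least m at t, so ∣ t ∣ > 1 lifts it above m, and
  -- the constant term is too small to interfere.
  horner-outside : ∀ {m β n bs t} → UnitBounded m bs → ∣ β ∣ ℝ.≈ m → ℝ.0# ℝ.< m → Leading β n bs →
                   ℝ.1# ℝ.< ∣ t ∣ → m ℝ.≤ ∣ horner bs t ∣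
  horner-outside {t = t} _ ∣β∣≈m _ ([_] {b} b≈β) _ = ℝ.≤-reflexive (ℝ.trans (ℝ.sym ∣β∣≈m)
    (∣∣-cong (trans (sym b≈β) (solve 2 (λ b t → b := b :+ t :* con (+ 0)) refl b t))))
  horner-outside {m} {t = t} (∣a∣≤m ∷ ps) ∣β∣≈m 0<m (_∷_ {as = bs} a l) 1<∣t∣ = begin
    m                          ≤⟨ ℝ.<⇒≤ m<∣th∣ ⟩
    ∣ t * horner bs t ∣        ≤⟨ ∣x∣≤∣x+y∣ (ℝ.≤-<-trans ∣a∣≤m m<∣th∣) ⟩
    ∣ t * horner bs t + a ∣    ≈⟨ ∣∣-cong (+-comm _ _) ⟩
    ∣ a + t * horner bs t ∣    ∎
    where
    open ≤-Reasoning
    m<∣th∣ : m ℝ.< ∣ t * horner bs t ∣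
    m<∣th∣ = begin-strict
      m                          ≈⟨ ℝ.*-identityˡ m ⟨
      ℝ.1# ℝ.* m                 <⟨ ℝ.*-monoʳ-< 0<m 1<∣t∣ ⟩
      ∣ t ∣ ℝ.* m                ≤⟨ ℝ.*-monoˡ-≤ (∣∣-nonNeg t) (horner-outside ps ∣β∣≈m 0<m l 1<∣t∣) ⟩
      ∣ t ∣ ℝ.* ∣ horner bs t ∣  ≈⟨ ∣∣-* t _ ⟨
      ∣ t * horner bs t ∣        ∎

  -- With bs the truncation of as and β its leading coefficient, every solution
  -- t of t · bs(t) = β lies on the unit circle and satisfies ∣ as(t) ∣ = m.
  gauss-norm-attained : AlgebraicallyClosed baseField → ∀ as →
    ∃[ t ] ∣ t ∣ ℝ.≈ ℝ.1# × UnitBounded ∣ horner as t ∣ as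
  gauss-norm-attained closed as with truncate as
  ... | inj₁ zeros = 1# , ∣1∣≈1 , All.map
      (λ x≈0 → ℝ.≤-respˡ-≈ (ℝ.sym (ℝ.trans (∣∣-cong x≈0) ∣0∣≈0)) (∣∣-nonNeg _)) zeros
  ... | inj₂ T = t , ∣t∣≈1 , All.map (λ p → ℝ.≤-trans p m≤∣as∣) as≤m
    where
    open Truncation T
    open ≤-Reasoning
    β≉0 : β ≉ 0#
    β≉0 = ∣∣-pos⁻¹ (ℝ.<-respʳ-≈ (ℝ.sym ∣β∣≈m) 0<m)
    -- The factor t in t · bs(t) - β makes the degree positive even if `bs` is a constant, so that a
    -- root exists.
    root = horner-root closed (- β ∷ leading) β≉0
    t = proj₁ root
    b = horner bs t
    tb≈β : t * b ≈ β
    tb≈β = trans (solve 2 (λ β tb → tb := (:- β :+ tb) :+ β) refl β (t * b))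
             (trans (+-congʳ (proj₂ root)) (+-identityˡ β))
    ∣t∣∣b∣≈m : ∣ t ∣ ℝ.* ∣ b ∣ ℝ.≈ m
    ∣t∣∣b∣≈m = ℝ.trans (ℝ.sym (∣∣-* t b)) (ℝ.trans (∣∣-cong tb≈β) ∣β∣≈m)
    ∣t∣≤1 : ∣ t ∣ ℝ.≤ ℝ.1#
    ∣t∣≤1 = ℝ.≮⇒≥ λ 1<∣t∣ → ℝ.<⇒≱ (begin-strict
      m                  ≈⟨ ℝ.*-identityˡ m ⟨
      ℝ.1# ℝ.* m         <⟨ ℝ.*-monoʳ-< 0<m 1<∣t∣ ⟩
      ∣ t ∣ ℝ.* m        ≤⟨ ℝ.*-monoˡ-≤ (∣∣-nonNeg t) (horner-outside bs≤m ∣β∣≈m 0<m leading 1<∣t∣) ⟩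
      ∣ t ∣ ℝ.* ∣ b ∣    ∎) (ℝ.≤-reflexive ∣t∣∣b∣≈m)
    m≤∣b∣ : m ℝ.≤ ∣ b ∣
    m≤∣b∣ = begin
      m                  ≈⟨ ∣t∣∣b∣≈m ⟨
      ∣ t ∣ ℝ.* ∣ b ∣    ≤⟨ ℝ.*-monoʳ-≤ (∣∣-nonNeg b) ∣t∣≤1 ⟩
      ℝ.1# ℝ.* ∣ b ∣     ≈⟨ ℝ.*-identityˡ _ ⟩
      ∣ b ∣              ∎
    ∣t∣≈1 : ∣ t ∣ ℝ.≈ ℝ.1#
    ∣t∣≈1 = ℝ.≤-antisym ∣t∣≤1 (ℝ.*-cancelʳ-≤ 0<m (begin
      ℝ.1# ℝ.* m         ≈⟨ ℝ.*-identityˡ m ⟩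
      m                  ≈⟨ ∣t∣∣b∣≈m ⟨
      ∣ t ∣ ℝ.* ∣ b ∣    ≤⟨ ℝ.*-monoˡ-≤ (∣∣-nonNeg t) (horner-≤ (ℝ.<⇒≤ 0<m) bs≤m ∣t∣≤1) ⟩
      ∣ t ∣ ℝ.* m        ∎))
    -- The dropped coefficients change the value by less than m, and b has absolute value at least
    -- m.
    m≤∣as∣ : m ℝ.≤ ∣ horner as t ∣
    m≤∣as∣ = begin
      m                             ≤⟨ m≤∣b∣ ⟩
      ∣ b ∣                         ≤⟨ ∣x∣≤∣x+y∣ (ℝ.<-≤-trans (close t ∣t∣≤1) m≤∣b∣) ⟩
      ∣ b + (horner as t - b) ∣     ≈⟨ ∣∣-cong (solve 2 (λ a b → b :+ (a :- b) := a) refl (horner as t) b) ⟩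
      ∣ horner as t ∣               ∎

  -- All coefficients are bounded by the absolute value at one point of the unit circle, and that
  -- value is 0.
  horner-determines-coefficients : AlgebraicallyClosed baseField → DeterminesCoefficients
  horner-determines-coefficients closed as h with gauss-norm-attained closed as
  ... | t , _ , bound = All.map (λ p → ∣x∣≈0⇒x≈0 (ℝ.≤-antisym
          (ℝ.≤-trans p (ℝ.≤-reflexive (ℝ.trans (∣∣-cong (h t)) ∣0∣≈0))) (∣∣-nonNeg _))) bound

  -- Apply the Gauss norm to (as(t) - as(0)) / t.
  schwarz : AlgebraicallyClosed baseField → ∀ as {M} →
    (∀ t → ∣ t ∣ ℝ.≤ ℝ.1# → ∣ horner as t ∣ ℝ.≤ M) →
    ∀ t → ∣ t ∣ ℝ.≤ ℝ.1# → ∣ horner as t - horner as 0# ∣ ℝ.≤ M ℝ.* ∣ t ∣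
  schwarz closed [] {M} bound t ∣t∣≤1 = begin
    ∣ 0# - 0# ∣  ≈⟨ ℝ.trans (∣∣-cong (-‿inverseʳ 0#)) ∣0∣≈0 ⟩
    ℝ.0#         ≤⟨ ℝ.*-nonNeg (ℝ.≤-trans (∣∣-nonNeg _) (bound t ∣t∣≤1)) (∣∣-nonNeg t) ⟩
    M ℝ.* ∣ t ∣  ∎
    where open ≤-Reasoning
  schwarz closed (a ∷ as) {M} bound t ∣t∣≤1 = begin
    ∣ horner (a ∷ as) t - horner (a ∷ as) 0# ∣  ≈⟨ ∣∣-cong (difference t) ⟩
    ∣ t * horner as t ∣                         ≈⟨ ∣∣-* t _ ⟩
    ∣ t ∣ ℝ.* ∣ horner as t ∣                   ≤⟨ ℝ.*-monoˡ-≤ (∣∣-nonNeg t) (horner-≤ 0≤M as≤M ∣t∣≤1) ⟩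
    ∣ t ∣ ℝ.* M                                 ≈⟨ ℝ.*-comm _ _ ⟩
    M ℝ.* ∣ t ∣                                 ∎
    where
    open ≤-Reasoning
    difference : ∀ t → horner (a ∷ as) t - horner (a ∷ as) 0# ≈ t * horner as t
    difference t = solve 4 (λ a t x y → (a :+ t :* x) :- (a :+ con (+ 0) :* y) := t :* x)
                     refl a t (horner as t) (horner as 0#)
    0≤M = ℝ.≤-trans (∣∣-nonNeg _) (bound t ∣t∣≤1)
    gauss = gauss-norm-attained closed as
    u = proj₁ gauss
    ∣u∣≈1 = proj₁ (proj₂ gauss)
    -- As ∣ u ∣ = 1, dividing by u costs nothing, and the ultrametric inequality bounds a difference
    -- of two values by M rather than 2 M.
    ∣as∣≤M : ∣ horner as u ∣ ℝ.≤ M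
    ∣as∣≤M = begin
      ∣ horner as u ∣              ≈⟨ ℝ.*-identityˡ _ ⟨
      ℝ.1# ℝ.* ∣ horner as u ∣     ≈⟨ ℝ.*-congʳ ∣u∣≈1 ⟨
      ∣ u ∣ ℝ.* ∣ horner as u ∣    ≈⟨ ∣∣-* u _ ⟨
      ∣ u * horner as u ∣          ≈⟨ ∣∣-cong (difference u) ⟨
      ∣ horner (a ∷ as) u - horner (a ∷ as) 0# ∣
        ≤⟨ ultra-minus-≤ (bound u (ℝ.≤-reflexive ∣u∣≈1))
             (bound 0# (ℝ.≤-respˡ-≈ (ℝ.sym ∣0∣≈0) ℝ.0≤1)) ⟩
      M                            ∎
    as≤M : UnitBounded M as
    as≤M = All.map (λ p → ℝ.≤-trans p ∣as∣≤M) (proj₂ (proj₂ gauss))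

-- Polynomial expressions, homogeneous components, restriction to lines

module PolynomialExpressions {c ℓ} (F : Field c ℓ) where

  open Field F hiding (zero)
  open FieldFacts F
  open SemiringExp semiring using (^-homo-*)
  open IntegerCoefficientSolver commutativeRing
  open SetoidReasoning setoid

  infixl 6 _⊕_
  infixl 7 _⊗_

  -- Plain syntax without normal forms: only values of expressions are ever compared, so sums,
  -- products and substitutions are free to be formal.
  data Expr (n : ℕ) : Set c where
    const    : Carrier → Expr n
    var     : Fin n → Expr n
    _⊕_ _⊗_ : Expr n → Expr n → Expr n

  ⟦_⟧ₑ : ∀ {n} → Expr n → Vector Carrier n → Carrier
  ⟦ const a ⟧ₑ x = a
  ⟦ var i ⟧ₑ  x = x i
  ⟦ e ⊕ f ⟧ₑ  x = ⟦ e ⟧ₑ x + ⟦ f ⟧ₑ x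
  ⟦ e ⊗ f ⟧ₑ  x = ⟦ e ⟧ₑ x * ⟦ f ⟧ₑ x

  ⟦⟧ₑ-cong : ∀ {n} (e : Expr n) {x y} → (∀ i → x i ≈ y i) → ⟦ e ⟧ₑ x ≈ ⟦ e ⟧ₑ y
  ⟦⟧ₑ-cong (const a) x≈y = refl
  ⟦⟧ₑ-cong (var i) x≈y = x≈y i
  ⟦⟧ₑ-cong (e ⊕ f) x≈y = +-cong (⟦⟧ₑ-cong e x≈y) (⟦⟧ₑ-cong f x≈y)
  ⟦⟧ₑ-cong (e ⊗ f) x≈y = *-cong (⟦⟧ₑ-cong e x≈y) (⟦⟧ₑ-cong f x≈y)

  substitute : ∀ {m n} → Vector (Expr n) m → Expr m → Expr n
  substitute σ (const a) = const a
  substitute σ (var i)  = σ i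
  substitute σ (e ⊕ f)  = substitute σ e ⊕ substitute σ f
  substitute σ (e ⊗ f)  = substitute σ e ⊗ substitute σ f

  ⟦substitute⟧ : ∀ {m n} (σ : Vector (Expr n) m) e x →
                 ⟦ substitute σ e ⟧ₑ x ≈ ⟦ e ⟧ₑ (λ i → ⟦ σ i ⟧ₑ x)
  ⟦substitute⟧ σ (const a) x = refl
  ⟦substitute⟧ σ (var i)  x = refl
  ⟦substitute⟧ σ (e ⊕ f)  x = +-cong (⟦substitute⟧ σ e x) (⟦substitute⟧ σ f x)
  ⟦substitute⟧ σ (e ⊗ f)  x = *-cong (⟦substitute⟧ σ e x) (⟦substitute⟧ σ f x)

  -- Polynomials in one distinguished variable t whose coefficients are polynomials in the other n
  -- variables.
  ExprPoly : ℕ → Set c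
  ExprPoly n = List (Expr n)

  infix 8 _at_
  _at_ : ∀ {n} → ExprPoly n → Vector Carrier n → List Carrier
  p at z = List.map (λ e → ⟦ e ⟧ₑ z) p

  constants : ∀ {n} → List Carrier → ExprPoly n
  constants = List.map const

  constants-at : ∀ {n} as (z : Vector Carrier n) t → horner (constants as at z) t ≈ horner as t
  constants-at []       z t = refl
  constants-at (a ∷ as) z t = +-congˡ (*-congˡ (constants-at as z t))

  infixl 6 _⊞_
  _⊞_ : ∀ {n} → ExprPoly n → ExprPoly n → ExprPoly n
  []      ⊞ q       = q
  (a ∷ p) ⊞ []      = a ∷ p
  (a ∷ p) ⊞ (b ∷ q) = (a ⊕ b) ∷ (p ⊞ q)

  scale : ∀ {n} → Expr n → ExprPoly n → ExprPoly n
  scale a = List.map (a ⊗_)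

  infixl 7 _⊠_
  _⊠_ : ∀ {n} → ExprPoly n → ExprPoly n → ExprPoly n
  []      ⊠ q = []
  (a ∷ p) ⊠ q = scale a q ⊞ (const 0# ∷ p ⊠ q)

  shift : ∀ {n} → ℕ → ExprPoly n → ExprPoly n
  shift zero    p = p
  shift (suc k) p = const 0# ∷ shift k p

  horner-⊞ : ∀ {n} (p q : ExprPoly n) z t →
             horner ((p ⊞ q) at z) t ≈ horner (p at z) t + horner (q at z) t
  horner-⊞ []      q       z t = sym (+-identityˡ _)
  horner-⊞ (a ∷ p) []      z t = sym (+-identityʳ _)
  horner-⊞ (a ∷ p) (b ∷ q) z t = trans (+-congˡ (*-congˡ (horner-⊞ p q z t)))
    (solve 5 (λ a b t p q → (a :+ b) :+ t :* (p :+ q) := (a :+ t :* p) :+ (b :+ t :* q)) refl _ _ t _ _)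

  horner-scale : ∀ {n} a (p : ExprPoly n) z t →
                 horner (scale a p at z) t ≈ ⟦ a ⟧ₑ z * horner (p at z) t
  horner-scale a []      z t = sym (zeroʳ _)
  horner-scale a (b ∷ p) z t = trans (+-congˡ (*-congˡ (horner-scale a p z t)))
    (solve 4 (λ a b t p → a :* b :+ t :* (a :* p) := a :* (b :+ t :* p)) refl _ _ t _)

  horner-⊠ : ∀ {n} (p q : ExprPoly n) z t →
             horner ((p ⊠ q) at z) t ≈ horner (p at z) t * horner (q at z) t
  horner-⊠ []      q z t = sym (zeroˡ _)
  horner-⊠ (a ∷ p) q z t = begin
    horner ((scale a q ⊞ (const 0# ∷ p ⊠ q)) at z) t
      ≈⟨ horner-⊞ (scale a q) (const 0# ∷ p ⊠ q) z t ⟩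
    horner (scale a q at z) t + (0# + t * horner ((p ⊠ q) at z) t)
      ≈⟨ +-cong (horner-scale a q z t) (+-congˡ (*-congˡ (horner-⊠ p q z t))) ⟩
    A * Q + (0# + t * (P * Q))
      ≈⟨ solve 4 (λ a t p q → a :* q :+ (con (+ 0) :+ t :* (p :* q)) := (a :+ t :* p) :* q) refl A t P Q ⟩
    (A + t * P) * Q ∎
    where
    A = ⟦ a ⟧ₑ z
    P = horner (p at z) t
    Q = horner (q at z) t

  horner-shift : ∀ {n} k (p : ExprPoly n) z t →
                 horner (shift k p at z) t ≈ t ^ k * horner (p at z) t
  horner-shift zero    p z t = sym (*-identityˡ _)
  horner-shift (suc k) p z t = trans (+-identityˡ _)
    (trans (*-congˡ (horner-shift k p z t)) (sym (*-assoc t _ _)))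

  length-⊞ : ∀ {n k} (p q : ExprPoly n) → List.length p ℕ.≤ k → List.length q ℕ.≤ k →
             List.length (p ⊞ q) ℕ.≤ k
  length-⊞ []      q       _         q≤k       = q≤k
  length-⊞ (a ∷ p) []      p≤k       _         = p≤k
  length-⊞ (a ∷ p) (b ∷ q) (ℕ.s≤s p≤k) (ℕ.s≤s q≤k) = ℕ.s≤s (length-⊞ p q p≤k q≤k)

  length-scale : ∀ {n} a (p : ExprPoly n) → List.length (scale a p) ≡ List.length p
  length-scale a p = List.length-map (a ⊗_) p

  length-shift : ∀ {n} k (p : ExprPoly n) → List.length (shift k p) ≡ k ℕ.+ List.length p
  length-shift zero    p = ≡.refl
  length-shift (suc k) p = ≡.cong suc (length-shift k p)

  -- Not sharp, but it suffices: length at most k stands for degree below k, and factors of degree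
  -- below k and l need only give degree below k + l.
  length-⊠ : ∀ {n} (p q : ExprPoly n) → List.length (p ⊠ q) ℕ.≤ List.length p ℕ.+ List.length q
  length-⊠ []      q = ℕ.z≤n
  length-⊠ (a ∷ p) q = length-⊞ (scale a q) (const 0# ∷ p ⊠ q)
    (ℕ.≤-trans (ℕ.≤-reflexive (length-scale a q)) (ℕ.m≤n+m _ (suc (List.length p))))
    (ℕ.s≤s (length-⊠ p q))

  expand : ∀ {m n} → Vector (ExprPoly n) m → Expr m → ExprPoly n
  expand σ (const a) = const a ∷ []
  expand σ (var i)  = σ i
  expand σ (e ⊕ f)  = expand σ e ⊞ expand σ f
  expand σ (e ⊗ f)  = expand σ e ⊠ expand σ f

  horner-expand : ∀ {m n} (σ : Vector (ExprPoly n) m) e z t →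
                  horner (expand σ e at z) t ≈ ⟦ e ⟧ₑ (λ j → horner (σ j at z) t)
  horner-expand σ (const a) z t = trans (+-congˡ (zeroʳ t)) (+-identityʳ a)
  horner-expand σ (var i)  z t = refl
  horner-expand σ (e ⊕ f)  z t = trans (horner-⊞ (expand σ e) (expand σ f) z t)
    (+-cong (horner-expand σ e z t) (horner-expand σ f z t))
  horner-expand σ (e ⊗ f)  z t = trans (horner-⊠ (expand σ e) (expand σ f) z t)
    (*-cong (horner-expand σ e z t) (horner-expand σ f z t))

  -- Homogeneous by construction, so the degree never has to be computed. The zero form is included
  -- in every degree in order to pad gaps.
  data Form (n : ℕ) : ℕ → Set c where
    nought : ∀ {k} → Form n k
    const   : Carrier → Form n 0
    var    : Fin n → Form n 1
    _⊕_    : ∀ {k} → Form n k → Form n k → Form n k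
    _⊗_    : ∀ {k l} → Form n k → Form n l → Form n (k ℕ.+ l)

  ⟦_⟧f : ∀ {n k} → Form n k → Vector Carrier n → Carrier
  ⟦ nought ⟧f x = 0#
  ⟦ const a ⟧f x = a
  ⟦ var i ⟧f  x = x i
  ⟦ f ⊕ g ⟧f  x = ⟦ f ⟧f x + ⟦ g ⟧f x
  ⟦ f ⊗ g ⟧f  x = ⟦ f ⟧f x * ⟦ g ⟧f x

  ⟦⟧f-homogeneous : ∀ {n k} (f : Form n k) t x → ⟦ f ⟧f (λ i → t * x i) ≈ t ^ k * ⟦ f ⟧f x
  ⟦⟧f-homogeneous nought t x = sym (zeroʳ _)
  ⟦⟧f-homogeneous (const a) t x = sym (*-identityˡ a)
  ⟦⟧f-homogeneous (var i) t x = *-congʳ (sym (*-identityʳ t))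
  ⟦⟧f-homogeneous (f ⊕ g) t x = trans (+-cong (⟦⟧f-homogeneous f t x) (⟦⟧f-homogeneous g t x))
    (sym (distribˡ _ _ _))
  ⟦⟧f-homogeneous (_⊗_ {k} {l} f g) t x = begin
    ⟦ f ⟧f (λ i → t * x i) * ⟦ g ⟧f (λ i → t * x i)
      ≈⟨ *-cong (⟦⟧f-homogeneous f t x) (⟦⟧f-homogeneous g t x) ⟩
    (t ^ k * ⟦ f ⟧f x) * (t ^ l * ⟦ g ⟧f x)
      ≈⟨ solve 4 (λ a b c d → (a :* b) :* (c :* d) := (a :* c) :* (b :* d)) refl _ _ _ _ ⟩
    (t ^ k * t ^ l) * (⟦ f ⟧f x * ⟦ g ⟧f x)
      ≈⟨ *-congʳ (^-homo-* t k l) ⟨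
    t ^ (k ℕ.+ l) * (⟦ f ⟧f x * ⟦ g ⟧f x) ∎

  ⟦⟧f-cong : ∀ {n k} (f : Form n k) {x y} → (∀ i → x i ≈ y i) → ⟦ f ⟧f x ≈ ⟦ f ⟧f y
  ⟦⟧f-cong nought x≈y = refl
  ⟦⟧f-cong (const a) x≈y = refl
  ⟦⟧f-cong (var i) x≈y = x≈y i
  ⟦⟧f-cong (f ⊕ g) x≈y = +-cong (⟦⟧f-cong f x≈y) (⟦⟧f-cong g x≈y)
  ⟦⟧f-cong (f ⊗ g) x≈y = *-cong (⟦⟧f-cong f x≈y) (⟦⟧f-cong g x≈y)

  -- Sums f₀ + ⋯ + f_{D-1} of forms with f_k of degree k

  infixl 5 _▷_
  data Graded (n : ℕ) : ℕ → Set c where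
    ∅   : Graded n 0
    _▷_ : ∀ {D} → Graded n D → Form n D → Graded n (suc D)

  ⟦_⟧g : ∀ {n D} → Graded n D → Vector Carrier n → Carrier
  ⟦ ∅ ⟧g     x = 0#
  ⟦ g ▷ f ⟧g x = ⟦ g ⟧g x + ⟦ f ⟧f x

  private
    GradedRepresentation : ∀ {n} → (Vector Carrier n → Carrier) → Set (c Level.⊔ ℓ)
    GradedRepresentation {n} F = ∃[ D ] Σ (Graded n D) λ g → ∀ x → F x ≈ ⟦ g ⟧g x

    _⊕g_ : ∀ {n D} → Graded n D → Graded n D → Graded n D
    ∅       ⊕g ∅         = ∅
    (g ▷ f) ⊕g (g′ ▷ f′) = (g ⊕g g′) ▷ (f ⊕ f′)

    ⟦⊕g⟧ : ∀ {n D} (g h : Graded n D) x → ⟦ g ⊕g h ⟧g x ≈ ⟦ g ⟧g x + ⟦ h ⟧g x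
    ⟦⊕g⟧ ∅ ∅ x = sym (+-identityˡ 0#)
    ⟦⊕g⟧ (g ▷ f) (g′ ▷ f′) x = trans (+-congʳ (⟦⊕g⟧ g g′ x))
      (solve 4 (λ a b c d → (a :+ b) :+ (c :+ d) := (a :+ c) :+ (b :+ d)) refl _ _ _ _)

    pad : ∀ {n D} k → Graded n D → Graded n (k ℕ.+ D)
    pad zero    g = g
    pad (suc k) g = pad k g ▷ nought

    ⟦pad⟧ : ∀ {n D} k (g : Graded n D) x → ⟦ pad k g ⟧g x ≈ ⟦ g ⟧g x
    ⟦pad⟧ zero    g x = refl
    ⟦pad⟧ (suc k) g x = trans (+-identityʳ _) (⟦pad⟧ k g x)

    represent-+ : ∀ {n F G} → GradedRepresentation {n} F → GradedRepresentation G →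
                  GradedRepresentation (λ x → F x + G x)
    represent-+ {n} (D , g , F≈g) (E , h , G≈h) = D ℕ.+ E , pad D h ⊕g g′ , λ x →
      trans (+-cong (trans (F≈g x) (g≈g′ x)) (trans (G≈h x) (sym (⟦pad⟧ D h x))))
        (trans (+-comm _ _) (sym (⟦⊕g⟧ (pad D h) g′ x)))
      where
      -- Both summands are padded to the common bound D + E; padding g produces E + D, hence the
      -- transport.
      g′ : Graded n (D ℕ.+ E)
      g′ = ≡.subst (Graded n) (ℕ.+-comm E D) (pad E g)
      ⟦subst⟧ : ∀ {D E} (eq : D ≡ E) (g : Graded n D) x → ⟦ ≡.subst (Graded n) eq g ⟧g x ≈ ⟦ g ⟧g x
      ⟦subst⟧ ≡.refl g x = refl
      g≈g′ : ∀ x → ⟦ g ⟧g x ≈ ⟦ g′ ⟧g x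
      g≈g′ x = sym (trans (⟦subst⟧ (ℕ.+-comm E D) (pad E g) x) (⟦pad⟧ E g x))

    zeros : ∀ {n} D → Graded n D
    zeros zero    = ∅
    zeros (suc D) = zeros D ▷ nought

    ⟦zeros⟧ : ∀ {n} D (x : Vector Carrier n) → ⟦ zeros D ⟧g x ≈ 0#
    ⟦zeros⟧ zero    x = refl
    ⟦zeros⟧ (suc D) x = trans (+-identityʳ _) (⟦zeros⟧ D x)

    -- A factor of degree l shifts every component up by l, and the l vacated lowest degrees are
    -- filled with zeros.
    _⊗gf_ : ∀ {n D l} → Graded n D → Form n l → Graded n (D ℕ.+ l)
    _⊗gf_ {l = l} ∅ f = zeros l
    (g ▷ h) ⊗gf f = (g ⊗gf f) ▷ (h ⊗ f)

    ⟦⊗gf⟧ : ∀ {n D l} (g : Graded n D) (f : Form n l) x → ⟦ g ⊗gf f ⟧g x ≈ ⟦ g ⟧g x * ⟦ f ⟧f x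
    ⟦⊗gf⟧ {l = l} ∅ f x = trans (⟦zeros⟧ l x) (sym (zeroˡ _))
    ⟦⊗gf⟧ (g ▷ h) f x = trans (+-congʳ (⟦⊗gf⟧ g f x)) (sym (distribʳ _ _ _))

    represent-* : ∀ {n D E} (g : Graded n D) (h : Graded n E) →
                  GradedRepresentation (λ x → ⟦ g ⟧g x * ⟦ h ⟧g x)
    represent-* g ∅ = 0 , ∅ , λ x → zeroʳ _
    represent-* g (h ▷ f) with represent-+ (represent-* g h) (_ , g ⊗gf f , λ x → sym (⟦⊗gf⟧ g f x))
    ... | D , k , eq = D , k , λ x → trans (distribˡ _ _ _) (eq x)

  graded : ∀ {n} (e : Expr n) → ∃[ D ] Σ (Graded n D) λ g → ∀ x → ⟦ e ⟧ₑ x ≈ ⟦ g ⟧g x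
  graded (const a) = 1 , ∅ ▷ const a , λ x → sym (+-identityˡ a)
  graded (var i)  = 2 , ∅ ▷ nought ▷ var i , λ x →
    sym (trans (+-congʳ (+-identityˡ 0#)) (+-identityˡ (x i)))
  graded (e ⊕ f)  = represent-+ (graded e) (graded f)
  graded (e ⊗ f) with graded e | graded f
  ... | _ , g , e≈g | _ , h , f≈h with represent-* g h
  ...   | D , k , eq = D , k , λ x → trans (*-cong (e≈g x) (f≈h x)) (eq x)

  record TopForm {n} (F : Vector Carrier n → Carrier) : Set (c Level.⊔ ℓ) where
    field
      degree     : ℕ
      lower      : Graded n degree
      top        : Form n degree
      direction  : Vector Carrier n
      nonzero    : ⟦ top ⟧f direction ≉ 0#
      decomposed : ∀ x → F x ≈ ⟦ lower ⟧g x + ⟦ top ⟧f x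

  -- Components that vanish identically as functions are stripped from the top. The process stops
  -- because F has a nonzero value.
  topForm : (∀ {a} → ExcludedMiddle a) → ∀ {n D F} (g : Graded n D) → (∀ x → F x ≈ ⟦ g ⟧g x) →
            ∃[ x ] F x ≉ 0# → TopForm F
  topForm em ∅ F≈g (x , Fx≉0) = contradiction (F≈g x) Fx≉0
  topForm em (g ▷ f) F≈g (x , Fx≉0) with em {P = ∃[ w ] ⟦ f ⟧f w ≉ 0#}
  ... | yes (w , fw≉0) = record { lower = g ; top = f ; direction = w ; nonzero = fw≉0 ; decomposed = F≈g }
  ... | no f≈0 = topForm em g (λ x → trans (F≈g x) (trans (+-congˡ (f-zero x)) (+-identityʳ _))) (x , Fx≉0)
    where
    f-zero : ∀ w → ⟦ f ⟧f w ≈ 0#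
    f-zero w with em {P = ⟦ f ⟧f w ≈ 0#}
    ... | yes eq = eq
    ... | no neq = contradiction (w , neq) f≈0

  -- If w i ≠ 0, then (z, t) ↦ `point z t` is a linear change of coordinates: z sits on the
  -- hyperplane where coordinate i is 0, and t moves along w. In these coordinates a form with
  -- nonzero value at w is, up to that constant, monic in t.
  module Line {n} (i : Fin (suc n)) (w : Vector Carrier (suc n)) where

    point : Vector Carrier n → Carrier → Vector Carrier (suc n)
    point z t j = insertAt z i 0# j + t * w j

    private
      ⟦insertAt⟧ : ∀ {m n} (xs : Vector (Expr m) n) (i : Fin (suc n)) e j z →
                   ⟦ insertAt xs i e j ⟧ₑ z ≡ insertAt (λ k → ⟦ xs k ⟧ₑ z) i (⟦ e ⟧ₑ z) j
      ⟦insertAt⟧ xs zero e zero z = ≡.refl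
      ⟦insertAt⟧ xs zero e (suc j) z = ≡.refl
      ⟦insertAt⟧ {n = suc n} xs (suc i) e zero z = ≡.refl
      ⟦insertAt⟧ {n = suc n} xs (suc i) e (suc j) z = ⟦insertAt⟧ (Vector.tail xs) i e j z

      origin : Vector (Expr n) (suc n)
      origin = insertAt var i (const 0#)

    restrict : Expr (suc n) → ExprPoly n
    restrict = expand (λ j → origin j ∷ const (w j) ∷ [])

    horner-restrict : ∀ e z t → horner (restrict e at z) t ≈ ⟦ e ⟧ₑ (point z t)
    horner-restrict e z t = trans (horner-expand _ e z t) (⟦⟧ₑ-cong e λ j →
      +-cong (reflexive (⟦insertAt⟧ var i (const 0#) j z))
             (*-congˡ (trans (+-congˡ (zeroʳ t)) (+-identityʳ (w j)))))

    LowerPart : ∀ D → (Vector Carrier n → Carrier → Carrier) → Set (c Level.⊔ ℓ)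
    LowerPart D F = ∃[ p ] List.length p ℕ.≤ D × ∀ z t → F z t ≈ horner (p at z) t

    -- The power t ^ k arises only by taking t w from every variable, which gives the coefficient
    -- f(w). In a product the other three terms all have degree below k + l in t.
    form-on-line : ∀ {k} (f : Form (suc n) k) → ∃[ p ] List.length p ℕ.≤ k ×
                   (∀ z t → ⟦ f ⟧f (point z t) ≈ horner (p at z) t + t ^ k * ⟦ f ⟧f w)
    form-on-line nought = [] , ℕ.z≤n , λ z t → sym (trans (+-identityˡ _) (zeroʳ _))
    form-on-line (const a) = [] , ℕ.z≤n , λ z t → sym (trans (+-identityˡ _) (*-identityˡ a))
    form-on-line (var j) = origin j ∷ [] , ℕ.≤-refl , λ z t → +-cong
      (sym (trans (+-congˡ (zeroʳ t)) (trans (+-identityʳ _) (reflexive (⟦insertAt⟧ var i (const 0#) j z)))))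
      (*-congʳ (sym (*-identityʳ t)))
    form-on-line {k} (f ⊕ g) with form-on-line f | form-on-line g
    ... | p , p≤k , f≈ | q , q≤k , g≈ = p ⊞ q , length-⊞ p q p≤k q≤k , λ z t → begin
      ⟦ f ⟧f (point z t) + ⟦ g ⟧f (point z t)   ≈⟨ +-cong (f≈ z t) (g≈ z t) ⟩
      (horner (p at z) t + t ^ k * ⟦ f ⟧f w) + (horner (q at z) t + t ^ k * ⟦ g ⟧f w)
        ≈⟨ solve 5 (λ p q t f g → (p :+ t :* f) :+ (q :+ t :* g) := (p :+ q) :+ t :* (f :+ g)) refl _ _ _ _ _ ⟩
      (horner (p at z) t + horner (q at z) t) + t ^ k * (⟦ f ⟧f w + ⟦ g ⟧f w)
        ≈⟨ +-congʳ (horner-⊞ p q z t) ⟨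
      horner ((p ⊞ q) at z) t + t ^ k * (⟦ f ⟧f w + ⟦ g ⟧f w)  ∎
    form-on-line (_⊗_ {k} {l} f g) with form-on-line f | form-on-line g
    ... | p , p≤k , f≈ | q , q≤l , g≈ = r , r≤k+l , λ z t →
      let P = horner (p at z) t
          Q = horner (q at z) t
      in begin
      ⟦ f ⟧f (point z t) * ⟦ g ⟧f (point z t)   ≈⟨ *-cong (f≈ z t) (g≈ z t) ⟩
      (P + t ^ k * a) * (Q + t ^ l * b)
        ≈⟨ solve 6 (λ P Q tk tl a b → (P :+ tk :* a) :* (Q :+ tl :* b) :=
             (P :* Q :+ (tl :* (b :* P) :+ tk :* (a :* Q))) :+ (tk :* tl) :* (a :* b)) refl P Q (t ^ k) (t ^ l) a b ⟩
      (P * Q + (t ^ l * (b * P) + t ^ k * (a * Q))) + (t ^ k * t ^ l) * (a * b)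
        ≈⟨ +-cong (+-cong (horner-⊠ p q z t) (+-cong (shifted l b p z t) (shifted k a q z t)))
                  (*-congʳ (^-homo-* t k l)) ⟨
      (horner ((p ⊠ q) at z) t + (horner (shift l (scale (const b) p) at z) t
        + horner (shift k (scale (const a) q) at z) t)) + t ^ (k ℕ.+ l) * (a * b)
        ≈⟨ +-congʳ (trans (horner-⊞ (p ⊠ q) _ z t) (+-congˡ (horner-⊞ (shift l (scale (const b) p)) _ z t))) ⟨
      horner (r at z) t + t ^ (k ℕ.+ l) * (a * b)  ∎
      where
      a = ⟦ f ⟧f w
      b = ⟦ g ⟧f w
      r = p ⊠ q ⊞ (shift l (scale (const b) p) ⊞ shift k (scale (const a) q))
      shifted : ∀ k b p z t → horner (shift k (scale (const b) p) at z) t ≈ t ^ k * (b * horner (p at z) t)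
      shifted k b p z t = trans (horner-shift k (scale (const b) p) z t) (*-congˡ (horner-scale (const b) p z t))
      length-shifted : ∀ k b (p : ExprPoly n) → List.length (shift k (scale (const b) p)) ≡ k ℕ.+ List.length p
      length-shifted k b p = ≡.trans (length-shift k _) (≡.cong (k ℕ.+_) (length-scale (const b) p))
      r≤k+l : List.length r ℕ.≤ k ℕ.+ l
      r≤k+l = length-⊞ (p ⊠ q) _ (ℕ.≤-trans (length-⊠ p q) (ℕ.+-mono-≤ p≤k q≤l))
        (length-⊞ (shift l _) _
          (ℕ.≤-trans (ℕ.≤-reflexive (length-shifted l b p))
            (ℕ.≤-trans (ℕ.+-monoʳ-≤ l p≤k) (ℕ.≤-reflexive (ℕ.+-comm l k))))
          (ℕ.≤-trans (ℕ.≤-reflexive (length-shifted k a q)) (ℕ.+-monoʳ-≤ k q≤l)))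

    graded-on-line : ∀ {D} (g : Graded (suc n) D) → LowerPart D (λ z t → ⟦ g ⟧g (point z t))
    graded-on-line ∅ = [] , ℕ.z≤n , λ z t → refl
    graded-on-line {suc D} (g ▷ f) with graded-on-line g | form-on-line f
    ... | p , p≤D , g≈ | q , q≤D , f≈ = r , r≤1+D , λ z t → begin
      ⟦ g ⟧g (point z t) + ⟦ f ⟧f (point z t)  ≈⟨ +-cong (g≈ z t) (f≈ z t) ⟩
      horner (p at z) t + (horner (q at z) t + t ^ D * ⟦ f ⟧f w)
        ≈⟨ +-congˡ (+-congˡ (*-congˡ (trans (+-congˡ (zeroʳ t)) (+-identityʳ _)))) ⟨
      horner (p at z) t + (horner (q at z) t + t ^ D * (⟦ f ⟧f w + t * 0#))
        ≈⟨ +-congˡ (+-congˡ (horner-shift D (const (⟦ f ⟧f w) ∷ []) z t)) ⟨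
      horner (p at z) t + (horner (q at z) t + horner (shift D (const (⟦ f ⟧f w) ∷ []) at z) t)
        ≈⟨ trans (horner-⊞ p _ z t) (+-congˡ (horner-⊞ q _ z t)) ⟨
      horner (r at z) t  ∎
      where
      r = p ⊞ (q ⊞ shift D (const (⟦ f ⟧f w) ∷ []))
      r≤1+D : List.length r ℕ.≤ suc D
      r≤1+D = length-⊞ p _ (ℕ.m≤n⇒m≤1+n p≤D) (length-⊞ q _ (ℕ.m≤n⇒m≤1+n q≤D)
        (ℕ.≤-reflexive (≡.trans (length-shift D _) (ℕ.+-comm D 1))))

-- Nullstellensatz modulo an ideal of functions

module Nullstellensatz
  (em : ∀ {a} → ExcludedMiddle a) {c ℓ} (F : Field c ℓ)
  (closed : AlgebraicallyClosed F) (horner-zero : FieldFacts.DeterminesCoefficients F)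
  where

  open Field F hiding (zero)
  open FieldFacts F
  open PolynomialExpressions F
  open IntegerCoefficientSolver commutativeRing
  open SetoidReasoning setoid
  open Sum semiring using (sum-cong-≋; sum-replicate-zero; *-distribˡ-sum; ∑-distrib-+)

  private
    by-contradiction : ∀ {a} {P : Set a} → ¬ ¬ P → P
    by-contradiction {P = P} ¬¬p with em {P = P}
    ... | yes p = p
    ... | no ¬p = contradiction ¬p ¬¬p

  -- Scalars S and ideal I are predicates on functions, so congruence modulo I replaces equality in
  -- a quotient ring and no quotient is formed.
  record FunctionIdeal {ξ} (X : Set ξ) s i : Set (ξ Level.⊔ c Level.⊔ ℓ Level.⊔ Level.suc (s Level.⊔ i)) where
    field
      S : (X → Carrier) → Set s
      I : (X → Carrier) → Set i
      S-const : ∀ k → S (λ _ → k)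
      S-+     : ∀ {f g} → S f → S g → S (λ x → f x + g x)
      S-*     : ∀ {f g} → S f → S g → S (λ x → f x * g x)
      I-resp  : ∀ {f g} → (∀ x → f x ≈ g x) → I f → I g
      I-zero  : I (λ _ → 0#)
      I-+     : ∀ {f g} → I f → I g → I (λ x → f x + g x)
      I-*     : ∀ {f g} → S f → I g → I (λ x → f x * g x)

    Proper : Set i
    Proper = ¬ I (λ _ → 1#)

    I-neg : ∀ {f} → I f → I (λ x → - f x)
    I-neg {f} If = I-resp (λ x → solve 1 (λ f → :- con (+ 1) :* f := :- f) refl (f x)) (I-* (S-const (- 1#)) If)

    I-minus : ∀ {f g} → I f → I g → I (λ x → f x - g x)
    I-minus If Ig = I-+ If (I-neg Ig)

    I-sum : ∀ {n} (f : Fin n → X → Carrier) → (∀ j → I (f j)) → I (λ x → sum (λ j → f j x))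
    I-sum {zero}  f If = I-zero
    I-sum {suc n} f If = I-+ (If zero) (I-sum (λ j → f (suc j)) (λ j → If (suc j)))

    S-^ : ∀ {f} n → S f → S (λ x → f x ^ n)
    S-^ zero    Sf = S-const 1#
    S-^ (suc n) Sf = S-* Sf (S-^ n Sf)

    S-expr : ∀ {n} {z : X → Vector Carrier n} → (∀ j → S (λ x → z x j)) →
             ∀ e → S (λ x → ⟦ e ⟧ₑ (z x))
    S-expr Sz (const a) = S-const a
    S-expr Sz (var i)  = Sz i
    S-expr Sz (e ⊕ f)  = S-+ (S-expr Sz e) (S-expr Sz f)
    S-expr Sz (e ⊗ f)  = S-* (S-expr Sz e) (S-expr Sz f)

    proper-const : Proper → ∀ {k} → I (λ _ → k) → k ≈ 0#
    proper-const proper {k} Ik = by-contradiction λ k≉0 →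
      proper (I-resp (λ _ → trans (*-comm _ _) (*-inverseʳ k≉0)) (I-* (S-const (k ⁻¹)) Ik))

  module _ {ξ} {X : Set ξ} {s i} (𝓘 : FunctionIdeal X s i) where

    open FunctionIdeal 𝓘

    module Nakayama {n} (z : X → Vector Carrier n) (Sz : ∀ j → S (λ x → z x j))
                    (a : Vector Carrier n) where

      neg : Expr n → Expr n
      neg e = const (- 1#) ⊗ e

      combination : ∀ {k} → (Fin k → Expr n) → (Fin k → X → Carrier) → X → Carrier
      combination r b x = sum (λ j → ⟦ r j ⟧ₑ (z x) * b j x)

      private
        combination-eliminate : ∀ {k} (p q : Expr n) (u v : Fin k → Expr n) b x →
          combination (λ j → p ⊗ u j ⊕ neg (q ⊗ v j)) b x ≈
          ⟦ p ⟧ₑ (z x) * combination u b x - ⟦ q ⟧ₑ (z x) * combination v b x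
        combination-eliminate {zero} p q u v b x =
          solve 2 (λ p q → con (+ 0) := p :* con (+ 0) :- q :* con (+ 0)) refl _ _
        combination-eliminate {suc k} p q u v b x = trans
          (+-congˡ (combination-eliminate p q (λ j → u (suc j)) (λ j → v (suc j)) (λ j → b (suc j)) x))
          (solve 7 (λ p q u v b U V →
            (p :* u :+ :- con (+ 1) :* (q :* v)) :* b :+ (p :* U :- q :* V) :=
            p :* (u :* b :+ U) :- q :* (v :* b :+ V)) refl _ _ _ _ _ _ _)

      -- Gaussian elimination over the local ring at a: a matrix that is the
      -- identity at a has diagonal pivots not vanishing at a.
      annihilator : ∀ {k} (b : Fin k → X → Carrier) (m : Fin k → Fin k → Expr n) →
        (∀ i → ⟦ m i i ⟧ₑ a ≈ 1#) → (∀ i j → i ≢ j → ⟦ m i j ⟧ₑ a ≈ 0#) →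
        (∀ i → I (combination (m i) b)) →
        ∃[ α ] ⟦ α ⟧ₑ a ≈ 1# × (∀ j → I (λ x → ⟦ α ⟧ₑ (z x) * b j x))
      annihilator {zero}  b m diagonal off-diagonal Im = const 1# , refl , λ ()
      annihilator {suc k} b m diagonal off-diagonal Im = α ⊗ m zero zero , trans (*-cong α≈1 (diagonal zero)) (*-identityˡ 1#) , λ
        -- In α times row zero, all terms but the first are already in I, because α annihilates the
        -- remaining generators.
        { zero → I-resp
            (λ x → trans (+-congˡ (-‿cong (trans
                     (sum-cong-≋ {k} (λ j → solve 3 (λ m α b → m :* (α :* b) := α :* (m :* b)) refl _ _ _))
                     (sym (*-distribˡ-sum {k} (⟦ α ⟧ₑ (z x)) (λ j → ⟦ m zero (suc j) ⟧ₑ (z x) * b (suc j) x))))))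
                   (solve 4 (λ α m b U → α :* (m :* b :+ U) :- α :* U := α :* m :* b) refl _ _ _ _))
            (I-minus (I-* (S-expr Sz α) (Im zero))
                 (I-sum (λ j x → ⟦ m zero (suc j) ⟧ₑ (z x) * (⟦ α ⟧ₑ (z x) * b (suc j) x))
                        (λ j → I-* (S-expr Sz (m zero (suc j))) (Iα j))))
        ; (suc j) → I-resp (λ x → solve 3 (λ m α b → m :* (α :* b) := α :* m :* b) refl _ _ _)
                      (I-* (S-expr Sz (m zero zero)) (Iα j))
        }
        where
        -- Pivot times row minus entry times row zero removes `b zero` without division. At a the
        -- pivot is 1 and the entry is 0, so the smaller matrix is again the identity there.
        m′ : Fin k → Fin k → Expr n
        m′ i j = m zero zero ⊗ m (suc i) (suc j) ⊕ neg (m (suc i) zero ⊗ m zero (suc j))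
        diagonal′ : ∀ i → ⟦ m′ i i ⟧ₑ a ≈ 1#
        diagonal′ i = trans
          (+-cong (*-cong (diagonal zero) (diagonal (suc i)))
                  (*-congˡ (*-congʳ (off-diagonal (suc i) zero λ ()))))
          (solve 1 (λ t → con (+ 1) :* con (+ 1) :+ :- con (+ 1) :* (con (+ 0) :* t) := con (+ 1)) refl _)
        off-diagonal′ : ∀ i j → i ≢ j → ⟦ m′ i j ⟧ₑ a ≈ 0#
        off-diagonal′ i j i≢j = trans
          (+-cong (*-congˡ (off-diagonal (suc i) (suc j) (λ eq → i≢j (Fin.suc-injective eq))))
                  (*-congˡ (*-congʳ (off-diagonal (suc i) zero λ ()))))
          (solve 2 (λ s t → s :* con (+ 0) :+ :- con (+ 1) :* (con (+ 0) :* t) := con (+ 0)) refl _ _)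
        Im′ : ∀ i → I (combination (m′ i) (λ j → b (suc j)))
        Im′ i = I-resp
          (λ x → trans
            (solve 5 (λ p q b₀ U V → p :* (q :* b₀ :+ U) :- q :* (p :* b₀ :+ V) := p :* U :- q :* V)
              refl (⟦ m zero zero ⟧ₑ (z x)) (⟦ m (suc i) zero ⟧ₑ (z x)) (b zero x) _ _)
            (sym (combination-eliminate (m zero zero) (m (suc i) zero) (λ j → m (suc i) (suc j)) (λ j → m zero (suc j)) (λ j → b (suc j)) x)))
          (I-minus (I-* (S-expr Sz (m zero zero)) (Im (suc i))) (I-* (S-expr Sz (m (suc i) zero)) (Im zero)))
        inductive-step = annihilator (λ j → b (suc j)) m′ diagonal′ off-diagonal′ Im′
        α = proj₁ inductive-step
        α≈1 = proj₁ (proj₂ inductive-step)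
        Iα : ∀ j → I (λ x → ⟦ α ⟧ₑ (z x) * b (suc j) x)
        Iα = proj₂ (proj₂ inductive-step)

      module Spans {k} (b : Fin k → X → Carrier) where

        -- The condition Q on the coefficients separates membership in the module M generated by the
        -- b j (`Anything`) from membership in mM, with m the maximal ideal of a (`Vanishing`).
        record Span {q} (Q : Expr n → Set q) (f : X → Carrier) : Set (c Level.⊔ q Level.⊔ i) where
          constructor spanned
          field
            row       : Fin k → Expr n
            row-in    : ∀ j → Q (row j)
            congruent : I (λ x → f x - combination row b x)

        Vanishing : Expr n → Set ℓ
        Vanishing e = ⟦ e ⟧ₑ a ≈ 0#

        Anything : Expr n → Set
        Anything _ = ⊤

        span-mod : ∀ {q} {Q : Expr n → Set q} {f g} → I (λ x → f x - g x) → Span Q g → Span Q f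
        span-mod If-g (spanned r Qr Ig) = spanned r Qr
          (I-resp (λ x → solve 3 (λ f g c → (f :- g) :+ (g :- c) := f :- c) refl _ _ _) (I-+ If-g Ig))

        span-resp : ∀ {q} {Q : Expr n → Set q} {f g} → (∀ x → f x ≈ g x) → Span Q g → Span Q f
        span-resp {g = g} f≈g = span-mod (I-resp
          (λ x → sym (trans (+-congʳ (f≈g x)) (-‿inverseʳ (g x)))) I-zero)

        span-ideal : ∀ {q} {Q : Expr n → Set q} → Q (const 0#) → ∀ {f} → I f → Span Q f
        span-ideal Q0 {f} If = spanned (λ _ → const 0#) (λ _ → Q0) (I-resp
          (λ x → sym (trans (+-congˡ (-‿cong (trans (sum-cong-≋ {k} (λ j → zeroˡ (b j x))) (sum-replicate-zero k))))
                   (solve 1 (λ f → f :- con (+ 0) := f) refl (f x)))) If)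

        span-+ : ∀ {q} {Q : Expr n → Set q} → (∀ {e e′} → Q e → Q e′ → Q (e ⊕ e′)) →
                 ∀ {f g} → Span Q f → Span Q g → Span Q (λ x → f x + g x)
        span-+ Q+ (spanned r Qr If) (spanned r′ Qr′ Ig) = spanned (λ j → r j ⊕ r′ j) (λ j → Q+ (Qr j) (Qr′ j)) (I-resp
          (λ x → trans
            (solve 4 (λ f c g d → (f :- c) :+ (g :- d) := (f :+ g) :- (c :+ d)) refl _ _ _ _)
            (+-congˡ (-‿cong (trans
              (sym (∑-distrib-+ {k} (λ j → ⟦ r j ⟧ₑ (z x) * b j x) (λ j → ⟦ r′ j ⟧ₑ (z x) * b j x)))
              (sum-cong-≋ {k} (λ j → sym (distribʳ (b j x) _ _)))))))
          (I-+ If Ig))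

        span-scale : ∀ {q q′} {Q : Expr n → Set q} {Q′ : Expr n → Set q′} e →
                     (∀ {e′} → Q e′ → Q′ (e ⊗ e′)) →
                     ∀ {f} → Span Q f → Span Q′ (λ x → ⟦ e ⟧ₑ (z x) * f x)
        span-scale e Qe (spanned r Qr If) = spanned (λ j → e ⊗ r j) (λ j → Qe (Qr j)) (I-resp
          (λ x → trans
            (solve 3 (λ e f c → e :* (f :- c) := e :* f :- e :* c) refl _ _ _)
            (+-congˡ (-‿cong (trans
              (*-distribˡ-sum {k} (⟦ e ⟧ₑ (z x)) (λ j → ⟦ r j ⟧ₑ (z x) * b j x))
              (sum-cong-≋ {k} (λ j → sym (*-assoc _ _ _)))))))
          (I-* (S-expr Sz e) If))

        private
          unit : ∀ {k} → Fin k → Fin k → Expr n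
          unit zero    zero    = const 1#
          unit zero    (suc l) = const 0#
          unit (suc j) zero    = const 0#
          unit (suc j) (suc l) = unit j l

          unit-combination : ∀ {k} (b : Fin k → X → Carrier) j x → combination (unit j) b x ≈ b j x
          unit-combination {suc k} b zero x = trans
            (+-cong (*-identityˡ _) (trans (sum-cong-≋ {k} (λ j → zeroˡ (b (suc j) x))) (sum-replicate-zero k)))
            (+-identityʳ _)
          unit-combination b (suc j) x = trans
            (+-cong (zeroˡ _) (unit-combination (λ j → b (suc j)) j x)) (+-identityˡ _)

          unit-diagonal : ∀ {k} (j : Fin k) → ⟦ unit j j ⟧ₑ a ≈ 1#
          unit-diagonal zero    = refl
          unit-diagonal (suc j) = unit-diagonal j

          unit-off-diagonal : ∀ {k} (i j : Fin k) → i ≢ j → ⟦ unit i j ⟧ₑ a ≈ 0#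
          unit-off-diagonal zero    zero    i≢j = contradiction ≡.refl i≢j
          unit-off-diagonal zero    (suc j) i≢j = refl
          unit-off-diagonal (suc i) zero    i≢j = refl
          unit-off-diagonal (suc i) (suc j) i≢j = unit-off-diagonal i j (λ eq → i≢j (≡.cong suc eq))

        span-generator : ∀ j → Span Anything (b j)
        span-generator j = spanned (unit j) (λ _ → tt) (I-resp
          (λ x → sym (trans (+-congˡ (-‿cong (unit-combination b j x))) (-‿inverseʳ _))) I-zero)

        -- Nakayama's lemma: if M = mM for the module M generated by the b j,
        -- then some α ≡ 1 modulo m annihilates M.
        nakayama : (∀ j → Span Vanishing (b j)) →
                   ∃[ α ] ⟦ α ⟧ₑ a ≈ 1# × (∀ j → I (λ x → ⟦ α ⟧ₑ (z x) * b j x))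
        nakayama spans = annihilator b m
          (λ i → trans (+-cong (unit-diagonal i) (*-congˡ (vanishing i i)))
            (solve 0 (con (+ 1) :+ :- con (+ 1) :* con (+ 0) := con (+ 1)) refl))
          (λ i j i≢j → trans (+-cong (unit-off-diagonal i j i≢j) (*-congˡ (vanishing i j)))
            (solve 0 (con (+ 0) :+ :- con (+ 1) :* con (+ 0) := con (+ 0)) refl))
          (λ i → I-resp
            (λ x → trans (+-cong (sym (unit-combination b i x))
                     (trans (solve 1 (λ c → :- c := :- con (+ 1) :* c) refl _)
                       (trans (*-distribˡ-sum {k} (- 1#) (λ j → ⟦ row i j ⟧ₑ (z x) * b j x))
                         (sum-cong-≋ {k} (λ j → sym (*-assoc _ _ _))))))
                   (trans (sym (∑-distrib-+ {k} (λ j → ⟦ unit i j ⟧ₑ (z x) * b j x)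
                                   (λ j → (- 1# * ⟦ row i j ⟧ₑ (z x)) * b j x)))
                     (sum-cong-≋ {k} (λ j → sym (distribʳ (b j x) _ _)))))
            (Span.congruent (spans i)))
          where
          row : Fin k → Fin k → Expr n
          row i = Span.row (spans i)
          vanishing : ∀ i j → ⟦ row i j ⟧ₑ a ≈ 0#
          vanishing i = Span.row-in (spans i)
          -- From b ≡ R b with R vanishing at a one gets (1 - R) b ≡ 0, and 1 - R is the identity
          -- matrix at a.
          m : Fin k → Fin k → Expr n
          m i j = unit i j ⊕ neg (row i j)

    -- J consists of the relations satisfied by τ, restricted to the fibre z = a.
    module Fibre {n} (z : X → Vector Carrier n) (Sz : ∀ j → S (λ x → z x j))
                 (τ : X → Carrier) (Sτ : S τ) (proper : Proper) (a : Vector Carrier n)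
                 (zero-of-relations : ∀ e → I (λ x → ⟦ e ⟧ₑ (z x)) → ⟦ e ⟧ₑ a ≈ 0#)
                 where

      J : (Carrier → Carrier) → Set _
      J q = Σ (ExprPoly n) λ p → (∀ t → horner (p at a) t ≈ q t) × I (λ x → horner (p at z x) (τ x))

      J-minus : ∀ {q r} → J q → J r → J (λ t → q t - r t)
      J-minus (p , p≈q , Ip) (p′ , p′≈r , Ip′) = p ⊞ scale (const (- 1#)) p′ ,
        (λ t → trans (minus p p′ a t) (+-cong (p≈q t) (-‿cong (p′≈r t)))) ,
        I-resp (λ x → sym (minus p p′ (z x) (τ x))) (I-minus Ip Ip′)
        where
        minus : ∀ p p′ z t → horner ((p ⊞ scale (const (- 1#)) p′) at z) t ≈ horner (p at z) t - horner (p′ at z) t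
        minus p p′ z t = trans (horner-⊞ p _ z t) (+-congˡ (trans (horner-scale (const (- 1#)) p′ z t)
          (solve 1 (λ x → :- con (+ 1) :* x := :- x) refl _)))

      S-poly : ∀ p → S (λ x → horner (p at z x) (τ x))
      S-poly []      = S-const 0#
      S-poly (e ∷ p) = S-+ (S-expr Sz e) (S-* Sτ (S-poly p))

      J-* : ∀ as {q} → J q → J (λ t → horner as t * q t)
      J-* as (p , p≈q , Ip) = constants as ⊠ p ,
        (λ t → trans (horner-⊠ (constants as) p a t) (*-cong (constants-at as a t) (p≈q t))) ,
        I-resp (λ x → sym (horner-⊠ (constants as) p (z x) (τ x))) (I-* (S-poly (constants as)) Ip)

      J-resp : ∀ {q r} → (∀ t → q t ≈ r t) → J q → J r
      J-resp q≈r (p , p≈q , Ip) = p , (λ t → trans (p≈q t) (q≈r t)) , Ip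

      J-unscale : ∀ {k q} → k ≉ 0# → J (λ t → k * q t) → J q
      J-unscale {k} {q} k≉0 Jkq = J-resp
        (λ t → trans (*-congʳ (trans (+-congˡ (zeroʳ t)) (+-identityʳ _))) (x⁻¹*[x*y]≈y k≉0 (q t)))
        (J-* (k ⁻¹ ∷ []) Jkq)

      -- If t₀ is a root of h = (t - t₀) q but not of f, then
      -- f(t₀) q = f q - h (f - f(t₀)) / (t - t₀) lies in the ideal.
      common-root-or-one : ∀ {β m h} → Leading β m h → β ≉ 0# → J (horner h) →
        (∃[ t ] (∀ {q} → J q → q t ≈ 0#)) ⊎ J (λ _ → 1#)
      common-root-or-one {β} ([_] {b} b≈β) β≉0 Jh = inj₂ (J-unscale β≉0 (J-resp
        (λ t → trans (+-cong b≈β (zeroʳ t)) (trans (+-identityʳ β) (sym (*-identityʳ β)))) Jh))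
      common-root-or-one {β} {h = h} l@(_ ∷ _) β≉0 Jh = divide em
        where
        solution = horner-root closed l β≉0
        t₀ = proj₁ solution
        root = proj₂ solution
        q = quotient t₀ h
        identity : ∀ {f : Carrier → Carrier} (p : ExprPoly n) → (∀ t → horner (p at a) t ≈ f t) → ∀ t →
                   horner q t * f t - horner (quotient t₀ (p at a)) t * horner h t ≈ f t₀ * horner q t
        identity {f} p p≈f t = begin
          Q * f t - G * H
            ≈⟨ +-cong (*-congˡ f-split) (-‿cong (*-congˡ h-split)) ⟩
          Q * (f t₀ + (t - t₀) * G) - G * ((t - t₀) * Q)
            ≈⟨ solve 4 (λ Q G d f → Q :* (f :+ d :* G) :- G :* (d :* Q) := f :* Q) refl Q G (t - t₀) (f t₀) ⟩
          f t₀ * Q ∎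
          where
          Q = horner q t
          G = horner (quotient t₀ (p at a)) t
          H = horner h t
          f-split : f t ≈ f t₀ + (t - t₀) * G
          f-split = trans (solve 2 (λ x y → x := y :+ (x :- y)) refl (f t) (f t₀))
            (+-congˡ (trans (+-cong (sym (p≈f t)) (-‿cong (sym (p≈f t₀)))) (horner-quotient t₀ (p at a) t)))
          h-split : H ≈ (t - t₀) * Q
          h-split = trans (solve 1 (λ x → x := x :- con (+ 0)) refl H)
            (trans (+-congˡ (-‿cong (sym root))) (horner-quotient t₀ h t))
        divide : Dec (∃[ f ] J f × f t₀ ≉ 0#) → (∃[ t ] (∀ {q} → J q → q t ≈ 0#)) ⊎ J (λ _ → 1#)
        divide (no ¬f) = inj₁ (t₀ , λ Jq → by-contradiction λ qt₀≉0 → ¬f (_ , Jq , qt₀≉0))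
        divide (yes (f , Jf@(p , p≈f , Ip) , ft₀≉0)) =
          common-root-or-one (quotient-Leading t₀ l) β≉0 (J-unscale ft₀≉0 (J-resp (identity p p≈f)
            (J-minus (J-* q Jf) (J-* (quotient t₀ (p at a)) Jh))))

      open Nakayama z Sz a

      -- As k is a nonzero constant, the relation makes τ integral over the polynomials in z modulo
      -- I. The powers of τ below D + 1 therefore generate all powers, which provides the finite
      -- generation that Nakayama's lemma needs.
      module Integral (D : ℕ) (L : ExprPoly n) (L≤D : List.length L ℕ.≤ suc D) (k : Carrier) (k≉0 : k ≉ 0#)
                      (integral : I (λ x → horner (L at z x) (τ x) + τ x ^ suc D * k)) where

        power : Fin (suc D) → X → Carrier
        power j x = τ x ^ toℕ j

        open Spans power

        private
          van-+ : ∀ {e e′} → Vanishing e → Vanishing e′ → Vanishing (e ⊕ e′)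
          van-+ e≈0 e′≈0 = trans (+-cong e≈0 e′≈0) (+-identityˡ 0#)

          low-power : ∀ m → m ℕ.< suc D → Span Anything (λ x → τ x ^ m)
          low-power m m<D = span-resp
            (λ x → reflexive (≡.cong (τ x ^_) (≡.sym (Fin.toℕ-fromℕ< m<D)))) (span-generator (fromℕ< m<D))

          low-degree : ∀ m p → m ℕ.+ List.length p ℕ.≤ suc D →
                       Span Anything (λ x → τ x ^ m * horner (p at z x) (τ x))
          low-degree m [] _ = span-resp (λ x → zeroʳ _) (span-ideal tt I-zero)
          low-degree m (e ∷ p) m+p≤D = span-resp
            (λ x → solve 4 (λ tm e t p → tm :* (e :+ t :* p) := e :* tm :+ (t :* tm) :* p) refl _ _ _ _)
            (span-+ (λ _ _ → tt)
              (span-scale e (λ _ → tt) (low-power m (ℕ.≤-trans (ℕ.m≤m+n (suc m) _) sm+p≤D)))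
              (low-degree (suc m) p sm+p≤D))
            where
            sm+p≤D : suc m ℕ.+ List.length p ℕ.≤ suc D
            sm+p≤D = ℕ.≤-trans (ℕ.≤-reflexive (≡.sym (ℕ.+-suc m _))) m+p≤D

          top-power : Span Anything (λ x → τ x ^ suc D)
          top-power = span-mod
            (I-resp (λ x → trans
                (solve 4 (λ w L t k → w :* (L :+ t :* k) := (k :* w) :* t :- (:- w) :* (con (+ 1) :* L))
                  refl (k ⁻¹) (horner (L at z x) (τ x)) (τ x ^ suc D) k)
                (+-congʳ (trans (*-congʳ (*-inverseʳ k≉0)) (*-identityˡ _))))
              (I-* (S-const (k ⁻¹)) integral))
            (span-scale (const (- k ⁻¹)) (λ _ → tt) (low-degree 0 L L≤D))

          span-sum : ∀ {m} (f : Fin m → X → Carrier) → (∀ j → Span Anything (f j)) →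
                     Span Anything (λ x → sum (λ j → f j x))
          span-sum {zero} f _ = span-ideal tt I-zero
          span-sum {suc m} f spans = span-+ (λ _ _ → tt) (spans zero) (span-sum (λ j → f (suc j)) (λ j → spans (suc j)))

          -- Multiplication by τ sends each generator to the next; only the last one leaves the
          -- list, and `top-power` brings it back.
          span-τ : ∀ {f} → Span Anything f → Span Anything (λ x → τ x * f x)
          span-τ {f} (spanned r _ If) = span-mod
            (I-resp (λ x → trans (solve 3 (λ t f c → t :* (f :- c) := t :* f :- t :* c) refl (τ x) (f x) _)
                (+-congˡ (-‿cong (trans
                  (*-distribˡ-sum {suc D} (τ x) (λ j → ⟦ r j ⟧ₑ (z x) * power j x))
                  (sum-cong-≋ {suc D} (λ j → solve 3 (λ t r b → t :* (r :* b) := r :* (t :* b)) refl (τ x) (⟦ r j ⟧ₑ (z x)) (power j x)))))))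
              (I-* Sτ If))
            (span-sum (λ j x → ⟦ r j ⟧ₑ (z x) * (τ x * power j x))
              (λ j → span-scale (r j) (λ _ → tt) (next j (ℕ.m≤n⇒m<n∨m≡n (Fin.toℕ<n j)))))
            where
            next : ∀ j → suc (toℕ j) ℕ.< suc D ⊎ suc (toℕ j) ≡ suc D → Span Anything (λ x → τ x * power j x)
            next j (inj₁ j<D) = low-power (suc (toℕ j)) j<D
            next j (inj₂ eq)  = span-resp (λ x → reflexive (≡.cong (τ x ^_) eq)) top-power

          any-power : ∀ m → Span Anything (λ x → τ x ^ m)
          any-power zero    = low-power 0 (ℕ.s≤s ℕ.z≤n)
          any-power (suc m) = span-τ (any-power m)

          -- Every power of τ is a combination of the generators, so multiplying it by a coefficient
          -- that vanishes at a gives a combination with coefficients vanishing at a.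
          vanishing-span : ∀ m p → All (_≈ 0#) (p at a) →
                           Span Vanishing (λ x → τ x ^ m * horner (p at z x) (τ x))
          vanishing-span m [] [] = span-resp (λ x → zeroʳ _) (span-ideal refl I-zero)
          vanishing-span m (e ∷ p) (e≈0 ∷ p≈0) = span-resp
            (λ x → solve 4 (λ tm e t p → tm :* (e :+ t :* p) := e :* tm :+ (t :* tm) :* p) refl _ _ _ _)
            (span-+ (λ {e} {e′} → van-+ {e} {e′})
              (span-scale e (λ _ → trans (*-congʳ e≈0) (zeroˡ _)) (any-power m))
              (vanishing-span (suc m) p p≈0))

        -- p ≡ 1 modulo the maximal ideal of a would make τ^j ≡ τ^j (1 - p)
        -- vanish at a for all j, so Nakayama applies.
        not-one : ¬ J (λ _ → 1#)
        not-one (p , p≈1 , Ip) = 0≉1 (trans (sym (zero-of-relations α Iα)) α≈1)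
          where
          1-p : ExprPoly n
          1-p = (const 1# ∷ []) ⊞ scale (const (- 1#)) p
          horner-1-p : ∀ z t → horner (1-p at z) t ≈ 1# - horner (p at z) t
          horner-1-p z t = trans (horner-⊞ (const 1# ∷ []) (scale (const (- 1#)) p) z t)
            (+-cong (trans (+-congˡ (zeroʳ t)) (+-identityʳ 1#))
              (trans (horner-scale (const (- 1#)) p z t) (solve 1 (λ x → :- con (+ 1) :* x := :- x) refl _)))
          1-p-vanishes : All (_≈ 0#) (1-p at a)
          -- On the fibre, 1 - p is zero only as a function of t; `horner-zero` makes its
          -- coefficients vanish at a.
          1-p-vanishes = horner-zero (1-p at a) λ t →
            trans (horner-1-p a t) (trans (+-congˡ (-‿cong (p≈1 t))) (-‿inverseʳ 1#))
          spans : ∀ j → Span Vanishing (power j)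
          spans j = span-mod
            (I-resp (λ x → trans (solve 2 (λ b P → b :* P := b :- b :* (con (+ 1) :- P)) refl (power j x) _)
                             (+-congˡ (-‿cong (*-congˡ (sym (horner-1-p (z x) (τ x)))))))
              (I-* (S-^ (toℕ j) Sτ) Ip))
            (vanishing-span (toℕ j) 1-p 1-p-vanishes)
          result = nakayama spans
          α = proj₁ result
          α≈1 = proj₁ (proj₂ result)
          -- The generator of index `zero` is τ ^ 0 = 1, so α itself is a relation; it ought to
          -- vanish at a but has value 1.
          Iα : I (λ x → ⟦ α ⟧ₑ (z x))
          Iα = I-resp (λ x → *-identityʳ _) (proj₂ (proj₂ result) zero)

        -- Pads `as` with zeros up to degree m, since a list shorter than m would put k in too low a
        -- degree.
        monic : ∀ {m as} → List.length as ℕ.≤ m → ∃[ h ] Leading k m h × (∀ t → horner h t ≈ horner as t + t ^ m * k)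
        monic {zero} {[]} _ = k ∷ [] , [ refl ] , λ t →
          solve 2 (λ k t → k :+ t :* con (+ 0) := con (+ 0) :+ con (+ 1) :* k) refl k t
        monic {suc m} {[]} _ with monic {m} {[]} ℕ.z≤n
        ... | h , l , eq = 0# ∷ h , 0# ∷ l , λ t → trans (+-congˡ (*-congˡ (eq t)))
          (solve 3 (λ t tm k → con (+ 0) :+ t :* (con (+ 0) :+ tm :* k) := con (+ 0) :+ (t :* tm) :* k) refl t (t ^ m) k)
        monic {suc m} {b ∷ as} (ℕ.s≤s as≤m) with monic {as = as} as≤m
        ... | h , l , eq = b ∷ h , b ∷ l , λ t → trans (+-congˡ (*-congˡ (eq t)))
          (solve 5 (λ b t A tm k → b :+ t :* (A :+ tm :* k) := (b :+ t :* A) :+ (t :* tm) :* k)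
            refl b t (horner as t) (t ^ m) k)

        -- The integral relation restricts to a polynomial in J with leading coefficient k, so
        -- repeated division applies and `not-one` excludes its other outcome.
        common-root : ∃[ t ] (∀ {q} → J q → q t ≈ 0#)
        common-root with monic {suc D} {L at a} (ℕ.≤-trans (ℕ.≤-reflexive (List.length-map (λ e → ⟦ e ⟧ₑ a) L)) L≤D)
        ... | h , l , h≈ with common-root-or-one l k≉0 (L ⊞ top ,
                 (λ t → trans (value a t) (sym (h≈ t))) , I-resp (λ x → sym (value (z x) (τ x))) integral)
          where
          top : ExprPoly n
          top = shift (suc D) (const k ∷ [])
          value : ∀ z t → horner ((L ⊞ top) at z) t ≈ horner (L at z) t + t ^ suc D * k
          value z t = trans (horner-⊞ L top z t) (+-congˡ (trans (horner-shift (suc D) (const k ∷ []) z t)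
            (*-congˡ (trans (+-congˡ (zeroʳ t)) (+-identityʳ k)))))
        ...   | inj₁ root = root
        ...   | inj₂ J1   = contradiction J1 not-one

    -- The point is a common zero of all polynomial relations that the functions y j satisfy modulo
    -- I. A relation that is not the zero function makes one coordinate integral over n others;
    -- induction finds a zero a for those, and `common-root` extends it along the fibre.
    nullstellensatz : ∀ {n} (y : X → Vector Carrier n) → (∀ j → S (λ x → y x j)) → Proper →
                      ∃[ a ] (∀ e → I (λ x → ⟦ e ⟧ₑ (y x)) → ⟦ e ⟧ₑ a ≈ 0#)
    nullstellensatz {zero} y Sy proper = (λ ()) , λ e Ie →
      proper-const proper (I-resp (λ x → ⟦⟧ₑ-cong e λ ()) Ie)
    nullstellensatz {suc n} y Sy proper with em {P = ∃[ e ] I (λ x → ⟦ e ⟧ₑ (y x)) × ∃[ b ] ⟦ e ⟧ₑ b ≉ 0#}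
    -- Every relation is the zero function, so any point serves.
    ... | no ¬e = (λ _ → 0#) , λ e Ie → by-contradiction λ e≉0 → ¬e (e , Ie , _ , e≉0)
    ... | yes (e , Ie , e≉0) with graded e
    ...   | _ , g , e≈g with topForm em g e≈g e≉0
    ...     | record { degree = zero ; lower = ∅ ; top = f ; direction = w ; nonzero = fw≉0 ; decomposed = e≈ } =
      contradiction (proper-const proper (I-resp (λ x → constant (y x)) Ie)) fw≉0
      where
      -- Scaling by 0 preserves a form of degree 0, because 0 ^ 0 = 1, and sends all points to the
      -- origin. A nonzero constant in I would contradict properness.
      constant : ∀ x → ⟦ e ⟧ₑ x ≈ ⟦ f ⟧f w
      constant x = begin
        ⟦ e ⟧ₑ x                   ≈⟨ trans (e≈ x) (+-identityˡ _) ⟩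
        ⟦ f ⟧f x                   ≈⟨ *-identityˡ _ ⟨
        1# * ⟦ f ⟧f x              ≈⟨ ⟦⟧f-homogeneous f 0# x ⟨
        ⟦ f ⟧f (λ j → 0# * x j)    ≈⟨ ⟦⟧f-cong f (λ j → trans (zeroˡ (x j)) (sym (zeroˡ (w j)))) ⟩
        ⟦ f ⟧f (λ j → 0# * w j)    ≈⟨ ⟦⟧f-homogeneous f 0# w ⟩
        1# * ⟦ f ⟧f w              ≈⟨ *-identityˡ _ ⟩
        ⟦ f ⟧f w                   ∎
    ...     | record { degree = suc D ; lower = g′ ; top = f ; direction = w ; nonzero = fw≉0 ; decomposed = e≈ }
      -- A form of positive degree vanishes at the origin, so w has a nonzero coordinate.
      with by-contradiction {P = ∃[ i ] w i ≉ 0#} (λ ¬i → fw≉0 (begin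
             ⟦ f ⟧f w                   ≈⟨ ⟦⟧f-cong f (λ j → trans (by-contradiction (λ wj≉0 → ¬i (j , wj≉0))) (sym (zeroˡ (w j)))) ⟩
             ⟦ f ⟧f (λ j → 0# * w j)    ≈⟨ ⟦⟧f-homogeneous f 0# w ⟩
             0# * 0# ^ D * ⟦ f ⟧f w     ≈⟨ trans (*-congʳ (zeroˡ _)) (zeroˡ _) ⟩
             0#                         ∎))
    ...       | i , wi≉0 = point a t₀ , λ e′ Ie′ → root (restrict e′ , horner-restrict e′ a , I-resp (λ x →
                  trans (⟦⟧ₑ-cong e′ (on-line x)) (sym (horner-restrict e′ (z x) (τ x)))) Ie′)
      where
      open Line i w
      -- This inverts `point`: τ is determined by coordinate i, and z consists of the other
      -- coordinates of y - τ w.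
      τ : X → Carrier
      τ x = y x i * w i ⁻¹
      z : X → Vector Carrier n
      z x j = y x (punchIn i j) + τ x * - w (punchIn i j)
      Sτ : S τ
      Sτ = S-* (Sy i) (S-const _)
      Sz : ∀ j → S (λ x → z x j)
      Sz j = S-+ (Sy (punchIn i j)) (S-* Sτ (S-const _))
      on-line : ∀ x j → y x j ≈ point (z x) (τ x) j
      on-line x j with i Fin.≟ j
      ... | yes ≡.refl = sym (begin
        insertAt (z x) i 0# i + y x i * w i ⁻¹ * w i  ≈⟨ +-congʳ (reflexive (Vector.insertAt-lookup (z x) i 0#)) ⟩
        0# + y x i * w i ⁻¹ * w i   ≈⟨ solve 3 (λ y v w → con (+ 0) :+ y :* v :* w := y :* (w :* v)) refl (y x i) (w i ⁻¹) (w i) ⟩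
        y x i * (w i * w i ⁻¹)      ≈⟨ *-congˡ (*-inverseʳ wi≉0) ⟩
        y x i * 1#                  ≈⟨ *-identityʳ _ ⟩
        y x i                       ∎)
      ... | no i≢j = ≡.subst (λ j → y x j ≈ point (z x) (τ x) j) (Fin.punchIn-punchOut i≢j) (sym (trans
        (+-congʳ (reflexive (Vector.insertAt-punchIn (z x) i 0# (punchOut i≢j))))
        (solve 3 (λ y t w → (y :+ t :* :- w) :+ t :* w := y) refl _ _ _)))
      induction = nullstellensatz z Sz proper
      a = proj₁ induction
      open Fibre z Sz τ Sτ proper a (proj₂ induction)
      lower-line = graded-on-line g′
      top-line = form-on-line f
      p = proj₁ lower-line
      q = proj₁ top-line
      integral : I (λ x → horner ((p ⊞ q) at z x) (τ x) + τ x ^ suc D * ⟦ f ⟧f w)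
      integral = I-resp (λ x → begin
        ⟦ e ⟧ₑ (y x)                 ≈⟨ ⟦⟧ₑ-cong e (on-line x) ⟩
        ⟦ e ⟧ₑ (point (z x) (τ x))   ≈⟨ e≈ _ ⟩
        ⟦ g′ ⟧g (point (z x) (τ x)) + ⟦ f ⟧f (point (z x) (τ x))
          ≈⟨ +-cong (proj₂ (proj₂ lower-line) (z x) (τ x)) (proj₂ (proj₂ top-line) (z x) (τ x)) ⟩
        horner (p at z x) (τ x) + (horner (q at z x) (τ x) + τ x ^ suc D * ⟦ f ⟧f w)
          ≈⟨ +-assoc _ _ _ ⟨
        (horner (p at z x) (τ x) + horner (q at z x) (τ x)) + τ x ^ suc D * ⟦ f ⟧f w
          ≈⟨ +-congʳ (horner-⊞ p q (z x) (τ x)) ⟨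
        horner ((p ⊞ q) at z x) (τ x) + τ x ^ suc D * ⟦ f ⟧f w ∎) Ie
      open Integral D (p ⊞ q) (length-⊞ p q (proj₁ (proj₂ lower-line)) (proj₁ (proj₂ top-line))) (⟦ f ⟧f w) fw≉0 integral
      t₀ = proj₁ common-root
      root : ∀ {q} → J q → q t₀ ≈ 0#
      root = proj₂ common-root

-- Chordal distance and normalised coordinates

module ProjectiveSpace
  (em : ∀ {a} → ExcludedMiddle a) {ℝ : RealNumbers} (ln : NaturalLog ℝ)
  {c ℓ} (K : NonarchimedeanField ℝ c ℓ) (N : ℕ) where

  private
    module ℝ where
      open RealNumbers ℝ public
      open RealFacts em ℝ public
    module ≤-Reasoning = PartialOrderReasoning ℝ.≤-poset

  open NonarchimedeanField K hiding (zero)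
  open NonarchimedeanFacts em K
  open PolynomialExpressions baseField
  open Dynamics ln K N
  open IntegerCoefficientSolver commutativeRing

  ∣xᵢ∣≤‖x‖ : ∀ x i → ∣ x i ∣ ℝ.≤ ‖ x ‖
  ∣xᵢ∣≤‖x‖ x i = ℝ.≤-maximum (λ i → ∣ x i ∣) i

  ‖‖-nonNeg : ∀ x → ℝ.0# ℝ.≤ ‖ x ‖
  ‖‖-nonNeg x = ℝ.maximum-nonNeg (λ i → ∣ x i ∣)

  ‖‖-≤ : ∀ x {b} → ℝ.0# ℝ.≤ b → (∀ i → ∣ x i ∣ ℝ.≤ b) → ‖ x ‖ ℝ.≤ b
  ‖‖-≤ x = ℝ.maximum-≤ (λ i → ∣ x i ∣)

  ‖‖-scale : ∀ {x y} t → (∀ i → x i ≈ t * y i) → ‖ x ‖ ℝ.≈ ∣ t ∣ ℝ.* ‖ y ‖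
  ‖‖-scale {x} {y} t x≈ty with em {P = t ≈ 0#}
  ... | yes t≈0 = ℝ.≤-antisym
    (‖‖-≤ x (ℝ.*-nonNeg (∣∣-nonNeg t) (‖‖-nonNeg y)) (λ i → ℝ.≤-trans
      (ℝ.≤-reflexive (ℝ.trans (∣∣-cong (trans (x≈ty i) (trans (*-congʳ t≈0) (zeroˡ _)))) ∣0∣≈0))
      (ℝ.*-nonNeg (∣∣-nonNeg t) (‖‖-nonNeg y))))
    (ℝ.≤-respˡ-≈ (ℝ.sym (ℝ.trans (ℝ.*-congʳ (ℝ.trans (∣∣-cong t≈0) ∣0∣≈0)) (ℝ.zeroˡ _))) (‖‖-nonNeg x))
  ... | no t≉0 = ℝ.≤-antisym
    (‖‖-≤ x (ℝ.*-nonNeg (∣∣-nonNeg t) (‖‖-nonNeg y)) (λ i → begin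
      ∣ x i ∣             ≈⟨ ℝ.trans (∣∣-cong (x≈ty i)) (∣∣-* t (y i)) ⟩
      ∣ t ∣ ℝ.* ∣ y i ∣   ≤⟨ ℝ.*-monoˡ-≤ (∣∣-nonNeg t) (∣xᵢ∣≤‖x‖ y i) ⟩
      ∣ t ∣ ℝ.* ‖ y ‖     ∎))
    (begin
      ∣ t ∣ ℝ.* ‖ y ‖                          ≤⟨ ℝ.*-monoˡ-≤ (∣∣-nonNeg t) ‖y‖≤ ⟩
      ∣ t ∣ ℝ.* (∣ t ⁻¹ ∣ ℝ.* ‖ x ‖)           ≈⟨ ℝ.*-assoc _ _ _ ⟨
      ∣ t ∣ ℝ.* ∣ t ⁻¹ ∣ ℝ.* ‖ x ‖             ≈⟨ ℝ.trans (ℝ.*-congʳ (∣∣-⁻¹ t≉0)) (ℝ.*-identityˡ _) ⟩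
      ‖ x ‖                                    ∎)
    where
    open ≤-Reasoning
    ‖y‖≤ : ‖ y ‖ ℝ.≤ ∣ t ⁻¹ ∣ ℝ.* ‖ x ‖
    ‖y‖≤ = ‖‖-≤ y (ℝ.*-nonNeg (∣∣-nonNeg _) (‖‖-nonNeg x)) λ i → begin
      ∣ y i ∣                ≈⟨ ∣∣-cong (trans (*-congˡ (x≈ty i)) (x⁻¹*[x*y]≈y t≉0 (y i))) ⟨
      ∣ t ⁻¹ * x i ∣         ≈⟨ ∣∣-* _ _ ⟩
      ∣ t ⁻¹ ∣ ℝ.* ∣ x i ∣   ≤⟨ ℝ.*-monoˡ-≤ (∣∣-nonNeg _) (∣xᵢ∣≤‖x‖ x i) ⟩
      ∣ t ⁻¹ ∣ ℝ.* ‖ x ‖     ∎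

  ‖‖-pos : ∀ {x} → ¬ IsZero x → ℝ.0# ℝ.< ‖ x ‖
  ‖‖-pos {x} x≉0 = ℝ.≰⇒> λ ‖x‖≤0 → x≉0 λ i →
    ∣x∣≈0⇒x≈0 (ℝ.≤-antisym (ℝ.≤-trans (∣xᵢ∣≤‖x‖ x i) ‖x‖≤0) (∣∣-nonNeg _))

  ‖‖-attained : ∀ {x} → ¬ IsZero x → ∃[ i ] ‖ x ‖ ℝ.≈ ∣ x i ∣
  ‖‖-attained x≉0 = ℝ.maximum-attained _ (‖‖-pos x≉0)

  ≈ₚ-refl : ∀ P → P ≈ₚ P
  ≈ₚ-refl P = 1# , (λ 1≈0 → 0≉1 (sym 1≈0)) , λ i → sym (*-identityˡ _)

  ≈ₚ-sym : ∀ {P Q} → P ≈ₚ Q → Q ≈ₚ P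
  ≈ₚ-sym (t , t≉0 , P≈tQ) = t ⁻¹ , ⁻¹-nonzero t≉0 , λ i →
    sym (trans (*-congˡ (P≈tQ i)) (x⁻¹*[x*y]≈y t≉0 _))

  ≈ₚ-trans : ∀ {P Q R} → P ≈ₚ Q → Q ≈ₚ R → P ≈ₚ R
  ≈ₚ-trans (t , t≉0 , P≈tQ) (s , s≉0 , Q≈sR) = t * s , *-nonzero t≉0 s≉0 , λ i →
    trans (P≈tQ i) (trans (*-congˡ (Q≈sR i)) (sym (*-assoc t s _)))

  minor : Affine → Affine → Fin (suc N) → Fin (suc N) → Carrier
  minor x y i j = x i * y j - x j * y i

  norms : Point → Point → ℝ.Carrier
  norms P Q = ‖ coords P ‖ ℝ.* ‖ coords Q ‖

  norms-pos : ∀ P Q → ℝ.0# ℝ.< norms P Q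
  norms-pos P Q = ℝ.*-pos (‖‖-pos (nonzero P)) (‖‖-pos (nonzero Q))

  Δ-nonNeg : ∀ P Q → ℝ.0# ℝ.≤ Δ P Q
  Δ-nonNeg P Q = ℝ.*-nonNeg (ℝ.maximum-nonNeg (λ i → ℝ.maximum (λ j → ∣ minor (coords P) (coords Q) i j ∣))) (ℝ.<⇒≤ (ℝ.⁻¹-pos (norms-pos P Q)))

  minor≤maximum : ∀ x y i j →
    ∣ minor x y i j ∣ ℝ.≤ ℝ.maximum (λ i → ℝ.maximum (λ j → ∣ minor x y i j ∣))
  minor≤maximum x y i j = ℝ.≤-trans (ℝ.≤-maximum (λ j → ∣ minor x y i j ∣) j)
    (ℝ.≤-maximum (λ i → ℝ.maximum (λ j → ∣ minor x y i j ∣)) i)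

  Δ≤⇒minor≤ : ∀ P Q {r} → Δ P Q ℝ.≤ r → ∀ i j → ∣ minor (coords P) (coords Q) i j ∣ ℝ.≤ r ℝ.* norms P Q
  Δ≤⇒minor≤ P Q Δ≤r i j = ℝ.≤-trans (minor≤maximum _ _ i j) (ℝ.x/y≤z⇒x≤zy (norms-pos P Q) Δ≤r)

  minor≤⇒Δ≤ : ∀ P Q {r} → ℝ.0# ℝ.≤ r → (∀ i j → ∣ minor (coords P) (coords Q) i j ∣ ℝ.≤ r ℝ.* norms P Q) → Δ P Q ℝ.≤ r
  minor≤⇒Δ≤ P Q 0≤r p = ℝ.x≤zy⇒x/y≤z (norms-pos P Q) (ℝ.maximum-≤ _ 0≤rn λ i → ℝ.maximum-≤ _ 0≤rn (p i))
    where
    0≤rn = ℝ.*-nonNeg 0≤r (ℝ.<⇒≤ (norms-pos P Q))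

  Δ<⇒minor< : ∀ P Q {r} → Δ P Q ℝ.< r → ∀ i j → ∣ minor (coords P) (coords Q) i j ∣ ℝ.< r ℝ.* norms P Q
  Δ<⇒minor< P Q Δ<r i j = ℝ.≤-<-trans (minor≤maximum _ _ i j) (ℝ.x/y<z⇒x<zy (norms-pos P Q) Δ<r)

  Δ-self : ∀ P → Δ P P ℝ.≤ ℝ.0#
  Δ-self P = minor≤⇒Δ≤ P P ℝ.≤-refl λ i j → ℝ.≤-reflexive (ℝ.trans
    (ℝ.trans (∣∣-cong (solve 2 (λ a b → a :* b :- b :* a := con (+ 0)) refl _ _)) ∣0∣≈0) (ℝ.sym (ℝ.zeroˡ _)))

  -- With ∣ y k ∣ = ‖ y ‖, expand y k (x i z j - x j z i) by the Plücker relation.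
  Δ-ultra : ∀ P Q R {r} → Δ P Q ℝ.≤ r → Δ Q R ℝ.≤ r → Δ P R ℝ.≤ r
  Δ-ultra P Q R {r} ΔPQ≤r ΔQR≤r = minor≤⇒Δ≤ P R (ℝ.≤-trans (Δ-nonNeg P Q) ΔPQ≤r) λ i j →
    ℝ.*-cancelˡ-≤ (‖‖-pos (nonzero Q)) (begin
      ‖ y ‖ ℝ.* ∣ minor x z i j ∣   ≈⟨ ℝ.trans (ℝ.*-congʳ ‖y‖≈) (ℝ.sym (∣∣-* _ _)) ⟩
      ∣ y k * minor x z i j ∣       ≈⟨ ∣∣-cong (solve 8 (λ yk xi xj xk yi yj zi zj →
        yk :* (xi :* zj :- xj :* zi) :=
        ((zj :* (xi :* yk :- xk :* yi)) :- (zi :* (xj :* yk :- xk :* yj))) :+ xk :* (yi :* zj :- yj :* zi)) refl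
        (y k) (x i) (x j) (x k) (y i) (y j) (z i) (z j)) ⟩
      ∣ z j * minor x y i k - z i * minor x y j k + x k * minor y z i j ∣
                                    ≤⟨ ultra-≤ (ultra-minus-≤ (left i j) (left j i)) (right i j) ⟩
      ‖ y ‖ ℝ.* (r ℝ.* (‖ x ‖ ℝ.* ‖ z ‖))  ∎)
    where
    open ≤-Reasoning
    x = coords P
    y = coords Q
    z = coords R
    attained = ‖‖-attained (nonzero Q)
    k = proj₁ attained
    ‖y‖≈ = proj₂ attained
    left : ∀ i j → ∣ z j * minor x y i k ∣ ℝ.≤ ‖ y ‖ ℝ.* (r ℝ.* (‖ x ‖ ℝ.* ‖ z ‖))
    left i j = begin
      ∣ z j * minor x y i k ∣             ≈⟨ ∣∣-* _ _ ⟩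
      ∣ z j ∣ ℝ.* ∣ minor x y i k ∣       ≤⟨ ℝ.*-mono-≤ (‖‖-nonNeg z) (∣∣-nonNeg _) (∣xᵢ∣≤‖x‖ z j) (Δ≤⇒minor≤ P Q ΔPQ≤r i k) ⟩
      ‖ z ‖ ℝ.* (r ℝ.* (‖ x ‖ ℝ.* ‖ y ‖)) ≈⟨ ℝ.rearrange₁ _ _ _ _ ⟩
      ‖ y ‖ ℝ.* (r ℝ.* (‖ x ‖ ℝ.* ‖ z ‖)) ∎
    right : ∀ i j → ∣ x k * minor y z i j ∣ ℝ.≤ ‖ y ‖ ℝ.* (r ℝ.* (‖ x ‖ ℝ.* ‖ z ‖))
    right i j = begin
      ∣ x k * minor y z i j ∣             ≈⟨ ∣∣-* _ _ ⟩
      ∣ x k ∣ ℝ.* ∣ minor y z i j ∣       ≤⟨ ℝ.*-mono-≤ (‖‖-nonNeg x) (∣∣-nonNeg _) (∣xᵢ∣≤‖x‖ x k) (Δ≤⇒minor≤ Q R ΔQR≤r i j) ⟩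
      ‖ x ‖ ℝ.* (r ℝ.* (‖ y ‖ ℝ.* ‖ z ‖)) ≈⟨ ℝ.rearrange₂ _ _ _ _ ⟩
      ‖ y ‖ ℝ.* (r ℝ.* (‖ x ‖ ℝ.* ‖ z ‖)) ∎

  Δ-ultra-< : ∀ P Q R {r} → Δ P Q ℝ.< r → Δ Q R ℝ.< r → Δ P R ℝ.< r
  Δ-ultra-< P Q R p q = ℝ.≤-<-trans
    (Δ-ultra P Q R (ℝ.x≤x⊔y _ _) (ℝ.x≤y⊔x _ _)) (ℝ.max-<-lub p q)

  ball-open : ∀ P {r} → ℝ.0# ℝ.< r → Open (λ Q → Δ P Q ℝ.< r)
  ball-open P {r} 0<r Q ΔPQ<r = r , 0<r , λ R ΔQR<r → Δ-ultra-< P Q R ΔPQ<r ΔQR<r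

  Δ-cong-≤ : ∀ {P P′ Q Q′} → P ≈ₚ P′ → Q ≈ₚ Q′ → Δ P′ Q′ ℝ.≤ Δ P Q
  Δ-cong-≤ {P} {P′} {Q} {Q′} (t , t≉0 , P≈tP′) (s , s≉0 , Q≈sQ′) =
    minor≤⇒Δ≤ P′ Q′ (Δ-nonNeg P Q) λ i j → ℝ.*-cancelˡ-≤ (∣∣-pos (*-nonzero t≉0 s≉0)) (begin
      ∣ t * s ∣ ℝ.* ∣ minor x′ y′ i j ∣    ≈⟨ ∣∣-* _ _ ⟨
      ∣ t * s * minor x′ y′ i j ∣          ≈⟨ ∣∣-cong (solve 6 (λ t s a b c d →
          t :* s :* (a :* b :- c :* d) := (t :* a) :* (s :* b) :- (t :* c) :* (s :* d)) refl t s (x′ i) (y′ j) (x′ j) (y′ i)) ⟩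
      ∣ (t * x′ i) * (s * y′ j) - (t * x′ j) * (s * y′ i) ∣
        ≈⟨ ∣∣-cong (+-cong (*-cong (P≈tP′ i) (Q≈sQ′ j)) (-‿cong (*-cong (P≈tP′ j) (Q≈sQ′ i)))) ⟨
      ∣ minor (coords P) (coords Q) i j ∣  ≤⟨ Δ≤⇒minor≤ P Q ℝ.≤-refl i j ⟩
      Δ P Q ℝ.* (‖ coords P ‖ ℝ.* ‖ coords Q ‖)
        ≈⟨ ℝ.*-congˡ (ℝ.*-cong (‖‖-scale t P≈tP′) (‖‖-scale s Q≈sQ′)) ⟩
      Δ P Q ℝ.* ((∣ t ∣ ℝ.* ‖ x′ ‖) ℝ.* (∣ s ∣ ℝ.* ‖ y′ ‖))
        ≈⟨ ℝ.rearrange₃ _ _ _ _ _ ⟩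
      ∣ t ∣ ℝ.* ∣ s ∣ ℝ.* (Δ P Q ℝ.* (‖ x′ ‖ ℝ.* ‖ y′ ‖))
        ≈⟨ ℝ.*-congʳ (∣∣-* t s) ⟨
      ∣ t * s ∣ ℝ.* (Δ P Q ℝ.* norms P′ Q′) ∎)
    where
    open ≤-Reasoning
    x′ = coords P′
    y′ = coords Q′

  -- Fixing the index i selects an affine chart. Two vectors normalised at the same index have
  -- chordal distance equal to the maximum norm of their difference.
  record Normalised (i : Fin (suc N)) (x : Affine) : Set (c Level.⊔ ℓ) where
    field
      at-i : x i ≈ 1#
      unit : ∀ j → ∣ x j ∣ ℝ.≤ ℝ.1#

  open Normalised public

  normalised-norm : ∀ {i x} → Normalised i x → ‖ x ‖ ℝ.≈ ℝ.1#
  normalised-norm {i} {x} n = ℝ.≤-antisym (‖‖-≤ x ℝ.0≤1 (unit n))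
    (ℝ.≤-trans (ℝ.≤-reflexive (ℝ.sym (ℝ.trans (∣∣-cong (at-i n)) ∣1∣≈1))) (∣xᵢ∣≤‖x‖ x i))

  normalised-nonzero : ∀ {i x} → Normalised i x → ¬ IsZero x
  normalised-nonzero {i} n x≈0 = 0≉1 (trans (sym (x≈0 i)) (at-i n))

  record Normalisation (i : Fin (suc N)) (x : Affine) : Set (c Level.⊔ ℓ) where
    field
      x̂          : Affine
      normalised : Normalised i x̂
      xᵢ≉0       : x i ≉ 0#
      x≈xᵢx̂      : ∀ j → x j ≈ x i * x̂ j

  normalise : ∀ {i x} → ¬ IsZero x → ‖ x ‖ ℝ.≈ ∣ x i ∣ → Normalisation i x
  normalise {i} {x} x≉0 ‖x‖≈∣xᵢ∣ = record
    { x̂ = λ j → x i ⁻¹ * x j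
    ; normalised = record
      { at-i = trans (*-comm _ _) (*-inverseʳ xᵢ≉0)
      ; unit = λ j → ℝ.*-cancelˡ-≤ (∣∣-pos xᵢ≉0) (begin
          ∣ x i ∣ ℝ.* ∣ x i ⁻¹ * x j ∣   ≈⟨ ℝ.trans (∣∣-cong (x≈ j)) (∣∣-* _ _) ⟨
          ∣ x j ∣                         ≤⟨ ∣xᵢ∣≤‖x‖ x j ⟩
          ‖ x ‖                           ≈⟨ ℝ.trans ‖x‖≈∣xᵢ∣ (ℝ.sym (ℝ.*-identityʳ _)) ⟩
          ∣ x i ∣ ℝ.* ℝ.1#                ∎)
      }
    ; xᵢ≉0 = xᵢ≉0
    ; x≈xᵢx̂ = x≈
    }
    where
    open ≤-Reasoning
    xᵢ≉0 : x i ≉ 0#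
    xᵢ≉0 = ∣∣-pos⁻¹ (ℝ.<-respʳ-≈ ‖x‖≈∣xᵢ∣ (‖‖-pos x≉0))
    x≈ : ∀ j → x j ≈ x i * (x i ⁻¹ * x j)
    x≈ j = sym (trans (solve 3 (λ a b c → a :* (b :* c) := b :* (a :* c)) refl _ _ _) (x⁻¹*[x*y]≈y xᵢ≉0 (x j)))

  -- Choose j with ∣ y j ∣ = ‖ y ‖. Then ∣ x i y j ∣ = ‖ x ‖ ‖ y ‖ exceeds the minor, so x j y i
  -- must be at least as large, which forces ∣ y i ∣ = ‖ y ‖.
  near⇒norm-attained : ∀ P Q {i} → Δ P Q ℝ.< ℝ.1# → ‖ coords P ‖ ℝ.≈ ∣ coords P i ∣ → ‖ coords Q ‖ ℝ.≈ ∣ coords Q i ∣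
  near⇒norm-attained P Q {i} Δ<1 ‖x‖≈ with ‖‖-attained (nonzero Q)
  ... | j , ‖y‖≈ = ℝ.≤-antisym (ℝ.*-cancelˡ-≤ (‖‖-pos (nonzero P)) (begin
      ‖ x ‖ ℝ.* ‖ y ‖       ≈⟨ xᵢyⱼ≈ ⟨
      ∣ x i * y j ∣         ≤⟨ ℝ.≮⇒≥ (λ xⱼyᵢ<xᵢyⱼ → ℝ.<⇒≱ (ultra-< minor<xᵢyⱼ xⱼyᵢ<xᵢyⱼ)
                                (ℝ.≤-reflexive (∣∣-cong (solve 2 (λ a b → a := (a :- b) :+ b) refl _ _)))) ⟩
      ∣ x j * y i ∣         ≈⟨ ∣∣-* _ _ ⟩
      ∣ x j ∣ ℝ.* ∣ y i ∣   ≤⟨ ℝ.*-monoʳ-≤ (∣∣-nonNeg _) (∣xᵢ∣≤‖x‖ x j) ⟩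
      ‖ x ‖ ℝ.* ∣ y i ∣     ∎)) (∣xᵢ∣≤‖x‖ y i)
    where
    open ≤-Reasoning
    x = coords P
    y = coords Q
    xᵢyⱼ≈ : ∣ x i * y j ∣ ℝ.≈ ‖ x ‖ ℝ.* ‖ y ‖
    xᵢyⱼ≈ = ℝ.trans (∣∣-* _ _) (ℝ.*-cong (ℝ.sym ‖x‖≈) (ℝ.sym ‖y‖≈))
    minor<xᵢyⱼ : ∣ minor x y i j ∣ ℝ.< ∣ x i * y j ∣
    minor<xᵢyⱼ = begin-strict
      ∣ minor x y i j ∣             <⟨ Δ<⇒minor< P Q Δ<1 i j ⟩
      ℝ.1# ℝ.* (‖ x ‖ ℝ.* ‖ y ‖)    ≈⟨ ℝ.trans (ℝ.*-identityˡ _) (ℝ.sym xᵢyⱼ≈) ⟩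
      ∣ x i * y j ∣                 ∎

  normalisation-≈ₚ : ∀ {i} P (n : Normalisation i (coords P)) →
    P ≈ₚ π (Normalisation.x̂ n) (normalised-nonzero (Normalisation.normalised n))
  normalisation-≈ₚ {i} P n = coords P i , xᵢ≉0 , x≈xᵢx̂
    where open Normalisation n

  norms-normalised : ∀ {i x y} (n : Normalised i x) (m : Normalised i y) r →
    r ℝ.* (‖ x ‖ ℝ.* ‖ y ‖) ℝ.≈ r
  norms-normalised n m r = ℝ.trans (ℝ.*-congˡ (ℝ.trans
    (ℝ.*-cong (normalised-norm n) (normalised-norm m)) (ℝ.*-identityˡ _))) (ℝ.*-identityʳ r)

  -- With x i = y i = 1, the minor at (i, j) is y j - x j.
  Δ≤⇒difference≤ : ∀ {i x y} (n : Normalised i x) (m : Normalised i y) {r} →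
    Δ (π x (normalised-nonzero n)) (π y (normalised-nonzero m)) ℝ.≤ r → ∀ j → ∣ y j - x j ∣ ℝ.≤ r
  Δ≤⇒difference≤ {i} {x} {y} n m {r} Δ≤r j = begin
    ∣ y j - x j ∣               ≈⟨ ∣∣-cong (trans
      (+-cong (*-congʳ (at-i n)) (-‿cong (*-congˡ (at-i m))))
      (solve 2 (λ a b → con (+ 1) :* b :- a :* con (+ 1) := b :- a) refl (x j) (y j))) ⟨
    ∣ minor x y i j ∣           ≤⟨ Δ≤⇒minor≤ (π x (normalised-nonzero n)) (π y (normalised-nonzero m)) Δ≤r i j ⟩
    r ℝ.* (‖ x ‖ ℝ.* ‖ y ‖)     ≈⟨ norms-normalised n m r ⟩
    r                           ∎
    where open ≤-Reasoning

  difference≤⇒Δ≤ : ∀ {i x y} (n : Normalised i x) (m : Normalised i y) {r} → ℝ.0# ℝ.≤ r →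
    (∀ j → ∣ y j - x j ∣ ℝ.≤ r) → Δ (π x (normalised-nonzero n)) (π y (normalised-nonzero m)) ℝ.≤ r
  difference≤⇒Δ≤ {i} {x} {y} n m {r} 0≤r p = minor≤⇒Δ≤ (π x (normalised-nonzero n)) (π y (normalised-nonzero m)) 0≤r λ j k → begin
    ∣ minor x y j k ∣                          ≈⟨ ∣∣-cong (solve 4 (λ xj xk yj yk →
        xj :* yk :- xk :* yj := xj :* (yk :- xk) :- xk :* (yj :- xj)) refl (x j) (x k) (y j) (y k)) ⟩
    ∣ x j * (y k - x k) - x k * (y j - x j) ∣  ≤⟨ ultra-minus-≤
        (ℝ.≤-trans (∣t∣≤1⇒∣tx∣≤∣x∣ _ (unit n j)) (p k)) (ℝ.≤-trans (∣t∣≤1⇒∣tx∣≤∣x∣ _ (unit n k)) (p j)) ⟩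
    r                                          ≈⟨ norms-normalised n m r ⟨
    r ℝ.* (‖ x ‖ ℝ.* ‖ y ‖)                    ∎
    where open ≤-Reasoning

  UnitBall : ∀ {n} → Vector Carrier n → Set
  UnitBall x = ∀ i → ∣ x i ∣ ℝ.≤ ℝ.1#

  expr-bounded : ∀ {n} (e : Expr n) → ∃[ B ] ℝ.0# ℝ.≤ B × (∀ x → UnitBall x → ∣ ⟦ e ⟧ₑ x ∣ ℝ.≤ B)
  expr-bounded (const a) = ∣ a ∣ , ∣∣-nonNeg a , λ _ _ → ℝ.≤-refl
  expr-bounded (var i)  = ℝ.1# , ℝ.0≤1 , λ x unit → unit i
  expr-bounded (e ⊕ f) with expr-bounded e | expr-bounded f
  ... | B , 0≤B , e≤B | C , 0≤C , f≤C = ℝ.max B C , ℝ.≤-trans 0≤B (ℝ.x≤x⊔y B C) , λ x u →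
    ultra-≤ (ℝ.≤-trans (e≤B x u) (ℝ.x≤x⊔y B C)) (ℝ.≤-trans (f≤C x u) (ℝ.x≤y⊔x B C))
  expr-bounded (e ⊗ f) with expr-bounded e | expr-bounded f
  ... | B , 0≤B , e≤B | C , 0≤C , f≤C = B ℝ.* C , ℝ.*-nonNeg 0≤B 0≤C , λ x u →
    ℝ.≤-respˡ-≈ (ℝ.sym (∣∣-* _ _)) (ℝ.*-mono-≤ 0≤B (∣∣-nonNeg _) (e≤B x u) (f≤C x u))

  expr-lipschitz : ∀ {n} (e : Expr n) → ∃[ L ] ℝ.0# ℝ.≤ L ×
    (∀ x y δ → ℝ.0# ℝ.≤ δ → UnitBall x → UnitBall y → (∀ i → ∣ x i - y i ∣ ℝ.≤ δ) →
     ∣ ⟦ e ⟧ₑ x - ⟦ e ⟧ₑ y ∣ ℝ.≤ L ℝ.* δ)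
  expr-lipschitz (const a) = ℝ.0# , ℝ.≤-refl , λ x y δ _ _ _ _ → ℝ.≤-reflexive
    (ℝ.trans (ℝ.trans (∣∣-cong (-‿inverseʳ a)) ∣0∣≈0) (ℝ.sym (ℝ.zeroˡ δ)))
  expr-lipschitz (var i) = ℝ.1# , ℝ.0≤1 , λ x y δ _ _ _ close →
    ℝ.≤-respʳ-≈ (ℝ.sym (ℝ.*-identityˡ δ)) (close i)
  expr-lipschitz (e ⊕ f) with expr-lipschitz e | expr-lipschitz f
  ... | L , 0≤L , e-lip | M , 0≤M , f-lip = ℝ.max L M , ℝ.≤-trans 0≤L (ℝ.x≤x⊔y L M) , λ x y δ 0≤δ ux uy close →
    ℝ.≤-respˡ-≈ (∣∣-cong (solve 4 (λ a b c d → (a :- b) :+ (c :- d) := (a :+ c) :- (b :+ d)) refl _ _ _ _))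
      (ultra-≤ (ℝ.≤-trans (e-lip x y δ 0≤δ ux uy close) (ℝ.*-monoʳ-≤ 0≤δ (ℝ.x≤x⊔y L M)))
               (ℝ.≤-trans (f-lip x y δ 0≤δ ux uy close) (ℝ.*-monoʳ-≤ 0≤δ (ℝ.x≤y⊔x L M))))
  expr-lipschitz (e ⊗ f) with expr-bounded e | expr-bounded f | expr-lipschitz e | expr-lipschitz f
  ... | B , 0≤B , e≤B | C , 0≤C , f≤C | L , 0≤L , e-lip | M , 0≤M , f-lip =
    ℝ.max (B ℝ.* M) (C ℝ.* L) , ℝ.≤-trans (ℝ.*-nonNeg 0≤B 0≤M) (ℝ.x≤x⊔y _ _) , λ x y δ 0≤δ ux uy close →
    ℝ.≤-respˡ-≈ (∣∣-cong (solve 4 (λ a b c d → a :* (c :- d) :+ d :* (a :- b) := a :* c :- b :* d) refl _ _ _ _))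
      (ultra-≤
        (product-≤ 0≤B 0≤δ (e≤B x ux) (f-lip x y δ 0≤δ ux uy close) (ℝ.x≤x⊔y _ _))
        (product-≤ 0≤C 0≤δ (f≤C y uy) (e-lip x y δ 0≤δ ux uy close) (ℝ.x≤y⊔x _ _)))
    where
    open ≤-Reasoning
    product-≤ : ∀ {a b B M δ S} → ℝ.0# ℝ.≤ B → ℝ.0# ℝ.≤ δ → ∣ a ∣ ℝ.≤ B → ∣ b ∣ ℝ.≤ M ℝ.* δ → B ℝ.* M ℝ.≤ S →
                ∣ a * b ∣ ℝ.≤ S ℝ.* δ
    product-≤ {a} {b} {B} {M} {δ} {S} 0≤B 0≤δ a≤B b≤Mδ BM≤S = begin
      ∣ a * b ∣           ≈⟨ ∣∣-* a b ⟩
      ∣ a ∣ ℝ.* ∣ b ∣     ≤⟨ ℝ.*-mono-≤ 0≤B (∣∣-nonNeg b) a≤B b≤Mδ ⟩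
      B ℝ.* (M ℝ.* δ)     ≈⟨ ℝ.*-assoc B M δ ⟨
      B ℝ.* M ℝ.* δ       ≤⟨ ℝ.*-monoʳ-≤ 0≤δ BM≤S ⟩
      S ℝ.* δ             ∎

  private
    power : ∀ {n} → Expr n → ℕ → Expr n
    power e zero    = const 1#
    power e (suc m) = e ⊗ power e m

    ⟦power⟧ : ∀ {n} (e : Expr n) m x → ⟦ power e m ⟧ₑ x ≈ ⟦ e ⟧ₑ x ^ m
    ⟦power⟧ e zero    x = refl
    ⟦power⟧ e (suc m) x = *-congˡ (⟦power⟧ e m x)

    productₑ : ∀ {m n} → Vector (Expr n) m → Expr n
    productₑ = Vector.foldr _⊗_ (const 1#)

    ⟦productₑ⟧ : ∀ {m n} (v : Vector (Expr n) m) {w} x → (∀ i → ⟦ v i ⟧ₑ x ≈ w i) → ⟦ productₑ v ⟧ₑ x ≈ product w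
    ⟦productₑ⟧ {zero}  v x eq = refl
    ⟦productₑ⟧ {suc m} v x eq = *-cong (eq zero) (⟦productₑ⟧ (Vector.tail v) x (λ i → eq (suc i)))

  toExpr : ∀ {n} → Polynomial baseField n → Expr n
  toExpr []            = const 0#
  toExpr ((a , e) ∷ p) = const a ⊗ productₑ (λ i → power (var i) (e i)) ⊕ toExpr p

  ⟦toExpr⟧ : ∀ {n} (p : Polynomial baseField n) x → ⟦ toExpr p ⟧ₑ x ≈ eval baseField p x
  ⟦toExpr⟧ [] x = refl
  ⟦toExpr⟧ ((a , e) ∷ p) x = +-cong
    (*-congˡ (⟦productₑ⟧ (λ i → power (var i) (e i)) x (λ i → ⟦power⟧ (var i) (e i) x))) (⟦toExpr⟧ p x)

  product-homogeneous : ∀ {m} t (x : Vector Carrier m) e →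
    product (λ i → (t * x i) ^ e i) ≈ t ^ Vector.foldr ℕ._+_ 0 e * product (λ i → x i ^ e i)
  product-homogeneous {zero}  t x e = sym (*-identityˡ 1#)
  product-homogeneous {suc m} t x e = trans
    (*-cong (^-distrib-* t (x zero) (e zero)) (product-homogeneous t (Vector.tail x) (Vector.tail e)))
    (trans (solve 4 (λ a b c d → (a :* b) :* (c :* d) := (a :* c) :* (b :* d)) refl _ _ _ _)
      (*-congʳ (sym (^-homo-* t (e zero) _))))

  eval-homogeneous : ∀ {n d} (p : Polynomial baseField n) → Homogeneous baseField d p → ∀ t x →
    eval baseField p (λ i → t * x i) ≈ t ^ d * eval baseField p x
  eval-homogeneous [] [] t x = sym (zeroʳ _)
  eval-homogeneous ((a , e) ∷ p) (≡.refl ∷ hom) t x = trans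
    (+-cong (*-congˡ (product-homogeneous t x e)) (eval-homogeneous p hom t x))
    (solve 4 (λ a t m r → a :* (t :* m) :+ t :* r := t :* (a :* m :+ r)) refl _ _ _ _)

  -- Bounds and local constancy for a lift

  module LiftBounds
    (closed : AlgebraicallyClosed baseField)
    {d} {φ : Point → Point} {Φ : PolynomialMap} (lift : IsLift d φ Φ) where

    open IsLift lift
    open Nullstellensatz em baseField closed (horner-determines-coefficients closed)

    Φₑ : Fin (suc N) → Expr (suc N)
    Φₑ i = toExpr (Φ i)

    ⟦Φₑ⟧ : ∀ i x → ⟦ Φₑ i ⟧ₑ x ≈ ⟦ Φ ⟧ x i
    ⟦Φₑ⟧ i = ⟦toExpr⟧ (Φ i)

    Φ-cong : ∀ {x y} → (∀ i → x i ≈ y i) → ∀ i → ⟦ Φ ⟧ x i ≈ ⟦ Φ ⟧ y i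
    Φ-cong {x} {y} x≈y i = trans (sym (⟦Φₑ⟧ i x)) (trans (⟦⟧ₑ-cong (Φₑ i) x≈y) (⟦Φₑ⟧ i y))

    Φ-scale : ∀ t {x y} → (∀ i → x i ≈ t * y i) → ∀ i → ⟦ Φ ⟧ x i ≈ t ^ d * ⟦ Φ ⟧ y i
    Φ-scale t {x} {y} x≈ty i = trans (Φ-cong x≈ty i) (eval-homogeneous (Φ i) (homogeneous i) t y)

    ‖Φ‖-scale : ∀ t {x y} → (∀ i → x i ≈ t * y i) → ‖ ⟦ Φ ⟧ x ‖ ℝ.≈ ∣ t ∣ ℝ.^ d ℝ.* ‖ ⟦ Φ ⟧ y ‖
    ‖Φ‖-scale t x≈ty = ℝ.trans (‖‖-scale (t ^ d) (Φ-scale t x≈ty)) (ℝ.*-congʳ (∣∣-^ t d))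

    φ-cong : ∀ {P Q} → P ≈ₚ Q → φ P ≈ₚ φ Q
    φ-cong {P} {Q} (t , t≉0 , P≈tQ) = ≈ₚ-trans {φ P} {π _ (noCommonZero _ (nonzero P))} {φ Q} (commutes (coords P) (nonzero P))
      (≈ₚ-trans {π _ (noCommonZero _ (nonzero P))} {π _ (noCommonZero _ (nonzero Q))} {φ Q}
        (t ^ d , ^-nonzero d t≉0 , Φ-scale t P≈tQ)
        (≈ₚ-sym {φ Q} {π _ (noCommonZero _ (nonzero Q))} (commutes (coords Q) (nonzero Q))))

    -- The coordinates are bounded on the chart, so they lie in S; the components of Φ lie in I; and
    -- 1 lies in I exactly when the desired lower bound holds on the chart.
    DominatedBy‖Φ‖ : ∀ i → FunctionIdeal (∃ (Normalised i)) (c Level.⊔ ℓ) (c Level.⊔ ℓ)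
    DominatedBy‖Φ‖ i = record
      { S = λ f → ∃[ B ] ℝ.0# ℝ.≤ B × (∀ x → ∣ f x ∣ ℝ.≤ B)
      ; I = λ f → ∃[ C ] ℝ.0# ℝ.≤ C × (∀ x → ∣ f x ∣ ℝ.≤ C ℝ.* ‖ ⟦ Φ ⟧ (proj₁ x) ‖)
      ; S-const = λ k → ∣ k ∣ , ∣∣-nonNeg k , λ _ → ℝ.≤-refl
      ; S-+ = λ (B , 0≤B , f≤B) (C , 0≤C , g≤C) → ℝ.max B C , ℝ.≤-trans 0≤B (ℝ.x≤x⊔y B C) , λ x →
          ultra-≤ (ℝ.≤-trans (f≤B x) (ℝ.x≤x⊔y B C)) (ℝ.≤-trans (g≤C x) (ℝ.x≤y⊔x B C))
      ; S-* = λ (B , 0≤B , f≤B) (C , 0≤C , g≤C) → B ℝ.* C , ℝ.*-nonNeg 0≤B 0≤C , λ x →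
          ℝ.≤-respˡ-≈ (ℝ.sym (∣∣-* _ _)) (ℝ.*-mono-≤ 0≤B (∣∣-nonNeg _) (f≤B x) (g≤C x))
      ; I-resp = λ f≈g (C , 0≤C , f≤) → C , 0≤C , λ x → ℝ.≤-respˡ-≈ (∣∣-cong (f≈g x)) (f≤ x)
      ; I-zero = ℝ.0# , ℝ.≤-refl , λ x → ℝ.≤-reflexive (ℝ.trans ∣0∣≈0 (ℝ.sym (ℝ.zeroˡ _)))
      ; I-+ = λ (B , 0≤B , f≤) (C , 0≤C , g≤) → ℝ.max B C , ℝ.≤-trans 0≤B (ℝ.x≤x⊔y B C) , λ x →
          ultra-≤ (ℝ.≤-trans (f≤ x) (ℝ.*-monoʳ-≤ (‖‖-nonNeg (⟦ Φ ⟧ (proj₁ x))) (ℝ.x≤x⊔y B C)))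
                  (ℝ.≤-trans (g≤ x) (ℝ.*-monoʳ-≤ (‖‖-nonNeg (⟦ Φ ⟧ (proj₁ x))) (ℝ.x≤y⊔x B C)))
      ; I-* = λ (B , 0≤B , f≤B) (C , 0≤C , g≤) → B ℝ.* C , ℝ.*-nonNeg 0≤B 0≤C , λ x →
          ℝ.≤-respˡ-≈ (ℝ.sym (∣∣-* _ _)) (ℝ.≤-respʳ-≈ (ℝ.sym (ℝ.*-assoc _ _ _))
            (ℝ.*-mono-≤ 0≤B (∣∣-nonNeg _) (f≤B x) (g≤ x)))
      }

    -- A common zero of the ideal would be a nontrivial common zero of Φ.
    lower-bound-at : ∀ i → ∃[ C ] ℝ.0# ℝ.≤ C × (∀ x → Normalised i x → ℝ.1# ℝ.≤ C ℝ.* ‖ ⟦ Φ ⟧ x ‖)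
    lower-bound-at i with em {P = FunctionIdeal.I (DominatedBy‖Φ‖ i) (λ _ → 1#)}
    ... | yes (C , 0≤C , 1≤) = C , 0≤C , λ x n → ℝ.≤-respˡ-≈ ∣1∣≈1 (1≤ (x , n))
    ... | no proper with nullstellensatz (DominatedBy‖Φ‖ i) proj₁
                           (λ j → ℝ.1# , ℝ.0≤1 , λ (x , n) → unit n j) proper
    ...   | a , common-zero = contradiction Φa≈0 (noCommonZero a a≉0)
      where
      -- The relation x i - 1 is zero on the chart and hence in I; it keeps the common zero away
      -- from the origin.
      aᵢ≈1 : a i ≈ 1#
      aᵢ≈1 = trans (solve 1 (λ a → a := (a :+ con (+ 1) :* :- con (+ 1)) :+ con (+ 1)) refl (a i))
        (trans (+-congʳ (common-zero (var i ⊕ const 1# ⊗ const (- 1#))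
          (ℝ.0# , ℝ.≤-refl , λ (x , n) → ℝ.≤-reflexive (ℝ.trans
            (ℝ.trans (∣∣-cong (trans (+-congʳ (at-i n))
              (solve 0 (con (+ 1) :+ con (+ 1) :* :- con (+ 1) := con (+ 0)) refl))) ∣0∣≈0)
            (ℝ.sym (ℝ.zeroˡ _)))))) (+-identityˡ 1#))
      a≉0 : ¬ IsZero a
      a≉0 a≈0 = 0≉1 (trans (sym (a≈0 i)) aᵢ≈1)
      Φa≈0 : IsZero (⟦ Φ ⟧ a)
      Φa≈0 k = trans (sym (⟦Φₑ⟧ k a)) (common-zero (Φₑ k) (ℝ.1# , ℝ.0≤1 , λ (x , n) →
        ℝ.≤-respʳ-≈ (ℝ.sym (ℝ.*-identityˡ _))
          (ℝ.≤-respˡ-≈ (∣∣-cong (sym (⟦Φₑ⟧ k x))) (∣xᵢ∣≤‖x‖ (⟦ Φ ⟧ x) k))))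

    -- Taking the maximum with 1, here and in `B₀`, keeps the constant positive, so that its
    -- logarithm can be used.
    C₀ : ℝ.Carrier
    C₀ = ℝ.max ℝ.1# (ℝ.maximum (λ i → proj₁ (lower-bound-at i)))

    0<C₀ : ℝ.0# ℝ.< C₀
    0<C₀ = ℝ.<-≤-trans ℝ.0<1 (ℝ.x≤x⊔y _ _)

    lower-bound : ∀ {i x} → Normalised i x → ℝ.1# ℝ.≤ C₀ ℝ.* ‖ ⟦ Φ ⟧ x ‖
    lower-bound {i} {x} n = ℝ.≤-trans (proj₂ (proj₂ (lower-bound-at i)) x n)
      (ℝ.*-monoʳ-≤ (‖‖-nonNeg (⟦ Φ ⟧ x)) (ℝ.≤-trans (ℝ.≤-maximum (λ i → proj₁ (lower-bound-at i)) i) (ℝ.x≤y⊔x ℝ.1# _)))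

    B₀ : ℝ.Carrier
    B₀ = ℝ.max ℝ.1# (ℝ.maximum (λ i → proj₁ (expr-bounded (Φₑ i))))

    0<B₀ : ℝ.0# ℝ.< B₀
    0<B₀ = ℝ.<-≤-trans ℝ.0<1 (ℝ.x≤x⊔y _ _)

    upper-bound : ∀ {i x} → Normalised i x → ‖ ⟦ Φ ⟧ x ‖ ℝ.≤ B₀
    upper-bound {i} {x} n = ‖‖-≤ _ (ℝ.<⇒≤ 0<B₀) λ k → ℝ.≤-respˡ-≈ (∣∣-cong (⟦Φₑ⟧ k x))
      (ℝ.≤-trans (proj₂ (proj₂ (expr-bounded (Φₑ k))) x (unit n))
        (ℝ.≤-trans (ℝ.≤-maximum (λ i → proj₁ (expr-bounded (Φₑ i))) k) (ℝ.x≤y⊔x _ _)))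

    L₀ : ℝ.Carrier
    L₀ = ℝ.maximum (λ i → proj₁ (expr-lipschitz (Φₑ i)))

    lipschitz : ∀ {x y δ} → ℝ.0# ℝ.≤ δ → UnitBall x → UnitBall y → (∀ i → ∣ x i - y i ∣ ℝ.≤ δ) →
                ∀ k → ∣ ⟦ Φ ⟧ x k - ⟦ Φ ⟧ y k ∣ ℝ.≤ L₀ ℝ.* δ
    lipschitz {x} {y} {δ} 0≤δ ux uy close k = ℝ.≤-respˡ-≈ (∣∣-cong (+-cong (⟦Φₑ⟧ k x) (-‿cong (⟦Φₑ⟧ k y))))
      (ℝ.≤-trans (proj₂ (proj₂ (expr-lipschitz (Φₑ k))) x y δ 0≤δ ux uy close)
        (ℝ.*-monoʳ-≤ 0≤δ (ℝ.≤-maximum (λ i → proj₁ (expr-lipschitz (Φₑ i))) k)))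

    ‖Φ‖-normalisation : ∀ {i x} (n : Normalisation i x) → ‖ x ‖ ℝ.≈ ∣ x i ∣ →
      ‖ ⟦ Φ ⟧ x ‖ ℝ.≈ ‖ x ‖ ℝ.^ d ℝ.* ‖ ⟦ Φ ⟧ (Normalisation.x̂ n) ‖
    ‖Φ‖-normalisation {i} {x} n ‖x‖≈ = ℝ.trans (‖Φ‖-scale (x i) x≈xᵢx̂) (ℝ.*-congʳ (ℝ.^-congˡ d (ℝ.sym ‖x‖≈)))
      where open Normalisation n

    ‖x‖^d≤C₀‖Φx‖ : ∀ {x} → ¬ IsZero x → ‖ x ‖ ℝ.^ d ℝ.≤ C₀ ℝ.* ‖ ⟦ Φ ⟧ x ‖
    ‖x‖^d≤C₀‖Φx‖ {x} x≉0 with ‖‖-attained x≉0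
    ... | i , ‖x‖≈ = begin
      ‖ x ‖ ℝ.^ d                                  ≈⟨ ℝ.*-identityʳ _ ⟨
      ‖ x ‖ ℝ.^ d ℝ.* ℝ.1#                         ≤⟨ ℝ.*-monoˡ-≤ (ℝ.<⇒≤ (ℝ.^-pos d (‖‖-pos x≉0))) (lower-bound normalised) ⟩
      ‖ x ‖ ℝ.^ d ℝ.* (C₀ ℝ.* ‖ ⟦ Φ ⟧ x̂ ‖)         ≈⟨ ℝ.x*[y*z]≈y*[x*z] _ _ _ ⟩
      C₀ ℝ.* (‖ x ‖ ℝ.^ d ℝ.* ‖ ⟦ Φ ⟧ x̂ ‖)         ≈⟨ ℝ.*-congˡ (‖Φ‖-normalisation n ‖x‖≈) ⟨
      C₀ ℝ.* ‖ ⟦ Φ ⟧ x ‖                           ∎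
      where
      open ≤-Reasoning
      n = normalise x≉0 ‖x‖≈
      open Normalisation n

    ‖Φx‖≤B₀‖x‖^d : ∀ {x} → ¬ IsZero x → ‖ ⟦ Φ ⟧ x ‖ ℝ.≤ B₀ ℝ.* ‖ x ‖ ℝ.^ d
    ‖Φx‖≤B₀‖x‖^d {x} x≉0 with ‖‖-attained x≉0
    ... | i , ‖x‖≈ = begin
      ‖ ⟦ Φ ⟧ x ‖                                  ≈⟨ ‖Φ‖-normalisation n ‖x‖≈ ⟩
      ‖ x ‖ ℝ.^ d ℝ.* ‖ ⟦ Φ ⟧ x̂ ‖                  ≤⟨ ℝ.*-monoˡ-≤ (ℝ.<⇒≤ (ℝ.^-pos d (‖‖-pos x≉0))) (upper-bound normalised) ⟩
      ‖ x ‖ ℝ.^ d ℝ.* B₀                           ≈⟨ ℝ.*-comm _ _ ⟩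
      B₀ ℝ.* ‖ x ‖ ℝ.^ d                           ∎
      where
      open ≤-Reasoning
      n = normalise x≉0 ‖x‖≈
      open Normalisation n

    -- Within distance δ₀ the change of Φ, at most L₀ δ₀, is below its lower
    -- bound 1 / C₀.
    δ₀ : ℝ.Carrier
    δ₀ = (ℝ.1# ℝ.+ L₀ ℝ.* C₀) ℝ.⁻¹

    private
      0≤L₀C₀ : ℝ.0# ℝ.≤ L₀ ℝ.* C₀
      0≤L₀C₀ = ℝ.*-nonNeg (ℝ.maximum-nonNeg (λ i → proj₁ (expr-lipschitz (Φₑ i)))) (ℝ.<⇒≤ 0<C₀)

      1≤1+L₀C₀ : ℝ.1# ℝ.≤ ℝ.1# ℝ.+ L₀ ℝ.* C₀
      1≤1+L₀C₀ = ℝ.≤-respˡ-≈ (ℝ.+-identityʳ _) (ℝ.+-mono-≤ ℝ.≤-refl 0≤L₀C₀)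

      0<1+L₀C₀ : ℝ.0# ℝ.< ℝ.1# ℝ.+ L₀ ℝ.* C₀
      0<1+L₀C₀ = ℝ.<-≤-trans ℝ.0<1 1≤1+L₀C₀

    0<δ₀ : ℝ.0# ℝ.< δ₀
    0<δ₀ = ℝ.⁻¹-pos 0<1+L₀C₀

    -- Ensures that points closer than δ₀ can be normalised at the same index.
    δ₀≤1 : δ₀ ℝ.≤ ℝ.1#
    δ₀≤1 = ℝ.*-cancelˡ-≤ 0<1+L₀C₀ (ℝ.≤-trans (ℝ.≤-reflexive (ℝ.⁻¹-inverseʳ 0<1+L₀C₀))
      (ℝ.≤-respʳ-≈ (ℝ.sym (ℝ.*-identityʳ _)) 1≤1+L₀C₀))

    C₀L₀δ₀≤1 : C₀ ℝ.* (L₀ ℝ.* δ₀) ℝ.≤ ℝ.1#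
    C₀L₀δ₀≤1 = begin
      C₀ ℝ.* (L₀ ℝ.* δ₀)                      ≈⟨ ℝ.x*[y*z]≈y*x*z _ _ _ ⟩
      L₀ ℝ.* C₀ ℝ.* δ₀                        ≤⟨ ℝ.*-monoʳ-≤ (ℝ.<⇒≤ 0<δ₀)
                                                  (ℝ.≤-respˡ-≈ (ℝ.+-identityˡ _) (ℝ.+-mono-≤ ℝ.0≤1 ℝ.≤-refl)) ⟩
      (ℝ.1# ℝ.+ L₀ ℝ.* C₀) ℝ.* δ₀             ≈⟨ ℝ.⁻¹-inverseʳ 0<1+L₀C₀ ⟩
      ℝ.1#                                    ∎
      where open ≤-Reasoning

    -- Each component changes by at most L₀ δ₀ ≤ 1 / C₀ ≤ ‖ Φ(x) ‖, which the ultrametric inequality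
    -- absorbs. Exchanging x and y gives equality.
    ‖Φ‖-near : ∀ {i x y} → Normalised i x → Normalised i y → (∀ j → ∣ y j - x j ∣ ℝ.≤ δ₀) →
               ‖ ⟦ Φ ⟧ y ‖ ℝ.≤ ‖ ⟦ Φ ⟧ x ‖
    ‖Φ‖-near {i} {x} {y} n m close = ‖‖-≤ (⟦ Φ ⟧ y) (‖‖-nonNeg (⟦ Φ ⟧ x)) λ k → ℝ.≤-respˡ-≈
      (∣∣-cong (solve 2 (λ a b → (b :- a) :+ a := b) refl (⟦ Φ ⟧ x k) (⟦ Φ ⟧ y k)))
      (ultra-≤ (ℝ.≤-trans (lipschitz (ℝ.<⇒≤ 0<δ₀) (unit m) (unit n) close k)
                 (ℝ.*-cancelˡ-≤ 0<C₀ (ℝ.≤-trans C₀L₀δ₀≤1 (lower-bound n))))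
               (∣xᵢ∣≤‖x‖ (⟦ Φ ⟧ x) k))

    -- The invariant is ‖ Φ(x) ‖ / ‖ x ‖ ^ d, a function on projective space; the equation is
    -- cross-multiplied to avoid inverses under the logarithm.
    ‖Φ‖-locally-constant : ∀ P Q → Δ P Q ℝ.< δ₀ →
      ‖ ⟦ Φ ⟧ (coords P) ‖ ℝ.* ‖ coords Q ‖ ℝ.^ d ℝ.≈ ‖ ⟦ Φ ⟧ (coords Q) ‖ ℝ.* ‖ coords P ‖ ℝ.^ d
    ‖Φ‖-locally-constant P Q ΔPQ<δ₀ with ‖‖-attained (nonzero P)
    ... | i , ‖x‖≈ = begin-equality
      ‖ ⟦ Φ ⟧ x ‖ ℝ.* ‖ y ‖ ℝ.^ d                         ≈⟨ ℝ.*-congʳ (‖Φ‖-normalisation n ‖x‖≈) ⟩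
      ‖ x ‖ ℝ.^ d ℝ.* ‖ ⟦ Φ ⟧ x̂ ‖ ℝ.* ‖ y ‖ ℝ.^ d         ≈⟨ ℝ.*-congʳ (ℝ.*-congˡ Φx̂≈Φŷ) ⟩
      ‖ x ‖ ℝ.^ d ℝ.* ‖ ⟦ Φ ⟧ ŷ ‖ ℝ.* ‖ y ‖ ℝ.^ d         ≈⟨ ℝ.x*y*z≈z*y*x _ _ _ ⟩
      ‖ y ‖ ℝ.^ d ℝ.* ‖ ⟦ Φ ⟧ ŷ ‖ ℝ.* ‖ x ‖ ℝ.^ d         ≈⟨ ℝ.*-congʳ (‖Φ‖-normalisation m ‖y‖≈) ⟨
      ‖ ⟦ Φ ⟧ y ‖ ℝ.* ‖ x ‖ ℝ.^ d                         ∎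
      where
      open ≤-Reasoning
      x = coords P
      y = coords Q
      ‖y‖≈ = near⇒norm-attained P Q (ℝ.<-≤-trans ΔPQ<δ₀ δ₀≤1) ‖x‖≈
      n = normalise (nonzero P) ‖x‖≈
      m = normalise (nonzero Q) ‖y‖≈
      open Normalisation n using (x̂) renaming (normalised to x̂-normalised)
      open Normalisation m renaming (x̂ to ŷ; normalised to ŷ-normalised)
      close : ∀ j → ∣ ŷ j - x̂ j ∣ ℝ.≤ δ₀
      close = Δ≤⇒difference≤ x̂-normalised ŷ-normalised (ℝ.≤-trans
        (Δ-cong-≤ {P} {π x̂ (normalised-nonzero x̂-normalised)} {Q} {π ŷ (normalised-nonzero ŷ-normalised)} (normalisation-≈ₚ P n) (normalisation-≈ₚ Q m)) (ℝ.<⇒≤ ΔPQ<δ₀))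
      Φx̂≈Φŷ : ‖ ⟦ Φ ⟧ x̂ ‖ ℝ.≈ ‖ ⟦ Φ ⟧ ŷ ‖
      Φx̂≈Φŷ = ℝ.≤-antisym
        (‖Φ‖-near ŷ-normalised x̂-normalised (λ j → ℝ.≤-respˡ-≈ (∣∣-sym (ŷ j) (x̂ j)) (close j)))
        (‖Φ‖-near x̂-normalised ŷ-normalised close)

-- Sequences u with u (n + 1) = d u n + O(1), rescaled to u n / dⁿ

module GeometricSequences
  (em : ∀ {a} → ExcludedMiddle a) (ℝ : RealNumbers) (d : ℕ) (2≤d : 2 ℕ.≤ d) where

  open RealNumbers ℝ hiding (zero)
  open RealFacts em ℝ
  open IntegerCoefficientSolver commutativeRing
  private module ≤-Reasoning = PartialOrderReasoning ≤-poset
  open MonoidMultiples +-monoid using () renaming (×-homo-+ to ·-homo-+)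
  open SemiringMultiples semiring using () renaming (×1-homo-* to ·1-homo-*)

  D : Carrier
  D = d · 1#

  -- The power is formed in ℕ to match the denominators in `IsGreenFunction` literally.
  q : ℕ → Carrier
  q n = (d ℕ.^ n) · 1#

  q-suc : ∀ n → q (suc n) ≈ D * q n
  q-suc n = ·1-homo-* d (d ℕ.^ n)

  q-+ : ∀ m n → q (m ℕ.+ n) ≈ q m * q n
  q-+ m n = trans (reflexive (≡.cong (_· 1#) (ℕ.^-distribˡ-+-* d m n))) (·1-homo-* (d ℕ.^ m) (d ℕ.^ n))

  q-zero : q 0 ≈ 1#
  q-zero = +-identityʳ 1#

  private
    ·1-nonNeg : ∀ n → 0# ≤ n · 1#
    ·1-nonNeg zero    = ≤-refl
    ·1-nonNeg (suc n) = ≤-respˡ-≈ (+-identityˡ 0#) (+-mono-≤ 0≤1 (·1-nonNeg n))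

  2≤D : 2# ≤ D
  2≤D with ℕ.m≤n⇒∃[o]m+o≡n 2≤d
  ... | o , eq = begin
    2#                    ≈⟨ +-identityʳ 2# ⟨
    2# + 0#               ≤⟨ +-mono-≤ ≤-refl (·1-nonNeg o) ⟩
    2# + o · 1#           ≈⟨ +-assoc 1# 1# _ ⟩
    (2 ℕ.+ o) · 1#        ≡⟨ ≡.cong (_· 1#) eq ⟩
    D                     ∎
    where open ≤-Reasoning

  0<D : 0# < D
  0<D = <-≤-trans 0<2 2≤D

  q-pos : ∀ n → 0# < q n
  q-pos zero    = <-respʳ-≈ (sym q-zero) 0<1
  q-pos (suc n) = <-respʳ-≈ (sym (q-suc n)) (*-pos 0<D (q-pos n))

  -- Adding B absorbs the error: D u + 2 B ≤ D (u + B) because D ≥ 2, so u + B grows at most by the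
  -- factor D in each step.
  geometric-bound : ∀ {u : ℕ → Carrier} {B} → 0# ≤ B → (∀ n → u (suc n) ≤ D * u n + B) →
                    ∀ m n → u (m ℕ.+ n) + B ≤ q m * (u n + B)
  geometric-bound {u} {B} 0≤B u≤ zero    n = ≤-reflexive (sym (trans (*-congʳ q-zero) (*-identityˡ _)))
  geometric-bound {u} {B} 0≤B u≤ (suc m) n = begin
    u (suc (m ℕ.+ n)) + B        ≤⟨ +-monoˡ-≤ B (u≤ (m ℕ.+ n)) ⟩
    (D * uₘ + B) + B             ≈⟨ solve 3 (λ D u B → (D :* u :+ B) :+ B := D :* u :+ (con (+ 1) :+ con (+ 1)) :* B) refl D uₘ B ⟩
    D * uₘ + 2# * B              ≤⟨ +-mono-≤ ≤-refl (*-monoʳ-≤ 0≤B 2≤D) ⟩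
    D * uₘ + D * B               ≈⟨ distribˡ D uₘ B ⟨
    D * (uₘ + B)                 ≤⟨ *-monoˡ-≤ (<⇒≤ 0<D) (geometric-bound 0≤B u≤ m n) ⟩
    D * (q m * (u n + B))        ≈⟨ *-assoc D (q m) _ ⟨
    D * q m * (u n + B)          ≈⟨ *-congʳ (q-suc m) ⟨
    q (suc m) * (u n + B)        ∎
    where
    open ≤-Reasoning
    uₘ = u (m ℕ.+ n)

  rescaled : (ℕ → Carrier) → ℕ → Carrier
  rescaled u n = q n ⁻¹ * u n

  q*q⁻¹*x≈x : ∀ n x → q n * (q n ⁻¹ * x) ≈ x
  q*q⁻¹*x≈x n x = trans (sym (*-assoc _ _ _)) (trans (*-congʳ (⁻¹-inverseʳ (q-pos n))) (*-identityˡ x))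

  private
    q-split : ∀ m n x → q (m ℕ.+ n) * (q n ⁻¹ * x) ≈ q m * x
    q-split m n x = trans (*-congʳ (q-+ m n)) (trans (*-assoc _ _ _) (*-congˡ (q*q⁻¹*x≈x n x)))

    from : ∀ n (P : ℕ → Set) → (∀ m → P (m ℕ.+ n)) → ∀ k → n ℕ.≤ k → P k
    from n P p k n≤k = ≡.subst P (ℕ.m∸n+n≡m n≤k) (p (k ℕ.∸ n))

  -- Divided by q (m + n), the geometric bound caps the rescaled tail by (u n + B) / q n uniformly
  -- in m, and hence the limit.
  limit-upper : ∀ {u l B} → ConvergesTo (rescaled u) l → 0# ≤ B →
                (∀ n → u (suc n) ≤ D * u n + B) → ∀ n → q n * l ≤ u n + B
  limit-upper {u} {l} {B} u→l 0≤B u≤ n = begin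
    q n * l                        ≤⟨ *-monoˡ-≤ (<⇒≤ (q-pos n)) (limit-≤-from n u→l (from n _ bound)) ⟩
    q n * (q n ⁻¹ * (u n + B))     ≈⟨ q*q⁻¹*x≈x n _ ⟩
    u n + B                        ∎
    where
    open ≤-Reasoning
    bound : ∀ m → rescaled u (m ℕ.+ n) ≤ q n ⁻¹ * (u n + B)
    bound m = *-cancelˡ-≤ (q-pos (m ℕ.+ n)) (begin
      q (m ℕ.+ n) * rescaled u (m ℕ.+ n)          ≈⟨ q*q⁻¹*x≈x (m ℕ.+ n) _ ⟩
      u (m ℕ.+ n)                                 ≈⟨ +-identityʳ _ ⟨
      u (m ℕ.+ n) + 0#                            ≤⟨ +-mono-≤ ≤-refl 0≤B ⟩
      u (m ℕ.+ n) + B                             ≤⟨ geometric-bound 0≤B u≤ m n ⟩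
      q m * (u n + B)                             ≈⟨ q-split m n _ ⟨
      q (m ℕ.+ n) * (q n ⁻¹ * (u n + B))          ∎)

  -- The geometric bound is applied to -u, which satisfies the same kind of recursion.
  limit-lower : ∀ {u l B} → ConvergesTo (rescaled u) l → 0# ≤ B →
                (∀ n → D * u n ≤ u (suc n) + B) → ∀ n → u n ≤ q n * l + B
  limit-lower {u} {l} {B} u→l 0≤B ≤u n = begin
    u n                            ≈⟨ solve 2 (λ u B → u := (u :- B) :+ B) refl (u n) B ⟩
    (u n - B) + B                  ≈⟨ +-congʳ (q*q⁻¹*x≈x n _) ⟨
    q n * (q n ⁻¹ * (u n - B)) + B ≤⟨ +-monoˡ-≤ B (*-monoˡ-≤ (<⇒≤ (q-pos n)) (limit-≥-from n u→l (from n _ bound))) ⟩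
    q n * l + B                    ∎
    where
    open ≤-Reasoning
    -u≤ : ∀ n → - u (suc n) ≤ D * - u n + B
    -u≤ n = begin
      - u (suc n)                ≈⟨ solve 2 (λ u B → :- u := :- (u :+ B) :+ B) refl (u (suc n)) B ⟩
      - (u (suc n) + B) + B      ≤⟨ +-monoˡ-≤ B (neg-mono-≤ (≤u n)) ⟩
      - (D * u n) + B            ≈⟨ solve 3 (λ D u B → :- (D :* u) :+ B := D :* :- u :+ B) refl D (u n) B ⟩
      D * - u n + B              ∎
    bound : ∀ m → q n ⁻¹ * (u n - B) ≤ rescaled u (m ℕ.+ n)
    bound m = *-cancelˡ-≤ (q-pos (m ℕ.+ n)) (begin
      q (m ℕ.+ n) * (q n ⁻¹ * (u n - B))          ≈⟨ q-split m n _ ⟩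
      q m * (u n - B)                             ≈⟨ solve 3 (λ q u B → q :* (u :- B) := :- (q :* (:- u :+ B))) refl (q m) (u n) B ⟩
      - (q m * (- u n + B))                       ≤⟨ neg-mono-≤ (geometric-bound { λ k → - u k} 0≤B -u≤ m n) ⟩
      - (- u (m ℕ.+ n) + B)                       ≈⟨ solve 2 (λ u B → :- (:- u :+ B) := u :+ :- B) refl (u (m ℕ.+ n)) B ⟩
      u (m ℕ.+ n) - B                             ≤⟨ +-mono-≤ ≤-refl (≤-respʳ-≈ (solve 0 (:- con (+ 0) := con (+ 0)) refl) (neg-mono-≤ 0≤B)) ⟩
      u (m ℕ.+ n) + 0#                            ≈⟨ +-identityʳ _ ⟩
      u (m ℕ.+ n)                                 ≈⟨ q*q⁻¹*x≈x (m ℕ.+ n) _ ⟨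
      q (m ℕ.+ n) * rescaled u (m ℕ.+ n)          ∎)

  -- The hypothesis says that u and v have the same increments u (n + 1) - D u n. Hence u n - v n =
  -- dⁿ (u 0 - v 0), and rescaling makes the difference constant.
  limit-difference : ∀ {u v l m} → ConvergesTo (rescaled u) l → ConvergesTo (rescaled v) m →
                     (∀ n → u (suc n) + D * v n ≈ v (suc n) + D * u n) → l - u 0 ≈ m - v 0
  limit-difference {u} {v} {l} {m} u→l v→m eq = ≤-antisym
    (shift≤ (u 0) (v 0) (limit-shift v→m u→l (λ n → ≤-reflexive (rescaled-difference n))))
    (shift≤ (v 0) (u 0) (limit-shift u→l v→m (λ n → ≤-reflexive (trans
      (solve 3 (λ x u v → x := (x :+ (u :- v)) :+ (v :- u)) refl (rescaled v n) (u 0) (v 0))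
      (+-congʳ (sym (rescaled-difference n)))))))
    where
    open ≤-Reasoning
    shift≤ : ∀ {l m} a b → l ≤ m + (a - b) → l - a ≤ m - b
    shift≤ {l} {m} a b p = ≤-respʳ-≈
      (solve 3 (λ m a b → (m :+ (a :- b)) :- a := m :- b) refl m a b) (+-monoˡ-≤ (- a) p)
    difference : ∀ n → u n ≈ v n + q n * (u 0 - v 0)
    difference zero = trans (solve 2 (λ u v → u := v :+ con (+ 1) :* (u :- v)) refl (u 0) (v 0))
      (+-congˡ (*-congʳ (sym q-zero)))
    difference (suc n) = begin-equality
      u (suc n)                                  ≈⟨ solve 2 (λ u w → u := (u :+ w) :- w) refl _ _ ⟩
      (u (suc n) + D * v n) - D * v n            ≈⟨ +-congʳ (eq n) ⟩
      (v (suc n) + D * u n) - D * v n            ≈⟨ +-congʳ (+-congˡ (*-congˡ (difference n))) ⟩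
      (v (suc n) + D * (v n + q n * (u 0 - v 0))) - D * v n
        ≈⟨ solve 5 (λ v′ D v q c → (v′ :+ D :* (v :+ q :* c)) :- D :* v := v′ :+ (D :* q) :* c) refl
             (v (suc n)) D (v n) (q n) (u 0 - v 0) ⟩
      v (suc n) + D * q n * (u 0 - v 0)          ≈⟨ +-congˡ (*-congʳ (q-suc n)) ⟨
      v (suc n) + q (suc n) * (u 0 - v 0)        ∎
    rescaled-difference : ∀ n → rescaled u n ≈ rescaled v n + (u 0 - v 0)
    rescaled-difference n = begin-equality
      q n ⁻¹ * u n                                     ≈⟨ *-congˡ (difference n) ⟩
      q n ⁻¹ * (v n + q n * (u 0 - v 0))               ≈⟨ solve 4 (λ w v q c → w :* (v :+ q :* c) := w :* v :+ q :* (w :* c)) refl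
                                                            (q n ⁻¹) (v n) (q n) (u 0 - v 0) ⟩
      q n ⁻¹ * v n + q n * (q n ⁻¹ * (u 0 - v 0))      ≈⟨ +-congˡ (q*q⁻¹*x≈x n _) ⟩
      q n ⁻¹ * v n + (u 0 - v 0)                       ∎

-- The Green function and the three implications

module Equivalence
  (em : ∀ {a} → ExcludedMiddle a) {ℝ : RealNumbers} (ln : NaturalLog ℝ)
  {c ℓ} (K : NonarchimedeanField ℝ c ℓ)
  (closed : AlgebraicallyClosed (NonarchimedeanField.baseField K)) (nontrivial : Nontrivial ℝ K)
  (N d : ℕ) (2≤d : 2 ℕ.≤ d)
  (φ : Dynamics.Morphism ln K N d) (Φ : Dynamics.PolynomialMap ln K N)
  (lift : Dynamics.IsLift ln K N d (Dynamics.Morphism.map φ) Φ)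
  (G : Dynamics.Affine ln K N → RealNumbers.Carrier ℝ) (green : Dynamics.IsGreenFunction ln K N d Φ G)
  where

  private
    module ℝ where
      open RealNumbers ℝ public
      open RealFacts em ℝ public
      open LogFacts em ln public
      open GeometricSequences em ℝ d 2≤d public
    module ≤-Reasoning = PartialOrderReasoning ℝ.≤-poset

  open NaturalLog ln
  open NonarchimedeanField K hiding (zero)
  open NonarchimedeanFacts em K
  open PolynomialExpressions baseField
  open Dynamics ln K N
  open ProjectiveSpace em ln K N
  open LiftBounds closed lift
  open IsLift lift
  open IntegerCoefficientSolver commutativeRing

  Φ^ : ℕ → Affine → Affine
  Φ^ = iterateLift Φ

  Φ^-nonzero : ∀ n {x} → ¬ IsZero x → ¬ IsZero (Φ^ n x)
  Φ^-nonzero zero    x≉0 = x≉0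
  Φ^-nonzero (suc n) x≉0 = noCommonZero _ (Φ^-nonzero n x≉0)

  Φ^-point : ∀ n (P : Point) → Point
  Φ^-point n P = π (Φ^ n (coords P)) (Φ^-nonzero n (nonzero P))

  iterate-lift : ∀ n P → iterate φ n P ≈ₚ Φ^-point n P
  iterate-lift zero    P = ≈ₚ-refl P
  iterate-lift (suc n) P = ≈ₚ-trans {iterate φ (suc n) P} {Morphism.map φ (Φ^-point n P)} {Φ^-point (suc n) P}
    (φ-cong {iterate φ n P} {Φ^-point n P} (iterate-lift n P))
    (commutes (Φ^ n (coords P)) (Φ^-nonzero n (nonzero P)))

  iterate-cong : ∀ n {P Q} → P ≈ₚ Q → iterate φ n P ≈ₚ iterate φ n Q
  iterate-cong zero    P≈Q = P≈Q
  iterate-cong (suc n) {P} {Q} P≈Q = φ-cong {iterate φ n P} {iterate φ n Q} (iterate-cong n {P} {Q} P≈Q)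

  -- Iterates as expressions, so that their components can be restricted to lines and become
  -- polynomials in one variable.
  Φ^ₑ : ℕ → Fin (suc N) → Expr (suc N)
  Φ^ₑ zero    k = var k
  Φ^ₑ (suc n) k = substitute (Φ^ₑ n) (Φₑ k)

  ⟦Φ^ₑ⟧ : ∀ n k x → ⟦ Φ^ₑ n k ⟧ₑ x ≈ Φ^ n x k
  ⟦Φ^ₑ⟧ zero    k x = refl
  ⟦Φ^ₑ⟧ (suc n) k x = trans (⟦substitute⟧ (Φ^ₑ n) (Φₑ k) x)
    (trans (⟦⟧ₑ-cong (Φₑ k) (λ j → ⟦Φ^ₑ⟧ n j x)) (⟦Φₑ⟧ k (Φ^ n x)))

  Φ^-cong : ∀ n {x y} → (∀ i → x i ≈ y i) → ∀ k → Φ^ n x k ≈ Φ^ n y k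
  Φ^-cong n {x} {y} x≈y k = trans (sym (⟦Φ^ₑ⟧ n k x)) (trans (⟦⟧ₑ-cong (Φ^ₑ n k) x≈y) (⟦Φ^ₑ⟧ n k y))

  -- Growth of orbits and the Green function

  height : Affine → ℕ → ℝ.Carrier
  height x n = log ‖ Φ^ n x ‖

  E : ℝ.Carrier
  E = ℝ.max ℝ.0# (ℝ.max (log B₀) (log C₀))

  0≤E : ℝ.0# ℝ.≤ E
  0≤E = ℝ.x≤x⊔y _ _

  height-upper : ∀ {x} → ¬ IsZero x → ∀ n → height x (suc n) ℝ.≤ ℝ.D ℝ.* height x n ℝ.+ E
  height-upper {x} x≉0 n = begin
    log ‖ ⟦ Φ ⟧ y ‖                    ≤⟨ ℝ.log-mono-≤ (‖‖-pos (Φ^-nonzero (suc n) x≉0)) (‖Φx‖≤B₀‖x‖^d y≉0) ⟩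
    log (B₀ ℝ.* ‖ y ‖ ℝ.^ d)           ≈⟨ log-* 0<B₀ (ℝ.^-pos d (‖‖-pos y≉0)) ⟩
    log B₀ ℝ.+ log (‖ y ‖ ℝ.^ d)       ≤⟨ ℝ.+-mono-≤ (ℝ.≤-trans (ℝ.x≤x⊔y _ _) (ℝ.x≤y⊔x ℝ.0# _)) (ℝ.≤-reflexive (ℝ.log-^ d (‖‖-pos y≉0))) ⟩
    E ℝ.+ ℝ.D ℝ.* log ‖ y ‖            ≈⟨ ℝ.+-comm _ _ ⟩
    ℝ.D ℝ.* log ‖ y ‖ ℝ.+ E            ∎
    where
    open ≤-Reasoning
    y = Φ^ n x
    y≉0 = Φ^-nonzero n x≉0

  height-lower : ∀ {x} → ¬ IsZero x → ∀ n → ℝ.D ℝ.* height x n ℝ.≤ height x (suc n) ℝ.+ E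
  height-lower {x} x≉0 n = begin
    ℝ.D ℝ.* log ‖ y ‖                  ≈⟨ ℝ.log-^ d (‖‖-pos y≉0) ⟨
    log (‖ y ‖ ℝ.^ d)                  ≤⟨ ℝ.log-mono-≤ (ℝ.^-pos d (‖‖-pos y≉0)) (‖x‖^d≤C₀‖Φx‖ y≉0) ⟩
    log (C₀ ℝ.* ‖ ⟦ Φ ⟧ y ‖)           ≈⟨ log-* 0<C₀ (‖‖-pos (Φ^-nonzero (suc n) x≉0)) ⟩
    log C₀ ℝ.+ log ‖ ⟦ Φ ⟧ y ‖         ≤⟨ ℝ.+-mono-≤ (ℝ.≤-trans (ℝ.x≤y⊔x (log B₀) _) (ℝ.x≤y⊔x ℝ.0# _)) ℝ.≤-refl ⟩
    E ℝ.+ log ‖ ⟦ Φ ⟧ y ‖              ≈⟨ ℝ.+-comm _ _ ⟩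
    log ‖ ⟦ Φ ⟧ y ‖ ℝ.+ E              ∎
    where
    open ≤-Reasoning
    y = Φ^ n x
    y≉0 = Φ^-nonzero n x≉0

  private
    -- C₁ plays the role of exp (2 E), with one E for each of the two points compared; log C₁ > 2 E
    -- suffices, so no exponential function is built.
    exponential = ℝ.log-unbounded (E ℝ.+ E)

  C₁ : ℝ.Carrier
  C₁ = proj₁ exponential

  0<C₁ : ℝ.0# ℝ.< C₁
  0<C₁ = proj₁ (proj₂ exponential)

  -- log ‖ Φⁿ x ‖ lies within E of dⁿ G x.
  equal-green⇒comparable : ∀ {x y} → ¬ IsZero x → ¬ IsZero y → G x ℝ.≈ G y →
                           ∀ n → ‖ Φ^ n x ‖ ℝ.≤ C₁ ℝ.* ‖ Φ^ n y ‖
  equal-green⇒comparable {x} {y} x≉0 y≉0 Gx≈Gy n = ℝ.log-cancel-≤ (ℝ.*-pos 0<C₁ 0<Φy) (begin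
    height x n                      ≤⟨ ℝ.limit-lower (green x x≉0) 0≤E (height-lower x≉0) n ⟩
    ℝ.q n ℝ.* G x ℝ.+ E             ≈⟨ ℝ.+-congʳ (ℝ.*-congˡ Gx≈Gy) ⟩
    ℝ.q n ℝ.* G y ℝ.+ E             ≤⟨ ℝ.+-monoˡ-≤ E (ℝ.limit-upper (green y y≉0) 0≤E (height-upper y≉0) n) ⟩
    (height y n ℝ.+ E) ℝ.+ E        ≈⟨ ℝ.trans (ℝ.+-assoc _ _ _) (ℝ.+-comm _ _) ⟩
    (E ℝ.+ E) ℝ.+ height y n        ≤⟨ ℝ.+-monoˡ-≤ _ (ℝ.<⇒≤ (proj₂ (proj₂ exponential))) ⟩
    log C₁ ℝ.+ height y n           ≈⟨ log-* 0<C₁ 0<Φy ⟨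
    log (C₁ ℝ.* ‖ Φ^ n y ‖)         ∎)
    where
    open ≤-Reasoning
    0<Φy = ‖‖-pos (Φ^-nonzero n y≉0)

  -- The logarithm of `‖Φ‖-locally-constant` along the orbits is the equality of increments in
  -- `limit-difference`, and the initial terms are log ‖ x ‖ and log ‖ y ‖.
  near-orbits⇒equal-modified-green : ∀ P Q → (∀ n → Δ (Φ^-point n P) (Φ^-point n Q) ℝ.< δ₀) →
                                     modifiedGreen G P ℝ.≈ modifiedGreen G Q
  near-orbits⇒equal-modified-green P Q near =
    ℝ.limit-difference (green (coords P) (nonzero P)) (green (coords Q) (nonzero Q)) λ n →
      let 0<Φx = ‖‖-pos (Φ^-nonzero (suc n) (nonzero P))
          0<Φy = ‖‖-pos (Φ^-nonzero (suc n) (nonzero Q))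
          0<x = ‖‖-pos (Φ^-nonzero n (nonzero P))
          0<y = ‖‖-pos (Φ^-nonzero n (nonzero Q))
      in ℝ.trans (log-product 0<Φx 0<y) (ℝ.trans
           (log-cong (ℝ.*-pos 0<Φx (ℝ.^-pos d 0<y)) (‖Φ‖-locally-constant (Φ^-point n P) (Φ^-point n Q) (near n)))
           (ℝ.sym (log-product 0<Φy 0<x)))
    where
    log-product : ∀ {a b} → ℝ.0# ℝ.< a → ℝ.0# ℝ.< b → log a ℝ.+ ℝ.D ℝ.* log b ℝ.≈ log (a ℝ.* b ℝ.^ d)
    log-product 0<a 0<b = ℝ.trans (ℝ.+-congˡ (ℝ.sym (ℝ.log-^ d 0<b))) (ℝ.sym (log-* 0<a (ℝ.^-pos d 0<b)))

  lesser : ∀ {a b} → ℝ.0# ℝ.< a → ℝ.0# ℝ.< b → ∃[ r ] ℝ.0# ℝ.< r × r ℝ.≤ a × r ℝ.≤ b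
  lesser {a} {b} 0<a 0<b with ℝ.≤-total a b
  ... | inj₁ a≤b = a , 0<a , ℝ.≤-refl , a≤b
  ... | inj₂ b≤a = b , 0<b , b≤a , ℝ.≤-refl

  fatou⇒constant : ∀ P → FatouSet φ P → ConstantNear (modifiedGreen G) P
  fatou⇒constant P (U , _ , P∈U , equicontinuous) =
    (λ Q → Δ P Q ℝ.< r) , ball-open P 0<r , ℝ.≤-<-trans (Δ-self P) 0<r ,
    λ Q R Q∈ R∈ → ℝ.trans (ℝ.sym (equal Q Q∈)) (equal R R∈)
    where
    at-P = equicontinuous P P∈U δ₀ 0<δ₀
    δ = proj₁ at-P
    close : ∀ n Q → Δ P Q ℝ.< δ → Δ (iterate φ (suc n) P) (iterate φ (suc n) Q) ℝ.< δ₀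
    close = proj₂ (proj₂ at-P)
    -- Equicontinuity speaks of the iterates from the first one on; r ≤ δ₀ takes care of n = 0.
    radius = lesser (proj₁ (proj₂ at-P)) 0<δ₀
    r = proj₁ radius
    0<r = proj₁ (proj₂ radius)
    r≤δ = proj₁ (proj₂ (proj₂ radius))
    r≤δ₀ = proj₂ (proj₂ (proj₂ radius))
    near : ∀ Q → Δ P Q ℝ.< r → ∀ n → Δ (iterate φ n P) (iterate φ n Q) ℝ.< δ₀
    near Q ΔPQ<r zero    = ℝ.<-≤-trans ΔPQ<r r≤δ₀
    near Q ΔPQ<r (suc n) = close n Q (ℝ.<-≤-trans ΔPQ<r r≤δ)
    equal : ∀ Q → Δ P Q ℝ.< r → modifiedGreen G P ℝ.≈ modifiedGreen G Q
    equal Q ΔPQ<r = near-orbits⇒equal-modified-green P Q λ n → ℝ.≤-<-trans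
      (Δ-cong-≤ {iterate φ n P} {Φ^-point n P} {iterate φ n Q} {Φ^-point n Q} (iterate-lift n P) (iterate-lift n Q))
      (near Q ΔPQ<r n)

  lipschitz⇒fatou : ∀ P → LocallyUniformlyLipschitzAt φ P → FatouSet φ P
  lipschitz⇒fatou P (r , C , 0<r , 0<C , lipschitz) =
    (λ Q → Δ P Q ℝ.< r) , ball-open P 0<r , ℝ.≤-<-trans (Δ-self P) 0<r , equicontinuous
    where
    equicontinuous : ∀ Q → Δ P Q ℝ.< r → EquicontinuousAt (λ n → iterate φ (suc n)) Q
    equicontinuous Q ΔPQ<r ε 0<ε = δ , proj₁ (proj₂ radius) , λ n R ΔQR<δ → begin-strict
      Δ (iterate φ (suc n) Q) (iterate φ (suc n) R)
        ≤⟨ lipschitz Q R (ℝ.<⇒≤ ΔPQ<r) (ℝ.<⇒≤ (Δ-ultra-< P Q R ΔPQ<r (ℝ.<-≤-trans ΔQR<δ δ≤r))) (suc n) ⟩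
      C ℝ.* Δ Q R               <⟨ ℝ.*-monoˡ-< 0<C (ℝ.<-≤-trans ΔQR<δ δ≤ε/C) ⟩
      C ℝ.* (ε ℝ.* C ℝ.⁻¹)      ≈⟨ ℝ.trans (ℝ.*-comm _ _) (ℝ.x*y⁻¹*y≈x ε 0<C) ⟩
      ε                         ∎
      where
      open ≤-Reasoning
      -- The bound r keeps R in the Lipschitz disk by the ultrametric inequality, and ε / C makes
      -- the Lipschitz estimate smaller than ε.
      radius = lesser 0<r (ℝ.*-pos 0<ε (ℝ.⁻¹-pos 0<C))
      δ = proj₁ radius
      δ≤r = proj₁ (proj₂ (proj₂ radius))
      δ≤ε/C = proj₂ (proj₂ (proj₂ radius))

  module ConstantOnBall
    (P : Point) {r : ℝ.Carrier} (0<r : ℝ.0# ℝ.< r)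
    (constant : ∀ Q R → Δ P Q ℝ.< r → Δ P R ℝ.< r → modifiedGreen G Q ℝ.≈ modifiedGreen G R)
    where

    private
      small = lesser 0<r ℝ.0<1
      scale-factor = ∣∣-arbitrarily-small nontrivial (proj₁ (proj₂ small))
      attained = ‖‖-attained (nonzero P)

    -- The radius must be the absolute value of a field element, since displacements get rescaled by
    -- κ. Below r it stays in the ball of constancy; below 1 it preserves the normalising index.
    κ : Carrier
    κ = proj₁ scale-factor

    κ≉0 : κ ≉ 0#
    κ≉0 = proj₁ (proj₂ scale-factor)

    ∣κ∣<r : ∣ κ ∣ ℝ.< r
    ∣κ∣<r = ℝ.<-≤-trans (proj₂ (proj₂ scale-factor)) (proj₁ (proj₂ (proj₂ small)))

    ∣κ∣<1 : ∣ κ ∣ ℝ.< ℝ.1#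
    ∣κ∣<1 = ℝ.<-≤-trans (proj₂ (proj₂ scale-factor)) (proj₂ (proj₂ (proj₂ small)))

    i : Fin (suc N)
    i = proj₁ attained

    P-normalisation : Normalisation i (coords P)
    P-normalisation = normalise (nonzero P) (proj₂ attained)

    open Normalisation P-normalisation using () renaming (x̂ to p; normalised to p-normalised)

    Near : Affine → Set
    Near y = ∀ j → ∣ y j - p j ∣ ℝ.≤ ∣ κ ∣

    near⇒in-ball : ∀ {y} (n : Normalised i y) → Near y → Δ P (π y (normalised-nonzero n)) ℝ.< r
    near⇒in-ball {y} n near = ℝ.≤-<-trans
      (ℝ.≤-trans
        (Δ-cong-≤ {π p (normalised-nonzero p-normalised)} {P} {π y (normalised-nonzero n)} {π y (normalised-nonzero n)}
          (≈ₚ-sym {P} {π p (normalised-nonzero p-normalised)} (normalisation-≈ₚ P P-normalisation))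
          (≈ₚ-refl (π y (normalised-nonzero n))))
        (difference≤⇒Δ≤ p-normalised n (∣∣-nonNeg κ) near))
      ∣κ∣<r

    -- Both vectors have norm 1, so G and the modified Green function differ by the same term.
    near⇒equal-green : ∀ {y z} → Normalised i y → Normalised i z → Near y → Near z → G y ℝ.≈ G z
    near⇒equal-green {y} {z} n m near-y near-z = begin-equality
      G y                                ≈⟨ ℝ.x≈[x-y]+y _ _ ⟩
      (G y ℝ.- log ‖ y ‖) ℝ.+ log ‖ y ‖  ≈⟨ ℝ.+-cong
          (constant (π y (normalised-nonzero n)) (π z (normalised-nonzero m)) (near⇒in-ball n near-y) (near⇒in-ball m near-z))
          (log-cong (‖‖-pos (normalised-nonzero n)) (ℝ.trans (normalised-norm n) (ℝ.sym (normalised-norm m)))) ⟩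
      (G z ℝ.- log ‖ z ‖) ℝ.+ log ‖ z ‖  ≈⟨ ℝ.x≈[x-y]+y _ _ ⟨
      G z                                ∎
      where open ≤-Reasoning

    -- Φⁿ is bounded by C₁ ‖ Φⁿ y ‖ on the disk y + t v, ∣ t ∣ ≤ 1, so the
    -- Schwarz lemma applies to t ↦ Φⁿ (y + t v), where z = y + θ v.
    difference-bound : ∀ {y z s} → Normalised i y → Normalised i z → Near y → Near z →
      (∀ j → ∣ z j - y j ∣ ℝ.≤ s) →
      ∀ n k → Dec (IsZero (λ j → z j - y j)) →
      ∣ Φ^ n z k - Φ^ n y k ∣ ℝ.≤ C₁ ℝ.* ‖ Φ^ n y ‖ ℝ.* (∣ κ ⁻¹ ∣ ℝ.* s)
    -- Equal vectors determine no line, so this case is separate.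
    difference-bound {y} {z} {s} ny nz near-y near-z z-y≤s n k (yes z≈y) = begin
      ∣ Φ^ n z k - Φ^ n y k ∣    ≈⟨ ∣∣-cong (+-congʳ (Φ^-cong n (λ j → x-y≈0⇒x≈y (z≈y j)) k)) ⟩
      ∣ Φ^ n y k - Φ^ n y k ∣    ≈⟨ ℝ.trans (∣∣-cong (-‿inverseʳ _)) ∣0∣≈0 ⟩
      ℝ.0#                       ≤⟨ ℝ.*-nonNeg (ℝ.*-nonNeg (ℝ.<⇒≤ 0<C₁) (‖‖-nonNeg (Φ^ n y)))
                                      (ℝ.*-nonNeg (∣∣-nonNeg _) (ℝ.≤-trans (∣∣-nonNeg _) (z-y≤s i))) ⟩
      C₁ ℝ.* ‖ Φ^ n y ‖ ℝ.* (∣ κ ⁻¹ ∣ ℝ.* s) ∎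
      where
      open ≤-Reasoning
      x-y≈0⇒x≈y : ∀ {x y} → x - y ≈ 0# → x ≈ y
      x-y≈0⇒x≈y {x} {y} eq = trans (solve 2 (λ x y → x := (x :- y) :+ y) refl x y)
        (trans (+-congʳ eq) (+-identityˡ y))
    difference-bound {y} {z} {s} ny nz near-y near-z z-y≤s n k (no z≉y) = begin
      ∣ Φ^ n z k - Φ^ n y k ∣                 ≈⟨ ∣∣-cong (+-cong (trans (at-θ) (sym (coefficients-value θ))) (-‿cong (trans at-0 (sym (coefficients-value 0#))))) ⟩
      ∣ horner coefficients θ - horner coefficients 0# ∣
                                              ≤⟨ schwarz closed coefficients bound θ ∣θ∣≤1 ⟩
      C₁ ℝ.* ‖ Φ^ n y ‖ ℝ.* ∣ θ ∣             ≤⟨ ℝ.*-monoˡ-≤ (ℝ.*-nonNeg (ℝ.<⇒≤ 0<C₁) (‖‖-nonNeg (Φ^ n y)))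
                                                   (ℝ.≤-respˡ-≈ (ℝ.sym (∣∣-* _ _)) (ℝ.*-monoˡ-≤ (∣∣-nonNeg _) (z-y≤s j))) ⟩
      C₁ ℝ.* ‖ Φ^ n y ‖ ℝ.* (∣ κ ⁻¹ ∣ ℝ.* s)  ∎
      where
      open ≤-Reasoning
      w v : Affine
      w l = z l - y l
      attained-w : ∃[ j ] ‖ w ‖ ℝ.≈ ∣ w j ∣
      attained-w = ‖‖-attained z≉y
      j : Fin (suc N)
      j = proj₁ attained-w
      ‖w‖≈ : ‖ w ‖ ℝ.≈ ∣ w j ∣
      ‖w‖≈ = proj₂ attained-w
      wⱼ≉0 : w j ≉ 0#
      wⱼ≉0 = ∣∣-pos⁻¹ (ℝ.<-respʳ-≈ ‖w‖≈ (‖‖-pos z≉y))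
      -- The displacement w factors as θ v, scaled by its largest coordinate w j: then ∣ v l ∣ ≤ ∣ κ
      -- ∣ keeps the unit disk of the line near p, while ∣ θ ∣ = ∣ κ⁻¹ ∣ ‖ w ‖ carries the distance
      -- from y to z.
      θ : Carrier
      θ = κ ⁻¹ * w j
      v l = κ * (w j ⁻¹ * w l)
      ∣w∣≤∣κ∣ : ∀ l → ∣ w l ∣ ℝ.≤ ∣ κ ∣
      ∣w∣≤∣κ∣ l = ℝ.≤-respˡ-≈ (∣∣-cong (solve 3 (λ z y p → (z :- p) :- (y :- p) := z :- y) refl (z l) (y l) (p l)))
        (ultra-minus-≤ (near-z l) (near-y l))
      ∣θ∣≤1 : ∣ θ ∣ ℝ.≤ ℝ.1#
      ∣θ∣≤1 = begin
        ∣ κ ⁻¹ * w j ∣           ≈⟨ ∣∣-* _ _ ⟩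
        ∣ κ ⁻¹ ∣ ℝ.* ∣ w j ∣     ≤⟨ ℝ.*-monoˡ-≤ (∣∣-nonNeg _) (∣w∣≤∣κ∣ j) ⟩
        ∣ κ ⁻¹ ∣ ℝ.* ∣ κ ∣       ≈⟨ ℝ.trans (ℝ.*-comm _ _) (∣∣-⁻¹ κ≉0) ⟩
        ℝ.1#                     ∎
      ∣v∣≤∣κ∣ : ∀ l → ∣ v l ∣ ℝ.≤ ∣ κ ∣
      ∣v∣≤∣κ∣ l = begin
        ∣ κ * (w j ⁻¹ * w l) ∣                   ≈⟨ ℝ.trans (∣∣-* _ _) (ℝ.*-congˡ (∣∣-* _ _)) ⟩
        ∣ κ ∣ ℝ.* (∣ w j ⁻¹ ∣ ℝ.* ∣ w l ∣)       ≤⟨ ℝ.*-monoˡ-≤ (∣∣-nonNeg κ) (ℝ.*-monoˡ-≤ (∣∣-nonNeg _)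
                                                    (ℝ.≤-respʳ-≈ ‖w‖≈ (∣xᵢ∣≤‖x‖ w l))) ⟩
        ∣ κ ∣ ℝ.* (∣ w j ⁻¹ ∣ ℝ.* ∣ w j ∣)       ≈⟨ ℝ.*-congˡ (ℝ.trans (ℝ.*-comm _ _) (∣∣-⁻¹ wⱼ≉0)) ⟩
        ∣ κ ∣ ℝ.* ℝ.1#                           ≈⟨ ℝ.*-identityʳ _ ⟩
        ∣ κ ∣                                    ∎
      line : Carrier → Affine
      line t l = y l + t * v l
      tv≤κ : ∀ {t} → ∣ t ∣ ℝ.≤ ℝ.1# → ∀ l → ∣ t * v l ∣ ℝ.≤ ∣ κ ∣
      tv≤κ ∣t∣≤1 l = ℝ.≤-trans (∣t∣≤1⇒∣tx∣≤∣x∣ (v l) ∣t∣≤1) (∣v∣≤∣κ∣ l)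
      -- Coordinate i is 1 in both y and z, so v i = 0 and the line stays in the chart.
      line-normalised : ∀ {t} → ∣ t ∣ ℝ.≤ ℝ.1# → Normalised i (line t)
      line-normalised {t} ∣t∣≤1 = record
        { at-i = trans (+-cong (at-i ny) (*-congˡ (*-congˡ (*-congˡ (+-cong (at-i nz) (-‿cong (at-i ny)))))))
            (solve 3 (λ t κ w → con (+ 1) :+ t :* (κ :* (w :* (con (+ 1) :- con (+ 1)))) := con (+ 1)) refl t κ (w j ⁻¹))
        ; unit = λ l → ultra-≤ (unit ny l) (ℝ.≤-trans (tv≤κ ∣t∣≤1 l) (ℝ.<⇒≤ ∣κ∣<1))
        }
      line-near : ∀ {t} → ∣ t ∣ ℝ.≤ ℝ.1# → Near (line t)
      line-near {t} ∣t∣≤1 l = ℝ.≤-respˡ-≈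
        (∣∣-cong (solve 3 (λ y p tv → (y :- p) :+ tv := (y :+ tv) :- p) refl (y l) (p l) (t * v l)))
        (ultra-≤ (near-y l) (tv≤κ ∣t∣≤1 l))
      -- With no parameters left (`n = 0`), the restriction to the line is a polynomial in t with
      -- coefficients in `K`.
      coefficients : List Carrier
      coefficients = expand {n = 0} (λ l → const (y l) ∷ const (v l) ∷ []) (Φ^ₑ n k) at (λ ())
      coefficients-value : ∀ t → horner coefficients t ≈ Φ^ n (line t) k
      coefficients-value t = trans (horner-expand {n = 0} _ (Φ^ₑ n k) (λ ()) t) (trans
        (⟦⟧ₑ-cong (Φ^ₑ n k) (λ l → +-congˡ (*-congˡ (trans (+-congˡ (zeroʳ t)) (+-identityʳ (v l))))))
        (⟦Φ^ₑ⟧ n k (line t)))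
      bound : ∀ t → ∣ t ∣ ℝ.≤ ℝ.1# → ∣ horner coefficients t ∣ ℝ.≤ C₁ ℝ.* ‖ Φ^ n y ‖
      bound t ∣t∣≤1 = ℝ.≤-trans
        (ℝ.≤-respˡ-≈ (∣∣-cong (sym (coefficients-value t))) (∣xᵢ∣≤‖x‖ (Φ^ n (line t)) k))
        (equal-green⇒comparable (normalised-nonzero (line-normalised ∣t∣≤1)) (normalised-nonzero ny)
          (near⇒equal-green (line-normalised ∣t∣≤1) ny (line-near ∣t∣≤1) near-y) n)
      at-θ : Φ^ n z k ≈ Φ^ n (line θ) k
      at-θ = Φ^-cong n (λ l → trans
        (solve 2 (λ z y → z := y :+ con (+ 1) :* con (+ 1) :* (z :- y)) refl (z l) (y l))
        (+-congˡ (trans (*-congʳ (*-cong (sym (*-inverseʳ κ≉0)) (sym (*-inverseʳ wⱼ≉0))))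
          (solve 5 (λ κ κ′ a a′ b → (κ :* κ′) :* (a :* a′) :* b := (κ′ :* a) :* (κ :* (a′ :* b))) refl
            κ (κ ⁻¹) (w j) (w j ⁻¹) (w l))))) k
      at-0 : Φ^ n y k ≈ Φ^ n (line 0#) k
      at-0 = Φ^-cong n (λ l → sym (trans (+-congˡ (zeroˡ _)) (+-identityʳ _))) k

    -- One C₁ comes from the bound on the disk, the other from exchanging ‖ Φⁿ y ‖ for ‖ Φⁿ z ‖, and
    -- ∣ κ⁻¹ ∣ from rescaling the disk to radius 1.
    C : ℝ.Carrier
    C = C₁ ℝ.* C₁ ℝ.* ∣ κ ⁻¹ ∣

    0<C : ℝ.0# ℝ.< C
    0<C = ℝ.*-pos (ℝ.*-pos 0<C₁ 0<C₁) (∣∣-pos (⁻¹-nonzero κ≉0))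

    normalise-near : ∀ Q → Δ P Q ℝ.≤ ∣ κ ∣ → Normalisation i (coords Q)
    normalise-near Q ΔPQ≤κ = normalise (nonzero Q)
      (near⇒norm-attained P Q (ℝ.≤-<-trans ΔPQ≤κ ∣κ∣<1) (proj₂ attained))

    normalised-point : ∀ {x} → Normalisation i x → Point
    normalised-point n = π (Normalisation.x̂ n) (normalised-nonzero (Normalisation.normalised n))

    normalisation-near : ∀ Q (n : Normalisation i (coords Q)) → Δ P Q ℝ.≤ ∣ κ ∣ → Near (Normalisation.x̂ n)
    normalisation-near Q n ΔPQ≤κ = Δ≤⇒difference≤ p-normalised (Normalisation.normalised n) (ℝ.≤-trans
      (Δ-cong-≤ {P} {normalised-point P-normalisation} {Q} {normalised-point n}
        (normalisation-≈ₚ P P-normalisation) (normalisation-≈ₚ Q n)) ΔPQ≤κ)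

    lipschitz-bound : ∀ Q R → Δ P Q ℝ.≤ ∣ κ ∣ → Δ P R ℝ.≤ ∣ κ ∣ →
                      ∀ n → Δ (iterate φ n Q) (iterate φ n R) ℝ.≤ C ℝ.* Δ Q R
    lipschitz-bound Q R ΔPQ≤κ ΔPR≤κ n = ℝ.≤-trans
      (Δ-cong-≤ {Φ^-point n Q̂} {iterate φ n Q} {Φ^-point n R̂} {iterate φ n R} (to-iterate Q nQ) (to-iterate R nR))
      (minor≤⇒Δ≤ (Φ^-point n Q̂) (Φ^-point n R̂) (ℝ.*-nonNeg (ℝ.<⇒≤ 0<C) (Δ-nonNeg Q R)) λ a b → begin
        ∣ minor Y Z a b ∣                                  ≈⟨ ∣∣-cong (solve 4 (λ ya yb za zb →
            ya :* zb :- yb :* za := ya :* (zb :- yb) :- yb :* (za :- ya)) refl (Y a) (Y b) (Z a) (Z b)) ⟩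
        ∣ Y a * (Z b - Y b) - Y b * (Z a - Y a) ∣          ≤⟨ ultra-minus-≤ (product-≤ a b) (product-≤ b a) ⟩
        -- The estimate carries ‖ Y ‖ twice, but Δ is normalised by ‖ Y ‖ ‖ Z ‖, so one factor is
        -- traded.
        ‖ Y ‖ ℝ.* (C₁ ℝ.* ‖ Y ‖ ℝ.* (∣ κ ⁻¹ ∣ ℝ.* s))      ≤⟨ ℝ.*-monoˡ-≤ (‖‖-nonNeg Y) (ℝ.*-monoʳ-≤ 0≤κs
            (ℝ.*-monoˡ-≤ (ℝ.<⇒≤ 0<C₁) Y≤C₁Z)) ⟩
        ‖ Y ‖ ℝ.* (C₁ ℝ.* (C₁ ℝ.* ‖ Z ‖) ℝ.* (∣ κ ⁻¹ ∣ ℝ.* s))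
                                                           ≈⟨ ℝ.rearrange₄ _ _ _ _ _ ⟩
        C ℝ.* s ℝ.* (‖ Y ‖ ℝ.* ‖ Z ‖)                      ∎)
      where
      open ≤-Reasoning
      nQ = normalise-near Q ΔPQ≤κ
      nR = normalise-near R ΔPR≤κ
      Q̂ = normalised-point nQ
      R̂ = normalised-point nR
      open Normalisation nQ using () renaming (x̂ to y; normalised to y-normalised)
      open Normalisation nR using () renaming (x̂ to z; normalised to z-normalised)
      y-near = normalisation-near Q nQ ΔPQ≤κ
      z-near = normalisation-near R nR ΔPR≤κ
      Y = Φ^ n y
      Z = Φ^ n z
      s = Δ Q R
      0≤κs : ℝ.0# ℝ.≤ ∣ κ ⁻¹ ∣ ℝ.* s
      0≤κs = ℝ.*-nonNeg (∣∣-nonNeg _) (Δ-nonNeg Q R)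
      to-iterate : ∀ Q (m : Normalisation i (coords Q)) → Φ^-point n (normalised-point m) ≈ₚ iterate φ n Q
      to-iterate Q m = ≈ₚ-sym {iterate φ n Q} {Φ^-point n (normalised-point m)}
        (≈ₚ-trans {iterate φ n Q} {iterate φ n (normalised-point m)} {Φ^-point n (normalised-point m)}
          (iterate-cong n {Q} {normalised-point m} (normalisation-≈ₚ Q m)) (iterate-lift n (normalised-point m)))
      Y≤C₁Z : ‖ Y ‖ ℝ.≤ C₁ ℝ.* ‖ Z ‖
      Y≤C₁Z = equal-green⇒comparable (normalised-nonzero y-normalised) (normalised-nonzero z-normalised)
        (near⇒equal-green y-normalised z-normalised y-near z-near) n
      z-y≤s : ∀ j → ∣ z j - y j ∣ ℝ.≤ s
      z-y≤s = Δ≤⇒difference≤ y-normalised z-normalised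
        (Δ-cong-≤ {Q} {Q̂} {R} {R̂} (normalisation-≈ₚ Q nQ) (normalisation-≈ₚ R nR))
      product-≤ : ∀ a b → ∣ Y a * (Z b - Y b) ∣ ℝ.≤ ‖ Y ‖ ℝ.* (C₁ ℝ.* ‖ Y ‖ ℝ.* (∣ κ ⁻¹ ∣ ℝ.* s))
      product-≤ a b = ℝ.≤-respˡ-≈ (ℝ.sym (∣∣-* _ _)) (ℝ.*-mono-≤ (‖‖-nonNeg Y) (∣∣-nonNeg _) (∣xᵢ∣≤‖x‖ Y a)
        (difference-bound y-normalised z-normalised y-near z-near z-y≤s n b em))

  constant⇒lipschitz : ∀ P → ConstantNear (modifiedGreen G) P → LocallyUniformlyLipschitzAt φ P
  constant⇒lipschitz P (U , openU , P∈U , constant) = ∣ κ ∣ , C , ∣∣-pos κ≉0 , 0<C , lipschitz-bound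
    where
    ball = openU P P∈U
    open ConstantOnBall P (proj₁ (proj₂ ball))
      (λ Q R Q∈ R∈ → constant Q R (proj₂ (proj₂ ball) Q Q∈) (proj₂ (proj₂ ball) R R∈))

open import Data.Nat.Base using (_≤_)

theorem23 :
    (∀ {a} → ExcludedMiddle a) →
    ∀ (ℝ : RealNumbers) (ln : NaturalLog ℝ)
      {c ℓ} (K : NonarchimedeanField ℝ c ℓ) →
    AlgebraicallyClosed (NonarchimedeanField.baseField K) →
    Complete ℝ K → Nontrivial ℝ K →
    ∀ (N d : ℕ) → 2 ≤ d →
    let open Dynamics ln K N in
    ∀ (φ : Morphism d) (Φ : PolynomialMap) →
    IsLift d (Morphism.map φ) Φ →
    ∀ G → IsGreenFunction d Φ G →
    ∀ P →
    (FatouSet φ P ⇔ LocallyUniformlyLipschitzAt φ P) ×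
    (LocallyUniformlyLipschitzAt φ P ⇔ ConstantNear (modifiedGreen G) P)
theorem23 em ℝ ln K closed _ nontrivial N d 2≤d φ Φ lift G green P =
  mk⇔ (λ fatou → constant⇒lipschitz P (fatou⇒constant P fatou)) (lipschitz⇒fatou P) ,
  mk⇔ (λ lipschitz → fatou⇒constant P (lipschitz⇒fatou P lipschitz)) (constant⇒lipschitz P)
  where open Equivalence em ln K closed nontrivial N d 2≤d φ Φ lift G green
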